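{- Let $A,B$ be multiplicative characters of $\mathbb{F}_q$ such that $A^2$, $B^2$, $A\overline{B}\varphi$, $AB$, $AB\varphi$ are all different from $\varepsilon$. Then for every $x\in\mathbb{F}_q$ with $x\neq1$ and $x\neq\frac12$, \begin{align*} {}_2F_1(A,B;\,AB\varphi\mid 4x(1-x))^2&=\frac{AB(4)\,g(B)^2g(A\varphi)^2}{q\,g(A^2)\,g(B^2)}\,{}_3F_2(A^2,B^2,AB;\,A^2B^2,AB\varphi\mid 4x(1-x))\\ &\quad+\frac{g(B)^2g(A\varphi)^2\,(\overline{A}\,\overline{B}\varphi)(x-x^2)}{q^2\,g(A^2)\,g(B^2)}. \end{align*}
   Context: Let $p$ be an odd prime, $q=p^r$, and $\mathbb{F}_q$ the field with $q$ elements. Multiplicative characters of $\mathbb{F}_q^\times$ are extended to $\mathbb{F}_q$ by $\chi(0)=0$ (including the trivial character $\varepsilon$). $\varphi$ is the quadratic character. Characters are multiplied pointwise, $\overline{A}$ is the inverse of $A$, and e.g. $(\overline{A}\,\overline{B}\varphi)(x-x^2)$ means the product character evaluated at $x-x^2$. The Gauss sum is $g(\chi)=\sum_{x\in\mathbb{F}_q}\chi(x)\theta(x)$ with $\theta(\alpha)=\zeta_p^{\mathrm{tr}(\alpha)}$, $\zeta_p$ a fixed primitive $p$-th root of unity, $\mathrm{tr}$ the trace to $\mathbb{F}_p$. The binomial coefficient is $\binom{A}{B}=\frac{B(-1)}{q}\sum_{x\in\mathbb{F}_q}A(x)\overline{B}(1-x)$. Greene's series: ${}_{n+1}F_n(A_0,\dots,A_n;\,B_1,\dots,B_n\mid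 x)=\frac{q}{q-1}\sum_{\chi}\binom{A_0\chi}{\chi}\prod_{i=1}^n\binom{A_i\chi}{B_i\chi}\chi(x)$, summed over all multiplicative characters $\chi$. -}

module Defs where

open import Level using (0ℓ)
open import Data.Nat as ℕ using (ℕ; zero; suc; _<_; _≤_)
open import Data.Nat.Primality using (Prime)
open import Data.Nat.Divisibility using (_∣_)
open import Data.List using (List; []; _∷_; foldr; length; upTo; map)
open import Data.List.Membership.Propositional using (_∈_)
open import Data.List.Relation.Unary.Unique.Propositional using (Unique)
open import Data.Product using (∃; _×_)
open import Data.Bool using (Bool; true; false; if_then_else_)
open import Relation.Nullary using (¬_; Dec; yes; no; does)
open import Relation.Binary.PropositionalEquality using (_≡_)
open import Relation.Binary.Definitions using (DecidableEquality)
open import Algebra.Structures using (IsCommutativeRing)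

natCast : {X : Set} → X → X → (X → X → X) → ℕ → X
natCast z o add zero = z
natCast z o add (suc n) = add o (natCast z o add n)

power : {X : Set} → X → (X → X → X) → X → ℕ → X
power o mul x zero = o
power o mul x (suc n) = mul x (power o mul x n)

-- A finite field F_q, q = p^r, p an odd prime, given concretely:
-- a commutative ring (with propositional equality) in which every
-- nonzero element is invertible, together with an exhaustive
-- duplicate-free enumeration of its elements, of length p^r.
-- The remaining fields (characteristic p, a generator of F_q^×) are
-- true of every finite field of order p^r and are recorded as data
-- so that the trace and the list of all characters can be computed.

record FiniteField : Set₁ where
  infixl 6 _+_
  infixl 7 _*_
  field
    F    : Set
    _+_  : F → F → F
    _*_  : F → F → F
    -_   : F → F
    0#   : F
    1#   : F
    isCommutativeRing : IsCommutativeRing _≡_ _+_ _*_ -_ 0# 1#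
    _≟_  : DecidableEquality F
    0≢1  : ¬ (0# ≡ 1#)
    inv  : F → F
    inv-r : ∀ x → ¬ (x ≡ 0#) → x * inv x ≡ 1#
    elems : List F
    elems-unique : Unique elems
    elems-complete : ∀ x → x ∈ elems
    p    : ℕ
    r    : ℕ
    p-prime : Prime p
    p-odd   : ¬ (2 ∣ p)
    r-pos   : 1 ≤ r
    card    : length elems ≡ p ℕ.^ r

    char-p : natCast 0# 1# _+_ p ≡ 0#
    gen    : F
    gen-generates : ∀ x → ¬ (x ≡ 0#) →
                    ∃ λ j → (j < p ℕ.^ r ℕ.∸ 1) × (power 1# _*_ gen j ≡ x)

  _×1 : ℕ → F
  _×1 = natCast 0# 1# _+_

  _^_ : F → ℕ → F
  _^_ = power 1# _*_

-- A field of characteristic 0 in which the character values and Gauss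
-- sums live (in the paper: ℂ).

record CharZeroField : Set₁ where
  infixl 6 _+_
  infixl 7 _*_
  field
    K    : Set
    _+_  : K → K → K
    _*_  : K → K → K
    -_   : K → K
    0#   : K
    1#   : K
    isCommutativeRing : IsCommutativeRing _≡_ _+_ _*_ -_ 0# 1#
    0≢1  : ¬ (0# ≡ 1#)
    inv  : K → K
    inv-r : ∀ x → ¬ (x ≡ 0#) → x * inv x ≡ 1#

    char-0 : ∀ n → natCast 0# 1# _+_ n ≡ 0# → n ≡ 0

  _×1 : ℕ → K
  _×1 = natCast 0# 1# _+_

  _^_ : K → ℕ → K
  _^_ = power 1# _*_

-- Everything below is relative to a finite field 𝔽, a target field 𝕂,
-- a primitive p-th root of unity ζ ∈ K (for θ) and a primitive
-- (q-1)-th root of unity ω ∈ K (used to list all characters).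

module Setup (𝔽 : FiniteField) (𝕂 : CharZeroField)
             (ζ ω : CharZeroField.K 𝕂) where

  open FiniteField 𝔽 renaming
    (_+_ to _+F_; _*_ to _*F_; -_ to -F_; 0# to 0F; 1# to 1F;
     inv to invF; _×1 to _×1F; _^_ to _^F_)
  open CharZeroField 𝕂

  q : ℕ
  q = p ℕ.^ r

  Σ[_]_ : {X : Set} → List X → (X → K) → K
  Σ[ xs ] f = foldr (λ x acc → f x + acc) 0# xs

  _/_ : K → K → K
  a / b = a * inv b

  qK : K
  qK = q ×1

  Char : Set
  Char = F → K

  record IsCharacter (χ : Char) : Set where
    field
      χ-0   : χ 0F ≡ 0#
      χ-1   : χ 1F ≡ 1#
      χ-mul : ∀ x y → χ (x *F y) ≡ χ x * χ y

  infixl 7 _·_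
  _·_ : Char → Char → Char
  (A · B) x = A x * B x

  conj : Char → Char
  conj A x with x ≟ 0F
  ... | yes _ = 0#
  ... | no  _ = A (invF x)

  ε : Char
  ε x with x ≟ 0F
  ... | yes _ = 0#
  ... | no  _ = 1#

  _≈χ_ : Char → Char → Set
  A ≈χ B = ∀ x → A x ≡ B x

  find : {X : Set} → (X → Bool) → X → List X → X
  find t d [] = d
  find t d (x ∷ xs) = if t x then x else find t d xs

  any : {X : Set} → (X → Bool) → List X → Bool
  any t [] = false
  any t (x ∷ xs) = if t x then true else any t xs

  isSquare : F → Bool
  isSquare x = any (λ y → does ((y *F y) ≟ x)) elems

  φ : Char
  φ x with x ≟ 0F
  ... | yes _ = 0#
  ... | no  _ = if isSquare x then 1# else - 1#

  dlog : F → ℕ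
  dlog x = find (λ j → does ((gen ^F j) ≟ x)) 0 (upTo (q ℕ.∸ 1))

  χ[_] : ℕ → Char
  χ[ k ] x with x ≟ 0F
  ... | yes _ = 0#
  ... | no  _ = ω ^ (k ℕ.* dlog x)

  allChars : List Char
  allChars = map χ[_] (upTo (q ℕ.∸ 1))

  tr : F → F
  tr α = foldr (λ i acc → (α ^F (p ℕ.^ i)) +F acc) 0F (upTo r)

  -- the natural number k < p with k·1 = t (for t in the prime field)
  toℕ : F → ℕ
  toℕ t = find (λ k → does ((k ×1F) ≟ t)) 0 (upTo p)

  θ : F → K
  θ α = ζ ^ toℕ (tr α)

  g : Char → K
  g χ = Σ[ elems ] (λ x → χ x * θ x)

  binom : Char → Char → K
  binom A B = (B (-F 1F) / qK) * Σ[ elems ] (λ x → A x * conj B (1F +F (-F x)))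

  -- Greene's 2F1 and 3F2
  ₂F₁ : Char → Char → Char → F → K
  ₂F₁ A₀ A₁ B₁ x =
    (qK / ((q ℕ.∸ 1) ×1)) *
    Σ[ allChars ] (λ χ → binom (A₀ · χ) χ * binom (A₁ · χ) (B₁ · χ) * χ x)

  ₃F₂ : Char → Char → Char → Char → Char → F → K
  ₃F₂ A₀ A₁ A₂ B₁ B₂ x =
    (qK / ((q ℕ.∸ 1) ×1)) *
    Σ[ allChars ] (λ χ → binom (A₀ · χ) χ * binom (A₁ · χ) (B₁ · χ)
                          * binom (A₂ · χ) (B₂ · χ) * χ x)

  2F 4F : F
  2F = 1F +F 1F
  4F = 2F +F 2F

  Theorem1p3 : Set
  Theorem1p3 =
    ζ ^ p ≡ 1# → ¬ (ζ ≡ 1#) →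
    ω ^ (q ℕ.∸ 1) ≡ 1# → (∀ k → 0 < k → k < q ℕ.∸ 1 → ¬ (ω ^ k ≡ 1#)) →
    (A B : Char) → IsCharacter A → IsCharacter B →
    ¬ ((A · A) ≈χ ε) → ¬ ((B · B) ≈χ ε) → ¬ ((A · conj B · φ) ≈χ ε) →
    ¬ ((A · B) ≈χ ε) → ¬ ((A · B · φ) ≈χ ε) →
    (x : F) → ¬ (x ≡ 1F) → ¬ (x ≡ invF 2F) →
    ₂F₁ A B (A · B · φ) (z x) * ₂F₁ A B (A · B · φ) (z x)
      ≡ ((A · B) 4F * G A B) / (qK * g (A · A) * g (B · B))
          * ₃F₂ (A · A) (B · B) (A · B) ((A · A) · (B · B)) (A · B · φ) (z x)
        + (G A B * (conj A · conj B · φ) (x +F (-F (x *F x))))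
          / (qK * qK * g (A · A) * g (B · B))
    where
    z : F → F
    z x = 4F *F (x *F (1F +F (-F x)))
    G : Char → Char → K
    G A B = g B * g B * g (A · φ) * g (A · φ)

{-# OPTIONS --safe #-}
module Submission where

-- Everything is reduced to sums over F. Write C = AB, D = A B̄, y = 1 - z. Orthogonality of characters gives
--   ₂F₁(A,B;Cφ|z) = Cφ(-1)/q · P(A,B),   P(A,B) = Σ_b B(b) Aφ(1+b) Ā(1+zb),
--   ₃F₂(A²,B²,C;C²,Cφ|z) = Cφ(-1)/q² · S  with S a double sum.
-- Expanding with Gauss sums shows g(A) g(Bφ) P(A,B) = C(-1) g(B) g(Aφ) P(B,A), so the square of P(A,B)
-- is, up to Gauss sums that the Hasse-Davenport relation simplifies, the product P(A,B) P(B,A).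
-- In that product
--   P(A,B) P(B,A) = Σ_{a,b} A(α) B(β) φ(ξ),  α = b(1+a)/(1+za),  β = a(1+b)/(1+zb),  ξ = (1+a)(1+b),
-- and ξ is a root of ξ² - Xξ + αβy², X = 1+α+β+αβz². Trading the sum of φ(ξ) over the roots for the sum
-- of φ(X - 2γy) over the square roots γ of αβ, and then parametrising α = γρ, β = γ/ρ, gives
--   Σ_{γ,ρ} C(γ) D(ρ) φ((1+γz)² + γ(ρ-1)²/ρ),
-- which is S in other coordinates; the exceptional points produce the extra term q C̄φ(-z) φ(y).
-- For z = 4x(1-x) the element y = (1-2x)² is a nonzero square.
--
-- K has no decidable equality, so no argument splits on whether a character is trivial:
-- nontriviality enters only through Σ χ = 0 and through explicit inverses.

open import Defs
open import Algebra.Bundles using (CommutativeRing)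
open import Algebra.Structures using (IsCommutativeRing)
import Algebra.Solver.Ring
open import Algebra.Solver.Ring.AlmostCommutativeRing using (fromCommutativeRing; _-Raw-AlmostCommutative⟶_)
open import Data.Bool using (Bool; true; false; if_then_else_)
open import Data.Empty using (⊥-elim)
open import Data.Fin as Fin using (inject₁; fromℕ)
open import Data.Fin.Properties using (toℕ-inject₁; toℕ<n; toℕ-fromℕ)
open import Data.Integer as ℤ using (ℤ; -[1+_]) renaming (+_ to pos)
import Data.Integer.Properties as ℤₚ
open import Data.List using (List; []; _∷_; foldr; length; upTo; applyUpTo; map; _++_)
open import Data.List.Membership.Propositional using (_∈_)
open import Data.List.Membership.Propositional.Properties
  using (∈-∃++; ∈-map⁺; ∈-map⁻; ∈-upTo⁺; ∈-upTo⁻; ∈-++⁻; ∈-++⁺ˡ; ∈-++⁺ʳ)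
open import Data.List.Properties using (length-map; length-upTo; length-++; map-upTo)
import Data.List.Relation.Unary.All as All
import Data.List.Relation.Unary.All.Properties as Allₚ
open import Data.List.Relation.Unary.AllPairs using ([]; _∷_)
open import Data.List.Relation.Unary.Any as Any using (here; there)
open import Data.List.Relation.Unary.Unique.Propositional using (Unique)
import Data.List.Relation.Unary.Unique.Propositional.Properties as Uniqueₚ
open import Data.Maybe using (Maybe; just; nothing)
open import Data.Nat as ℕ using (ℕ; zero; suc; _<_; _≤_; z≤n; s≤s; _∸_)
open import Data.Nat.Base using (_!)
open import Data.Nat.Combinatorics using (_C_; nCn≡1; [n∸k]!k!∣n!)
open import Data.Nat.Combinatorics.Specification using (nCk≡n!/k![n-k]!)
open import Data.Nat.Coprimality using (Coprime; coprime-Bézout; prime⇒coprime)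
open import Data.Nat.Divisibility using (_∣_; divides; ∣⇒≤; m∣m*n; n∣m*n; m%n≡0⇒n∣m)
open import Data.Nat.DivMod using (m/n*n≡m; _%_; m≡m%n+[m/n]*n; m%n<n; m*n/n≡m)
open import Data.Nat.GCD using (module Bézout)
open import Data.Nat.Primality as Primality using (Prime; euclidsLemma)
import Data.Nat.Properties as ℕₚ
open import Data.Nat.Properties using (_!*_!≢0)
open import Data.Product using (_×_; _,_; proj₁; proj₂; ∃)
open import Data.Sum using (_⊎_; inj₁; inj₂)
open import Data.Vec as Vec using (Vec)
open import Data.Vec.N-ary using (N-ary; ∀ⁿ; curryⁿ; _$ⁿ_; uncurry-∀ⁿ; left-inverse)
open import Function.Bundles using (module Equivalence)
open import Relation.Binary.Definitions using (DecidableEquality)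
open import Relation.Binary.PropositionalEquality
open import Relation.Nullary using (¬_; Dec; yes; no; does)
open import Relation.Nullary.Decidable using (¬?; decidable-stable)

-- The product P(A,B) P(B,A) is easier to treat than the square because its factors at 1 + a, 1 + b,
-- 1 + za and 1 + zb group into a single argument for each of A, B and φ. What then blocks a
-- comparison with the ₃F₂ is that φ sits at a root of a quadratic, which is not a rational function
-- of α and β. Passing to X - 2γy costs only a square root γ of αβ, which the coordinates (γ, ρ)
-- rationalise. The trade needs y ≠ 0, that is x ≠ 1/2. The substitutions are fractional linear, so
-- each of them misses a few points. The inverse is therefore made total by `i 0# ≡ 0#`, which gives
-- χ(i x) = conj χ x everywhere, and `reindex` accepts maps that are inverse to each other only
-- where the summands do not vanish. The missed points are evaluated by hand, since the correction
-- terms come from them. The field record supplies a generator, but neither its exact order nor any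
-- property of the trace. Both have to be derived before Gauss sums can be used.

-- Commutative rings and polynomial identities.

record Ring≡ : Set₁ where
  infixl 6 _+_
  infixl 7 _*_
  field
    R : Set
    _+_ _*_ : R → R → R
    -_ : R → R
    0# 1# : R
    isCommutativeRing : IsCommutativeRing _≡_ _+_ _*_ -_ 0# 1#

module RingSolver (𝓡 : Ring≡) where
  open Ring≡ 𝓡

  commutativeRing : CommutativeRing _ _
  commutativeRing = record { isCommutativeRing = isCommutativeRing }

  open CommutativeRing commutativeRing public
    using (+-assoc; +-comm; +-identityˡ; +-identityʳ; -‿inverseʳ;
           *-assoc; *-comm; *-identityˡ; *-identityʳ; distribˡ; distribʳ;
           zeroˡ; zeroʳ; ring; semiring; commutativeSemiring)
  open import Algebra.Properties.Ring ring public
    using (-0#≈0#; -‿involutive; -‿+-comm; -‿distribˡ-*; -‿distribʳ-*)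
  open import Algebra.Properties.Semiring.Mult.TCOptimised semiring
    using (×-homo-+; ×1-homo-*; 1+×) renaming (_×_ to _×ⁿ_)

  -- The solver takes its coefficients from ℤ, where equality is decidable, and not from R, where it
  -- need not be. The optimised multiple `_×ⁿ_` makes the images of 0 and 1 reduce to `0#` and `1#`.
  ⟦_⟧ℤ : ℤ → R
  ⟦ pos n ⟧ℤ      = n ×ⁿ 1#
  ⟦ -[1+ n ] ⟧ℤ = - (suc n ×ⁿ 1#)

  private
    ⊖-homo : ∀ m n → ⟦ m ℤ.⊖ n ⟧ℤ ≡ (m ×ⁿ 1#) + (- (n ×ⁿ 1#))
    ⊖-homo m zero = sym (trans (cong ((m ×ⁿ 1#) +_) -0#≈0#) (+-identityʳ _))
    ⊖-homo zero (suc n) = sym (+-identityˡ _)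
    ⊖-homo (suc m) (suc n) = begin
      ⟦ suc m ℤ.⊖ suc n ⟧ℤ              ≡⟨ cong ⟦_⟧ℤ (ℤₚ.[1+m]⊖[1+n]≡m⊖n m n) ⟩
      ⟦ m ℤ.⊖ n ⟧ℤ                      ≡⟨ ⊖-homo m n ⟩
      M + (- N)                         ≡⟨ cong (_+ (- N)) (sym (+-identityˡ M)) ⟩
      (0# + M) + (- N)
        ≡⟨ cong (λ u → (u + M) + (- N)) (sym (-‿inverseʳ 1#)) ⟩
      ((1# + (- 1#)) + M) + (- N)
        ≡⟨ cong (_+ (- N)) (trans (+-assoc _ _ _) (trans (cong (1# +_) (+-comm _ _)) (sym (+-assoc _ _ _)))) ⟩
      ((1# + M) + (- 1#)) + (- N)       ≡⟨ +-assoc _ _ _ ⟩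
      (1# + M) + ((- 1#) + (- N))       ≡⟨ cong ((1# + M) +_) (-‿+-comm 1# N) ⟩
      (1# + M) + (- (1# + N))
        ≡⟨ cong₂ (λ u v → u + (- v)) (sym (1+× m 1#)) (sym (1+× n 1#)) ⟩
      (suc m ×ⁿ 1#) + (- (suc n ×ⁿ 1#)) ∎
      where
      open ≡-Reasoning
      M N : R
      M = m ×ⁿ 1#
      N = n ×ⁿ 1#

    +-homoℤ : ∀ i j → ⟦ i ℤ.+ j ⟧ℤ ≡ ⟦ i ⟧ℤ + ⟦ j ⟧ℤ
    +-homoℤ (pos m) (pos n) = ×-homo-+ 1# m n
    +-homoℤ (pos m) -[1+ n ] = ⊖-homo m (suc n)
    +-homoℤ -[1+ m ] (pos n) = trans (⊖-homo n (suc m)) (+-comm _ _)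
    +-homoℤ -[1+ m ] -[1+ n ] = trans (cong (λ k → - (k ×ⁿ 1#)) (cong suc (sym (ℕₚ.+-suc m n))))
      (trans (cong -_ (×-homo-+ 1# (suc m) (suc n))) (sym (-‿+-comm _ _)))

    neg-homoℤ : ∀ i → ⟦ ℤ.- i ⟧ℤ ≡ - ⟦ i ⟧ℤ
    neg-homoℤ (pos zero) = sym -0#≈0#
    neg-homoℤ (pos (suc n)) = refl
    neg-homoℤ -[1+ n ] = sym (-‿involutive _)

    *-homo⁺ : ∀ m j → ⟦ pos m ℤ.* j ⟧ℤ ≡ ⟦ pos m ⟧ℤ * ⟦ j ⟧ℤ
    *-homo⁺ m (pos n) = trans (cong ⟦_⟧ℤ (sym (ℤₚ.pos-* m n))) (×1-homo-* m n)
    *-homo⁺ m -[1+ n ] = trans (cong ⟦_⟧ℤ (sym (ℤₚ.neg-distribʳ-* (pos m) (pos (suc n)))))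
      (trans (neg-homoℤ (pos m ℤ.* pos (suc n)))
        (trans (cong -_ (*-homo⁺ m (pos (suc n)))) (-‿distribʳ-* _ _)))

    *-homoℤ : ∀ i j → ⟦ i ℤ.* j ⟧ℤ ≡ ⟦ i ⟧ℤ * ⟦ j ⟧ℤ
    *-homoℤ (pos m) j = *-homo⁺ m j
    *-homoℤ -[1+ m ] j = trans (cong ⟦_⟧ℤ (sym (ℤₚ.neg-distribˡ-* (pos (suc m)) j)))
      (trans (neg-homoℤ (pos (suc m) ℤ.* j)) (trans (cong -_ (*-homo⁺ (suc m) j)) (-‿distribˡ-* _ _)))

    coefficients : ℤ.+-*-rawRing -Raw-AlmostCommutative⟶ fromCommutativeRing commutativeRing
    coefficients = record
      { ⟦_⟧ = ⟦_⟧ℤ ; +-homo = +-homoℤ ; *-homo = *-homoℤ ; -‿homo = neg-homoℤ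
      ; 0-homo = refl ; 1-homo = refl }

    _coeff≟_ : ∀ i j → Maybe (⟦ i ⟧ℤ ≡ ⟦ j ⟧ℤ)
    i coeff≟ j with i ℤ.≟ j
    ... | yes i≡j = just (cong ⟦_⟧ℤ i≡j)
    ... | no  _   = nothing

    module Solver = Algebra.Solver.Ring ℤ.+-*-rawRing (fromCommutativeRing commutativeRing)
                      coefficients _coeff≟_

  open Solver public using (Polynomial; con; _:+_; _:*_; :-_)

  infix 4 _:=_
  _:=_ : ∀ {n} → Polynomial n → Polynomial n → Polynomial n × Polynomial n
  _:=_ = _,_

  :1 :0 : ∀ {n} → Polynomial n
  :1 = con (pos 1)
  :0 = con (pos 0)

  private
    closed : ∀ n → N-ary n (Polynomial n) (Polynomial n × Polynomial n) →
             Polynomial n × Polynomial n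
    closed n f = f $ⁿ Vec.map Solver.var (Vec.allFin n)

  -- Normal forms are compared as closed syntax, so `refl` never inspects elements of R.
  solve : ∀ n (f : N-ary n (Polynomial n) (Polynomial n × Polynomial n)) →
          Solver.normalise (proj₁ (closed n f)) ≡ Solver.normalise (proj₂ (closed n f)) →
          ∀ⁿ n (curryⁿ (λ ρ → Solver.⟦ proj₁ (closed n f) ⟧ ρ ≡ Solver.⟦ proj₂ (closed n f) ⟧ ρ))
  solve n f same = Equivalence.from (uncurry-∀ⁿ n) λ ρ →
    subst (λ P → P) (sym (left-inverse _ ρ))
      (Solver.prove ρ (proj₁ (closed n f)) (proj₂ (closed n f))
        (cong (λ e → Solver.⟦ e ⟧N ρ) same))

  move : ∀ {l r} → l + (- r) ≡ 0# → l ≡ r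
  move {l} {r} h = trans (solve 2 (λ l r → l := (l :+ (:- r)) :+ r) refl l r)
                         (trans (cong (_+ r) h) (+-identityˡ r))

  diff-0 : ∀ {a b} → a ≡ b → a + (- b) ≡ 0#
  diff-0 {a} refl = -‿inverseʳ a

  -- A certificate for reasoning modulo a relation such as x * i x = 1: the multiplier k is given by
  -- hand, and the remaining polynomial identity is left to the solver. `lin₂` does the same modulo
  -- two relations.
  lin₁ : ∀ {l r a b} k → a ≡ b → l + (- r) ≡ k * (a + (- b)) → l ≡ r
  lin₁ k h e = move (trans e (trans (cong (k *_) (diff-0 h)) (zeroʳ k)))

  lin₂ : ∀ {l r a b c d} k m → a ≡ b → c ≡ d →
         l + (- r) ≡ (k * (a + (- b))) + (m * (c + (- d))) → l ≡ r
  lin₂ k m h h′ e = move (trans e (trans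
    (cong₂ _+_ (trans (cong (k *_) (diff-0 h)) (zeroʳ k)) (trans (cong (m *_) (diff-0 h′)) (zeroʳ m)))
    (+-identityˡ 0#)))

-- Finite sums and change of variables.

module Sums (𝓡 : Ring≡) where
  open Ring≡ 𝓡
  open RingSolver 𝓡
  open ≡-Reasoning

  ∑ : {X : Set} → List X → (X → R) → R
  ∑ xs f = foldr (λ x acc → f x + acc) 0# xs

  ∑-cong : ∀ {X : Set} (xs : List X) {f g : X → R} → (∀ x → f x ≡ g x) → ∑ xs f ≡ ∑ xs g
  ∑-cong [] h = refl
  ∑-cong (x ∷ xs) h = cong₂ _+_ (h x) (∑-cong xs h)

  ∑-0 : ∀ {X : Set} (xs : List X) → ∑ xs (λ _ → 0#) ≡ 0#
  ∑-0 [] = refl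
  ∑-0 (x ∷ xs) = trans (+-identityˡ _) (∑-0 xs)

  ∑-+ : ∀ {X : Set} (xs : List X) (f g : X → R) → ∑ xs (λ x → f x + g x) ≡ ∑ xs f + ∑ xs g
  ∑-+ [] f g = sym (+-identityˡ 0#)
  ∑-+ (x ∷ xs) f g = trans (cong (f x + g x +_) (∑-+ xs f g))
    (solve 4 (λ a b c d → (a :+ b) :+ (c :+ d) := (a :+ c) :+ (b :+ d)) refl _ _ _ _)

  ∑-*ˡ : ∀ {X : Set} (xs : List X) k (f : X → R) → ∑ xs (λ x → k * f x) ≡ k * ∑ xs f
  ∑-*ˡ [] k f = sym (zeroʳ k)
  ∑-*ˡ (x ∷ xs) k f = trans (cong (k * f x +_) (∑-*ˡ xs k f)) (sym (distribˡ k (f x) (∑ xs f)))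

  ∑-*ʳ : ∀ {X : Set} (xs : List X) k (f : X → R) → ∑ xs (λ x → f x * k) ≡ ∑ xs f * k
  ∑-*ʳ xs k f = trans (∑-cong xs λ x → *-comm (f x) k) (trans (∑-*ˡ xs k f) (*-comm k _))

  ∑-swap : ∀ {X Y : Set} (xs : List X) (ys : List Y) (f : X → Y → R) →
           ∑ xs (λ x → ∑ ys (f x)) ≡ ∑ ys (λ y → ∑ xs (λ x → f x y))
  ∑-swap [] ys f = sym (∑-0 ys)
  ∑-swap (x ∷ xs) ys f = trans (cong (∑ ys (f x) +_) (∑-swap xs ys f))
    (sym (∑-+ ys (f x) (λ y → ∑ xs (λ x → f x y))))

  module Finite {X : Set} (_≟_ : DecidableEquality X) (xs : List X)
                (unique : Unique xs) (complete : ∀ x → x ∈ xs) where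

    Σ : (X → R) → R
    Σ = ∑ xs

    Σ-cong : {f g : X → R} → (∀ x → f x ≡ g x) → Σ f ≡ Σ g
    Σ-cong = ∑-cong xs

    Σ-0 : Σ (λ _ → 0#) ≡ 0#
    Σ-0 = ∑-0 xs

    Σ-+ : ∀ {f g : X → R} → Σ (λ x → f x + g x) ≡ Σ f + Σ g
    Σ-+ {f} {g} = ∑-+ xs f g

    Σ-*ˡ : ∀ k {f : X → R} → Σ (λ x → k * f x) ≡ k * Σ f
    Σ-*ˡ k {f} = ∑-*ˡ xs k f

    Σ-*ʳ : ∀ k {f : X → R} → Σ (λ x → f x * k) ≡ Σ f * k
    Σ-*ʳ k {f} = ∑-*ʳ xs k f

    Σ-swap : ∀ {f : X → X → R} → Σ (λ x → Σ (f x)) ≡ Σ (λ y → Σ (λ x → f x y))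
    Σ-swap {f} = ∑-swap xs xs f

    δ : X → X → R
    δ x y with x ≟ y
    ... | yes _ = 1#
    ... | no  _ = 0#

    δ-≡ : ∀ {x y} → x ≡ y → δ x y ≡ 1#
    δ-≡ {x} {y} x≡y with x ≟ y
    ... | yes _ = refl
    ... | no x≢y = ⊥-elim (x≢y x≡y)

    δ-≢ : ∀ {x y} → ¬ (x ≡ y) → δ x y ≡ 0#
    δ-≢ {x} {y} x≢y with x ≟ y
    ... | yes x≡y = ⊥-elim (x≢y x≡y)
    ... | no _ = refl

    δ-⇔ : ∀ {x y x′ y′} → (x ≡ y → x′ ≡ y′) → (x′ ≡ y′ → x ≡ y) → δ x y ≡ δ x′ y′
    δ-⇔ {x} {y} to from with x ≟ y
    ... | yes x≡y = sym (δ-≡ (to x≡y))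
    ... | no x≢y = sym (δ-≢ (λ e → x≢y (from e)))

    δ-sym : ∀ x y → δ x y ≡ δ y x
    δ-sym x y = δ-⇔ sym sym

    Σ-δ : ∀ (f : X → R) a → Σ (λ x → δ x a * f x) ≡ f a
    Σ-δ f a = go xs unique (complete a)
      where
      absent : ∀ ys → All.All (λ y → ¬ (a ≡ y)) ys → ∑ ys (λ x → δ x a * f x) ≡ 0#
      absent [] _ = refl
      absent (y ∷ ys) (a≢y All.∷ h) = trans
        (cong₂ _+_ (trans (cong (_* f y) (δ-≢ λ y≡a → a≢y (sym y≡a))) (zeroˡ _)) (absent ys h))
        (+-identityˡ 0#)
      go : ∀ ys → Unique ys → a ∈ ys → ∑ ys (λ x → δ x a * f x) ≡ f a
      go (y ∷ ys) (y∉ys ∷ u) (here refl) = trans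
        (cong₂ _+_ (trans (cong (_* f y) (δ-≡ refl)) (*-identityˡ _)) (absent ys y∉ys))
        (+-identityʳ _)
      go (y ∷ ys) (y∉ys ∷ u) (there a∈ys) = trans
        (cong₂ _+_ (trans (cong (_* f y) (δ-≢ (All.lookup y∉ys a∈ys))) (zeroˡ _)) (go ys u a∈ys))
        (+-identityˡ _)

    -- Partial bijections suffice: off the domain of σ (of τ) the summand f (resp. g) vanishes.
    reindex : ∀ {f g : X → R} (σ τ : X → X) →
              (∀ x → f x ≡ 0# ⊎ (τ (σ x) ≡ x × g (σ x) ≡ f x)) →
              (∀ y → g y ≡ 0# ⊎ (σ (τ y) ≡ y × f (τ y) ≡ g y)) →
              Σ f ≡ Σ g
    reindex {f} {g} σ τ to from = begin
      Σ f                                                ≡⟨ Σ-cong left ⟩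
      -- The two deltas together cut out the pairs with y = σ x and x = τ y. This relation is
      -- symmetric, so exchanging the sums reduces the right half to the same argument.
      Σ (λ x → Σ (λ y → δ y (σ x) * (δ x (τ y) * f x)))  ≡⟨ ∑-swap xs xs _ ⟩
      Σ (λ y → Σ (λ x → δ y (σ x) * (δ x (τ y) * f x)))  ≡⟨ Σ-cong right ⟩
      Σ g                                                ∎
      where
      left : ∀ x → f x ≡ Σ (λ y → δ y (σ x) * (δ x (τ y) * f x))
      left x = trans (support (to x)) (sym (Σ-δ (λ y → δ x (τ y) * f x) (σ x)))
        where
        support : f x ≡ 0# ⊎ (τ (σ x) ≡ x × g (σ x) ≡ f x) → f x ≡ δ x (τ (σ x)) * f x
        support (inj₁ z) = trans z (sym (trans (cong (_ *_) z) (zeroʳ _)))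
        support (inj₂ (e , _)) = sym (trans (cong (_* f x) (δ-≡ (sym e))) (*-identityˡ _))
      right : ∀ y → Σ (λ x → δ y (σ x) * (δ x (τ y) * f x)) ≡ g y
      right y = begin
        Σ (λ x → δ y (σ x) * (δ x (τ y) * f x))
          ≡⟨ Σ-cong (λ x → solve 3 (λ a b c → a :* (b :* c) := b :* (a :* c)) refl _ _ _) ⟩
        Σ (λ x → δ x (τ y) * (δ y (σ x) * f x))  ≡⟨ Σ-δ (λ x → δ y (σ x) * f x) (τ y) ⟩
        δ y (σ (τ y)) * f (τ y)                  ≡⟨ support (from y) ⟩
        g y                                      ∎
        where
        support : g y ≡ 0# ⊎ (σ (τ y) ≡ y × f (τ y) ≡ g y) → δ y (σ (τ y)) * f (τ y) ≡ g y
        support (inj₂ (e , h)) = trans (cong (_* f (τ y)) (δ-≡ (sym e))) (trans (*-identityˡ _) h)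
        support (inj₁ z) with y ≟ σ (τ y)
        ... | no _ = trans (zeroˡ _) (sym z)
        ... | yes e = trans (*-identityˡ _) (vanish (to (τ y)))
          where
          vanish : f (τ y) ≡ 0# ⊎ (τ (σ (τ y)) ≡ τ y × g (σ (τ y)) ≡ f (τ y)) → f (τ y) ≡ g y
          vanish (inj₁ z′) = trans z′ (sym z)
          vanish (inj₂ (_ , h)) = trans (sym h) (cong g (sym e))

    reindex-↔ : ∀ (f : X → R) (σ τ : X → X) → (∀ x → τ (σ x) ≡ x) → (∀ y → σ (τ y) ≡ y) →
                Σ (λ x → f (σ x)) ≡ Σ f
    reindex-↔ f σ τ τσ στ = reindex σ τ (λ x → inj₂ (τσ x , refl)) (λ y → inj₂ (στ y , cong f (στ y)))

-- Powers and integer multiples of 1.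

module Powers (𝓡 : Ring≡) where
  open Ring≡ 𝓡
  open RingSolver 𝓡
  open Sums 𝓡 using (∑)

  infixr 8 _^_
  _^_ : R → ℕ → R
  _^_ = power 1# _*_

  cast : ℕ → R
  cast = natCast 0# 1# _+_

  1^ : ∀ n → 1# ^ n ≡ 1#
  1^ zero = refl
  1^ (suc n) = trans (*-identityˡ _) (1^ n)

  ^-+ : ∀ x m n → x ^ (m ℕ.+ n) ≡ x ^ m * x ^ n
  ^-+ x zero n = sym (*-identityˡ _)
  ^-+ x (suc m) n = trans (cong (x *_) (^-+ x m n)) (sym (*-assoc _ _ _))

  *-^ : ∀ x y n → (x * y) ^ n ≡ x ^ n * y ^ n
  *-^ x y zero = sym (*-identityˡ _)
  *-^ x y (suc n) = trans (cong (x * y *_) (*-^ x y n))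
    (solve 4 (λ a b c d → (a :* b) :* (c :* d) := (a :* c) :* (b :* d)) refl _ _ _ _)

  ^-* : ∀ x m n → x ^ (m ℕ.* n) ≡ (x ^ n) ^ m
  ^-* x zero n = refl
  ^-* x (suc m) n = trans (^-+ x n (m ℕ.* n)) (cong (x ^ n *_) (^-* x m n))

  ^-*-comm : ∀ x m n → x ^ (m ℕ.* n) ≡ (x ^ m) ^ n
  ^-*-comm x m n = trans (cong (x ^_) (ℕₚ.*-comm m n)) (^-* x n m)

  ^-∣-1 : ∀ x {m n} → x ^ m ≡ 1# → m ∣ n → x ^ n ≡ 1#
  ^-∣-1 x {m} h (divides k refl) = trans (^-* x k m) (trans (cong (_^ k) h) (1^ k))

  cast-+ : ∀ m n → cast (m ℕ.+ n) ≡ cast m + cast n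
  cast-+ zero n = sym (+-identityˡ _)
  cast-+ (suc m) n = trans (cong (1# +_) (cast-+ m n)) (sym (+-assoc _ _ _))

  cast-* : ∀ m n → cast (m ℕ.* n) ≡ cast m * cast n
  cast-* zero n = sym (zeroˡ _)
  cast-* (suc m) n = trans (cast-+ n (m ℕ.* n)) (trans (cong (cast n +_) (cast-* m n))
    (solve 2 (λ a b → b :+ a :* b := (:1 :+ a) :* b) refl _ _))

  cast-∣-0 : ∀ {m n} → cast m ≡ 0# → m ∣ n → cast n ≡ 0#
  cast-∣-0 {m} h (divides k refl) = trans (cast-* k m) (trans (cong (cast k *_) h) (zeroʳ _))

  -- The index map f and the constant c are there for the induction: the tail of
  -- `applyUpTo f (suc n)` is again of this form, with f shifted and c multiplied by x.
  geometric : ∀ x n (f : ℕ → ℕ) (h : ℕ → R) c → (∀ k → h (f k) ≡ c * x ^ k) →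
              (x + - 1#) * ∑ (applyUpTo f n) h ≡ c * (x ^ n + - 1#)
  geometric x zero f h c e =
    solve 2 (λ x c → (x :+ :- :1) :* :0 := c :* (:1 :+ :- :1)) refl x c
  geometric x (suc n) f h c e = lin₂ (x + - 1#) 1#
    (e 0)
    (geometric x n (λ k → f (suc k)) h (c * x) (λ k → trans (e (suc k)) (sym (*-assoc _ _ _))))
    (solve 5 (λ x c h S xn → (x :+ :- :1) :* (h :+ S) :+ :- (c :* (x :* xn :+ :- :1))
        := (x :+ :- :1) :* (h :+ :- (c :* :1))
           :+ :1 :* ((x :+ :- :1) :* S :+ :- (c :* x :* (xn :+ :- :1)))) refl _ _ _ _ _)

  ^-coprime : ∀ x {m n} → Coprime m n → x ^ m ≡ 1# → x ^ n ≡ 1# → x ≡ 1#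
  ^-coprime x {m} {n} c hm hn = bezout (coprime-Bézout c)
    where
    step : ∀ i j → 1 ℕ.+ i ≡ j → x ^ i ≡ 1# → x ^ j ≡ 1# → x ≡ 1#
    step i j refl hi hj = trans (sym (trans (cong (x *_) hi) (*-identityʳ x))) hj
    bezout : Bézout.Identity 1 m n → x ≡ 1#
    bezout (Bézout.+- a b e) = step (b ℕ.* n) (a ℕ.* m) e
      (^-∣-1 x hn (divides b refl)) (^-∣-1 x hm (divides a refl))
    bezout (Bézout.-+ a b e) = step (a ℕ.* m) (b ℕ.* n) e
      (^-∣-1 x hm (divides a refl)) (^-∣-1 x hn (divides b refl))

  cast-coprime : ∀ {m n} → Coprime m n → cast m ≡ 0# → cast n ≡ 0# → 1# ≡ 0#
  cast-coprime {m} {n} c hm hn = bezout (coprime-Bézout c)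
    where
    step : ∀ i j → 1 ℕ.+ i ≡ j → cast i ≡ 0# → cast j ≡ 0# → 1# ≡ 0#
    step i j refl hi hj = trans (sym (trans (cong (1# +_) hi) (+-identityʳ 1#))) hj
    bezout : Bézout.Identity 1 m n → 1# ≡ 0#
    bezout (Bézout.+- a b e) = step (b ℕ.* n) (a ℕ.* m) e
      (cast-∣-0 hn (divides b refl)) (cast-∣-0 hm (divides a refl))
    bezout (Bézout.-+ a b e) = step (a ℕ.* m) (b ℕ.* n) e
      (cast-∣-0 hm (divides a refl)) (cast-∣-0 hn (divides b refl))

-- Binomial coefficients modulo p and the Frobenius map.

private
  p∤m! : ∀ {p} → Prime p → ∀ m → m < p → ¬ (p ∣ m !)
  p∤m! {p} pr zero m<p p∣1 = ℕₚ.<⇒≱ (ℕ.nonTrivial⇒n>1 p {{Primality.prime⇒nonTrivial pr}}) (∣⇒≤ p∣1)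
  p∤m! pr (suc m) m<p p∣m! with euclidsLemma (suc m) (m !) pr p∣m!
  ... | inj₁ h = ℕₚ.<⇒≱ m<p (∣⇒≤ h)
  ... | inj₂ h = p∤m! pr m (ℕₚ.<-trans (ℕₚ.n<1+n m) m<p) h

-- The prime p divides p! = (p C k) k! (p - k)!, but neither of the two factorials, whose factors
-- are all smaller than p.
p∣pCk : ∀ {p k} → Prime p → 0 < k → k < p → p ∣ p C k
p∣pCk {p} {k} pr 0<k k<p with euclidsLemma (p C k) (k ! ℕ.* (p ℕ.∸ k) !) pr p∣product
  where
  k≤p : k ≤ p
  k≤p = ℕₚ.<⇒≤ k<p
  p∣p! : ∀ n → ℕ.NonZero n → n ∣ n !
  p∣p! (suc n) _ = m∣m*n (n !)
  product≡p! : (p C k) ℕ.* (k ! ℕ.* (p ℕ.∸ k) !) ≡ p !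
  product≡p! = trans (cong (ℕ._* (k ! ℕ.* (p ℕ.∸ k) !)) (nCk≡n!/k![n-k]! k≤p))
    (m/n*n≡m {{k !* (p ℕ.∸ k) !≢0}} (subst (_∣ p !) (ℕₚ.*-comm ((p ℕ.∸ k) !) (k !)) ([n∸k]!k!∣n! k≤p)))
  p∣product : p ∣ (p C k) ℕ.* (k ! ℕ.* (p ℕ.∸ k) !)
  p∣product = subst (p ∣_) (sym product≡p!) (p∣p! p (Primality.prime⇒nonZero pr))
... | inj₁ h = h
... | inj₂ h with euclidsLemma (k !) ((p ℕ.∸ k) !) pr h
...   | inj₁ h′ = ⊥-elim (p∤m! pr k k<p h′)
...   | inj₂ h′ = ⊥-elim (p∤m! pr (p ℕ.∸ k) (ℕₚ.∸-monoʳ-< 0<k (ℕₚ.<⇒≤ k<p)) h′)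

module Frobenius (𝓡 : Ring≡) where
  open Ring≡ 𝓡
  open RingSolver 𝓡
  open Powers 𝓡
  open import Algebra.Properties.CommutativeSemiring.Binomial commutativeSemiring
    using (binomialTerm) renaming (theorem to binomial-theorem)
  open import Algebra.Properties.Semiring.Sum semiring using (sum; sum-init-last; sum-cong-≗; sum-replicate-zero)
  open import Algebra.Properties.Semiring.Mult semiring using () renaming (_×_ to _×ᵤ_)
  import Algebra.Properties.Semiring.Exp semiring as Exp
  open ≡-Reasoning

  private
    ×ᵤ-cast : ∀ n x → n ×ᵤ x ≡ cast n * x
    ×ᵤ-cast zero x = sym (zeroˡ x)
    ×ᵤ-cast (suc n) x = trans (cong (x +_) (×ᵤ-cast n x))
      (solve 2 (λ x c → x :+ c :* x := (:1 :+ c) :* x) refl _ _)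

    ^-Exp : ∀ x n → x Exp.^ n ≡ x ^ n
    ^-Exp x zero = refl
    ^-Exp x (suc n) = cong (x *_) (^-Exp x n)

  frobenius : ∀ {p} → Prime p → cast p ≡ 0# → ∀ x y → (x + y) ^ p ≡ x ^ p + y ^ p
  frobenius {zero} pr _ = ⊥-elim (Primality.¬prime[0] pr)
  frobenius {p@(suc p-1)} pr char x y = begin
    (x + y) ^ p                                       ≡⟨ sym (^-Exp (x + y) p) ⟩
    (x + y) Exp.^ p                                   ≡⟨ binomial-theorem p x y ⟩
    term Fin.zero + sum (λ j → term (Fin.suc j))      ≡⟨ cong (term Fin.zero +_) (sum-init-last (λ j → term (Fin.suc j))) ⟩
    term Fin.zero + (sum inner + term (Fin.suc (fromℕ p-1)))
      ≡⟨ cong₂ (λ u v → term Fin.zero + (u + v)) (trans (sum-cong-≗ inner-0) (sum-replicate-zero p-1)) last-term ⟩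
    term Fin.zero + (0# + x ^ p)                      ≡⟨ cong₂ _+_ first-term (+-identityˡ _) ⟩
    y ^ p + x ^ p                                     ≡⟨ +-comm _ _ ⟩
    x ^ p + y ^ p                                     ∎
    where
    term : Fin.Fin (suc p) → R
    term = binomialTerm x y p
    inner : Fin.Fin p-1 → R
    inner j = term (Fin.suc (inject₁ j))
    inner-0 : ∀ j → inner j ≡ 0#
    inner-0 j = trans (×ᵤ-cast (p C suc (Fin.toℕ (inject₁ j))) _) (trans (cong₂ _*_ (cast-∣-0 char
      (p∣pCk pr (s≤s z≤n) (s≤s (subst (_< p-1) (sym (toℕ-inject₁ j)) (toℕ<n j))))) refl) (zeroˡ _))
    first-term : term Fin.zero ≡ y ^ p
    first-term = trans (×ᵤ-cast 1 (1# * y Exp.^ p))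
      (trans (solve 1 (λ y → (:1 :+ :0) :* (:1 :* y) := y) refl _) (^-Exp y p))
    last-term : term (Fin.suc (fromℕ p-1)) ≡ x ^ p
    last-term = begin
      (p C suc (Fin.toℕ (fromℕ p-1))) ×ᵤ (x Exp.^ suc (Fin.toℕ (fromℕ p-1)) * y Exp.^ (p-1 ℕ.∸ Fin.toℕ (fromℕ p-1)))
        ≡⟨ cong (λ k → (p C suc k) ×ᵤ (x Exp.^ suc k * y Exp.^ (p-1 ℕ.∸ k))) (toℕ-fromℕ p-1) ⟩
      (p C p) ×ᵤ (x Exp.^ p * y Exp.^ (p-1 ℕ.∸ p-1))
        ≡⟨ cong₂ (λ c k → c ×ᵤ (x Exp.^ p * y Exp.^ k)) (nCn≡1 p) (ℕₚ.n∸n≡0 p-1) ⟩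
      1 ×ᵤ (x Exp.^ p * 1#)  ≡⟨ ×ᵤ-cast 1 (x Exp.^ p * 1#) ⟩
      cast 1 * (x Exp.^ p * 1#)
        ≡⟨ solve 1 (λ x → (:1 :+ :0) :* (x :* :1) := x) refl _ ⟩
      x Exp.^ p              ≡⟨ ^-Exp x p ⟩
      x ^ p                  ∎

  frobenius^ : ∀ {p} → Prime p → cast p ≡ 0# → ∀ i x y →
               (x + y) ^ (p ℕ.^ i) ≡ x ^ (p ℕ.^ i) + y ^ (p ℕ.^ i)
  frobenius^ pr char zero x y = solve 2 (λ x y → (x :+ y) :* :1 := x :* :1 :+ y :* :1) refl x y
  frobenius^ {p} pr char (suc i) x y = begin
    (x + y) ^ (p ℕ.* p ℕ.^ i)              ≡⟨ ^-*-comm (x + y) p (p ℕ.^ i) ⟩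
    ((x + y) ^ p) ^ (p ℕ.^ i)              ≡⟨ cong (_^ (p ℕ.^ i)) (frobenius pr char x y) ⟩
    (x ^ p + y ^ p) ^ (p ℕ.^ i)            ≡⟨ frobenius^ pr char i (x ^ p) (y ^ p) ⟩
    (x ^ p) ^ (p ℕ.^ i) + (y ^ p) ^ (p ℕ.^ i)
      ≡⟨ sym (cong₂ _+_ (^-*-comm x p (p ℕ.^ i)) (^-*-comm y p (p ℕ.^ i))) ⟩
    x ^ (p ℕ.* p ℕ.^ i) + y ^ (p ℕ.* p ℕ.^ i)  ∎

-- Counting, and cancellation in fields.

-- The pigeonhole principle. It yields the order of `gen` and the bound on the number of roots of
-- t^p = t.
unique-⊆-length : ∀ {X : Set} (xs ys : List X) → Unique xs → (∀ {x} → x ∈ xs → x ∈ ys) →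
                  length xs ≤ length ys
unique-⊆-length [] ys _ _ = z≤n
unique-⊆-length (x ∷ xs) ys (x∉xs ∷ u) xs⊆ys with ∈-∃++ (xs⊆ys (here refl))
... | as , bs , refl = ℕₚ.≤-trans
  (s≤s (unique-⊆-length xs (as ++ bs) u λ y∈xs → drop-x (All.lookup x∉xs y∈xs) (xs⊆ys (there y∈xs))))
  (ℕₚ.≤-reflexive (sym (trans (length-++ as) (trans (ℕₚ.+-suc (length as) (length bs)) (cong suc (sym (length-++ as)))))))
  where
  drop-x : ∀ {y} → ¬ (x ≡ y) → y ∈ as ++ x ∷ bs → y ∈ as ++ bs
  drop-x x≢y y∈ with ∈-++⁻ as y∈
  ... | inj₁ y∈as = ∈-++⁺ˡ y∈as
  ... | inj₂ (here y≡x) = ⊥-elim (x≢y (sym y≡x))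
  ... | inj₂ (there y∈bs) = ∈-++⁺ʳ as y∈bs

-- Equality of R need not be decidable or stable, so nonzero is always ¬ (x ≡ 0#).
module FieldLemmas (𝓡 : Ring≡) (0≢1 : ¬ (Ring≡.0# 𝓡 ≡ Ring≡.1# 𝓡)) (inv : Ring≡.R 𝓡 → Ring≡.R 𝓡)
  (inv-r : ∀ x → ¬ (x ≡ Ring≡.0# 𝓡) → Ring≡._*_ 𝓡 x (inv x) ≡ Ring≡.1# 𝓡) where

  open Ring≡ 𝓡
  open RingSolver 𝓡

  *-cancelˡ-≢0 : ∀ {c x y} → ¬ (c ≡ 0#) → c * x ≡ c * y → x ≡ y
  *-cancelˡ-≢0 {c} {x} {y} c≢0 e = lin₂ (y + - x) (inv c) (inv-r c c≢0) e
    (solve 4 (λ c i x y → x :+ :- y := (y :+ :- x) :* (c :* i :+ :- :1) :+ i :* (c :* x :+ :- (c :* y))) refl _ _ _ _)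

  *-≡0 : ∀ {c x} → ¬ (c ≡ 0#) → c * x ≡ 0# → x ≡ 0#
  *-≡0 {c} c≢0 e = *-cancelˡ-≢0 c≢0 (trans e (sym (zeroʳ c)))

  *-≢0 : ∀ {x y} → ¬ (x ≡ 0#) → ¬ (y ≡ 0#) → ¬ (x * y ≡ 0#)
  *-≢0 x≢0 y≢0 e = y≢0 (*-≡0 x≢0 e)

  unit-≢0 : ∀ {x y} → x * y ≡ 1# → ¬ (x ≡ 0#)
  unit-≢0 {x} {y} e refl = 0≢1 (trans (sym (zeroˡ y)) e)

  diff-≢0 : ∀ {x y} → ¬ (x ≡ y) → ¬ (x + - y ≡ 0#)
  diff-≢0 x≢y e = x≢y (move e)

-- The order of the generator and power sums.

ringOf : FiniteField → Ring≡
ringOf 𝔽 = record { FiniteField 𝔽 renaming (F to R) }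

module FiniteFieldProperties (𝔽 : FiniteField) where
  open FiniteField 𝔽 hiding (_^_)
  open RingSolver (ringOf 𝔽) public
  open Sums (ringOf 𝔽)
  open Finite _≟_ elems elems-unique elems-complete
  open Powers (ringOf 𝔽)
  open Frobenius (ringOf 𝔽)
  open FieldLemmas (ringOf 𝔽) 0≢1 inv inv-r public
  open ≡-Reasoning

  1≢0 : ¬ (1# ≡ 0#)
  1≢0 e = 0≢1 (sym e)

  q N : ℕ
  q = p ℕ.^ r
  N = q ∸ 1

  2<p : 2 < p
  2<p = ℕₚ.≤∧≢⇒< (ℕ.nonTrivial⇒n>1 p {{Primality.prime⇒nonTrivial p-prime}})
    (λ 2≡p → p-odd (subst (2 ∣_) 2≡p (divides 1 refl)))

  instance
    p≢0 : ℕ.NonZero p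
    p≢0 = Primality.prime⇒nonZero p-prime

  p≤q : p ≤ q
  p≤q = subst (_≤ q) (ℕₚ.*-identityʳ p) (ℕₚ.^-monoʳ-≤ p r-pos)

  2<q : 2 < q
  2<q = ℕₚ.<-≤-trans 2<p p≤q

  q≡1+N : q ≡ suc N
  q≡1+N = sym (ℕₚ.m+[n∸m]≡n (ℕₚ.≤-trans (s≤s z≤n) 2<q))

  1<N : 1 < N
  1<N = ℕₚ.∸-monoˡ-≤ 1 2<q

  instance
    N≢0 : ℕ.NonZero N
    N≢0 = ℕ.>-nonZero (ℕₚ.<-trans (s≤s z≤n) 1<N)

  cast-prime-≢0 : ∀ {n} → 0 < n → n < p → ¬ (cast n ≡ 0#)
  cast-prime-≢0 0<n n<p e = 1≢0
    (cast-coprime (prime⇒coprime p-prime {{ℕ.>-nonZero 0<n}} n<p) char-p e)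

  2≢0 : ¬ (1# + 1# ≡ 0#)
  2≢0 e = cast-prime-≢0 (s≤s z≤n) 2<p (trans (cong (1# +_) (+-identityʳ 1#)) e)

  gen≢0 : ¬ (gen ≡ 0#)
  -- If `gen` were 0, its powers would be only 1 and 0. The element 2 is neither, because p is odd.
  gen≢0 g≡0 with gen-generates (1# + 1#) 2≢0
  ... | zero , _ , e = 1≢0 (sym (move (trans (solve 0 (:0 :+ :- :1 := :1 :+ :- (:1 :+ :1)) refl) (diff-0 e))))
  ... | suc j , _ , e = 2≢0 (trans (sym e) (trans (cong (_* gen ^ j) g≡0) (zeroˡ _)))

  ^-≢0 : ∀ {x} n → ¬ (x ≡ 0#) → ¬ (x ^ n ≡ 0#)
  ^-≢0 zero _ = 1≢0
  ^-≢0 (suc n) x≢0 = *-≢0 x≢0 (^-≢0 n x≢0)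

  ^-cancel : ∀ {x i j} → ¬ (x ≡ 0#) → i ≤ j → x ^ i ≡ x ^ j → x ^ (j ∸ i) ≡ 1#
  ^-cancel {x} {i} {j} x≢0 i≤j e = sym (*-cancelˡ-≢0 (^-≢0 i x≢0) (begin
    x ^ i * 1#            ≡⟨ *-identityʳ _ ⟩
    x ^ i                 ≡⟨ e ⟩
    x ^ j                 ≡⟨ cong (x ^_) (sym (ℕₚ.m+[n∸m]≡n i≤j)) ⟩
    x ^ (i ℕ.+ (j ∸ i))   ≡⟨ ^-+ x i (j ∸ i) ⟩
    x ^ i * x ^ (j ∸ i)   ∎))

  ^-% : ∀ {x d} .{{_ : ℕ.NonZero d}} → x ^ d ≡ 1# → ∀ j → x ^ j ≡ x ^ (j % d)
  ^-% {x} {d} h j = begin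
    x ^ j                               ≡⟨ cong (x ^_) (m≡m%n+[m/n]*n j d) ⟩
    x ^ (j % d ℕ.+ j ℕ./ d ℕ.* d)         ≡⟨ ^-+ x (j % d) _ ⟩
    x ^ (j % d) * x ^ (j ℕ./ d ℕ.* d)     ≡⟨ cong (x ^ (j % d) *_) (^-∣-1 x h (n∣m*n (j ℕ./ d))) ⟩
    x ^ (j % d) * 1#                    ≡⟨ *-identityʳ _ ⟩
    x ^ (j % d)                         ∎

  -- If gen^d = 1, then 0 and the d powers with exponent below d exhaust F, hence q ≤ 1 + d.
  gen-period : ∀ d .{{_ : ℕ.NonZero d}} → gen ^ d ≡ 1# → N ≤ d
  gen-period d h = ℕₚ.≤-pred (subst (ℕ._≤ suc d) q≡1+N (subst₂ _≤_ card
    (cong suc (trans (length-map (gen ^_) (upTo d)) (length-upTo d)))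
    (unique-⊆-length elems (0# ∷ map (gen ^_) (upTo d)) elems-unique λ {x} _ → covered x)))
    where
    covered : ∀ x → x ∈ 0# ∷ map (gen ^_) (upTo d)
    covered x with x ≟ 0#
    ... | yes x≡0 = here x≡0
    ... | no x≢0 with gen-generates x x≢0
    ...   | j , _ , refl = there (subst (_∈ map (gen ^_) (upTo d)) (sym (^-% h j)) (∈-map⁺ (gen ^_) (∈-upTo⁺ (m%n<n j d))))

  -- The element gen^N is itself gen^j for some j < N. For j > 0, cancellation would give a period N
  -- - j shorter than N, against `gen-period`.
  gen^N≡1 : gen ^ N ≡ 1#
  gen^N≡1 with gen-generates (gen ^ N) (^-≢0 N gen≢0)
  ... | zero , _ , e = sym e
  ... | suc j , j<N , e = ⊥-elim (ℕₚ.<⇒≱ (ℕₚ.∸-monoʳ-< (s≤s z≤n) (ℕₚ.<⇒≤ j<N))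
    (gen-period (N ∸ suc j) {{ℕ.>-nonZero (ℕₚ.m<n⇒0<n∸m j<N)}} (^-cancel gen≢0 (ℕₚ.<⇒≤ j<N) e)))

  gen^-≡1 : ∀ k → gen ^ k ≡ 1# → N ∣ k
  gen^-≡1 k h with k % N in eq
  ... | zero = m%n≡0⇒n∣m k N eq
  ... | suc m = ⊥-elim (ℕₚ.<⇒≱ (subst (_< N) eq (m%n<n k N))
    (gen-period (suc m) (trans (cong (gen ^_) (sym eq)) (trans (sym (^-% gen^N≡1 k)) h))))

  fermat : ∀ x → ¬ (x ≡ 0#) → x ^ N ≡ 1#
  fermat x x≢0 with gen-generates x x≢0
  ... | j , _ , refl = trans (sym (^-* gen N j))
    (^-∣-1 gen {N} gen^N≡1 (m∣m*n j))

  ^q : ∀ x → x ^ q ≡ x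
  ^q x with x ≟ 0#
  ... | yes refl = trans (cong (0# ^_) q≡1+N) (zeroˡ _)
  ... | no x≢0 = trans (cong (x ^_) q≡1+N) (trans (cong (x *_) (fermat x x≢0)) (*-identityʳ x))

  module _ (𝓢 : Ring≡) where
    private
      module S = Ring≡ 𝓢
      module SP = Powers 𝓢

    -- w ↦ w^k depends only on gen^k, which makes k ↦ w^(log k) multiplicative.
    ^-gen : ∀ {w i j} → w SP.^ N ≡ S.1# → gen ^ i ≡ gen ^ j → w SP.^ i ≡ w SP.^ j
    ^-gen {w} {i} {j} hw e = cases (ℕₚ.≤-total i j)
      where
      go : ∀ i j → i ≤ j → gen ^ i ≡ gen ^ j → w SP.^ j ≡ w SP.^ i
      go i j i≤j e = trans (cong (w SP.^_) (sym (ℕₚ.m+[n∸m]≡n i≤j))) (trans (SP.^-+ w i (j ∸ i))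
        (trans (cong (w SP.^ i S.*_) (SP.^-∣-1 w {N} hw (gen^-≡1 (j ∸ i) (^-cancel gen≢0 i≤j e))))
          (RingSolver.*-identityʳ 𝓢 _)))
      cases : i ≤ j ⊎ j ≤ i → w SP.^ i ≡ w SP.^ j
      cases (inj₁ i≤j) = sym (go i j i≤j e)
      cases (inj₂ j≤i) = go j i j≤i (sym e)

  p∣q : p ∣ q
  p∣q = divides (p ℕ.^ (r ∸ 1)) (trans (cong (p ℕ.^_) (sym (ℕₚ.m+[n∸m]≡n r-pos))) (ℕₚ.*-comm p _))

  0^ : ∀ n .{{_ : ℕ.NonZero n}} → 0# ^ n ≡ 0#
  0^ (suc n) = zeroˡ _

  ∑-1 : ∀ (xs : List F) → ∑ xs (λ _ → 1#) ≡ cast (length xs)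
  ∑-1 [] = refl
  ∑-1 (x ∷ xs) = cong (1# +_) (∑-1 xs)

  -- The permutation x ↦ gen x multiplies the sum by gen^k, which is not 1.
  power-sum-0 : ∀ k → ¬ (gen ^ k ≡ 1#) → Σ (_^ k) ≡ 0#
  power-sum-0 k gen^k≢1 = *-≡0 (diff-≢0 gen^k≢1) (begin
    (gen ^ k + - 1#) * Σ (_^ k)
      ≡⟨ solve 2 (λ g s → (g :+ :- :1) :* s := g :* s :+ :- s) refl _ _ ⟩
    gen ^ k * Σ (_^ k) + - Σ (_^ k)  ≡⟨ diff-0 (sym scaled) ⟩
    0#                               ∎)
    where
    scaled : Σ (_^ k) ≡ gen ^ k * Σ (_^ k)
    scaled = begin
      Σ (_^ k)                      ≡⟨ sym (reindex-↔ (_^ k) (gen *_) (inv gen *_)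
        (λ x → trans (sym (*-assoc _ _ x)) (trans (cong (_* x) (trans (*-comm _ _) (inv-r gen gen≢0))) (*-identityˡ x)))
        (λ x → trans (sym (*-assoc _ _ x)) (trans (cong (_* x) (inv-r gen gen≢0)) (*-identityˡ x)))) ⟩
      Σ (λ x → (gen * x) ^ k)       ≡⟨ Σ-cong (λ x → *-^ gen x k) ⟩
      Σ (λ x → gen ^ k * x ^ k)     ≡⟨ Σ-*ˡ (gen ^ k) ⟩
      gen ^ k * Σ (_^ k)            ∎

  -- The summand is 1 except at x = 0, so the sum is q - 1, and q vanishes in F.
  power-sum-N : Σ (_^ N) ≡ - 1#
  power-sum-N = begin
    Σ (_^ N)                              ≡⟨ Σ-cong split ⟩
    Σ (λ x → 1# + - (δ x 0# * 1#))        ≡⟨ Σ-cong (λ x → cong (1# +_) (solve 1 (λ d → :- (d :* :1) := d :* :- :1) refl _)) ⟩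
    Σ (λ x → 1# + δ x 0# * - 1#)          ≡⟨ Σ-+ ⟩
    Σ (λ _ → 1#) + Σ (λ x → δ x 0# * - 1#)
      ≡⟨ cong₂ _+_ (trans (∑-1 elems) (trans (cong cast card) (cast-∣-0 {p} char-p p∣q))) (Σ-δ (λ _ → - 1#) 0#) ⟩
    0# + - 1#                             ≡⟨ +-identityˡ _ ⟩
    - 1#                                  ∎
    where
    split : ∀ x → x ^ N ≡ 1# + - (δ x 0# * 1#)
    split x with x ≟ 0#
    ... | yes refl = trans (0^ N) (solve 0 (:0 := :1 :+ :- (:1 :* :1)) refl)
    ... | no x≢0 = trans (fermat x x≢0) (solve 0 (:1 := :1 :+ :- (:0 :* :1)) refl)

  -- The prime field and the trace.

  frobenius-p : ∀ x y → (x + y) ^ p ≡ x ^ p + y ^ p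
  frobenius-p = frobenius p-prime char-p

  cast-^p : ∀ k → cast k ^ p ≡ cast k
  cast-^p zero = 0^ p
  cast-^p (suc k) = trans (frobenius-p 1# (cast k)) (cong₂ _+_ (1^ p) (cast-^p k))

  cast-<-≢ : ∀ {i j} → i < j → j < p → ¬ (cast i ≡ cast j)
  cast-<-≢ {i} {j} i<j j<p e = cast-prime-≢0 (ℕₚ.m<n⇒0<n∸m i<j) (ℕₚ.≤-<-trans (ℕₚ.m∸n≤m j i) j<p)
    (lin₁ (- 1#) (trans e (trans (cong cast (sym (ℕₚ.m+[n∸m]≡n (ℕₚ.<⇒≤ i<j)))) (cast-+ i (j ∸ i))))
      (solve 2 (λ d i → d :+ :- :0 := :- :1 :* (i :+ :- (i :+ d))) refl _ _))

  cast-≡0 : ∀ {n} → cast n ≡ 0# → p ∣ n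
  cast-≡0 {n} e with n % p in eq
  ... | zero = m%n≡0⇒n∣m n p eq
  ... | suc m = ⊥-elim (cast-prime-≢0 (s≤s z≤n) (subst (_< p) eq (m%n<n n p)) (begin
    cast (suc m)                            ≡⟨ cong cast (sym eq) ⟩
    cast (n % p)                            ≡⟨ sym (+-identityʳ _) ⟩
    cast (n % p) + 0#                       ≡⟨ cong (cast (n % p) +_) (sym (cast-∣-0 {p} char-p (n∣m*n (n ℕ./ p)))) ⟩
    cast (n % p) + cast (n ℕ./ p ℕ.* p)       ≡⟨ sym (cast-+ (n % p) _) ⟩
    cast (n % p ℕ.+ n ℕ./ p ℕ.* p)            ≡⟨ cong cast (sym (m≡m%n+[m/n]*n n p)) ⟩
    cast n                                  ≡⟨ e ⟩
    0#                                      ∎))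

  abstract
    -- The p multiples of 1 are roots of t^p = t; conversely a nonzero root gen^j has
    -- N ∣ j (p - 1), which leaves only p - 1 choices for j < N, so there are no other roots.
    prime-field : ∀ t → t ^ p ≡ t → ∃ λ k → k < p × cast k ≡ t
    prime-field t t^p≡t with Any.any? (t ≟_) (map cast (upTo p))
    ... | yes t∈ with ∈-map⁻ cast t∈
    ...   | k , k∈ , t≡k = k , ∈-upTo⁻ k∈ , sym t≡k
    prime-field t t^p≡t | no t∉ = ⊥-elim (ℕₚ.1+n≰n (subst₂ _≤_
      (cong suc (trans (length-map cast (upTo p)) (length-upTo p)))
      (trans (cong suc (trans (length-map (λ c → gen ^ ((N ℕ.* c) ℕ./ p-1)) (upTo p-1)) (length-upTo p-1))) 1+p-1≡p)
      (unique-⊆-length (t ∷ map cast (upTo p)) roots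
        (Allₚ.¬Any⇒All¬ _ t∉ ∷ subst Unique (sym (map-upTo cast p)) (Uniqueₚ.applyUpTo⁺₁ cast p cast-<-≢)) is-root)))
      where
      p-1 : ℕ
      p-1 = p ∸ 1
      1+p-1≡p : suc p-1 ≡ p
      1+p-1≡p = ℕₚ.m+[n∸m]≡n (ℕₚ.<-trans (s≤s z≤n) 2<p)
      instance
        p-1≢0 : ℕ.NonZero p-1
        p-1≢0 = ℕ.>-nonZero (ℕₚ.m<n⇒0<n∸m (ℕₚ.<-trans (s≤s (s≤s z≤n)) 2<p))
      roots : List F
      roots = 0# ∷ map (λ c → gen ^ ((N ℕ.* c) ℕ./ p-1)) (upTo p-1)
      root-∈ : ∀ x → x ^ p ≡ x → x ∈ roots
      root-∈ x x^p≡x with x ≟ 0#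
      ... | yes x≡0 = here x≡0
      ... | no x≢0 with gen-generates x x≢0
      ...   | j , j<N , refl with gen^-≡1 (j ℕ.* p-1)
                (trans (^-*-comm gen j p-1) (sym (*-cancelˡ-≢0 x≢0 (trans (*-identityʳ _)
                  (trans (sym x^p≡x) (cong ((gen ^ j) ^_) (sym 1+p-1≡p)))))))
      ...     | divides c j*[p-1]≡c*N = there (subst (λ k → gen ^ k ∈ map (λ c → gen ^ ((N ℕ.* c) ℕ./ p-1)) (upTo p-1))
                  (trans (cong (λ k → ℕ._/_ k p-1 {{p-1≢0}}) (trans (ℕₚ.*-comm N c) (sym j*[p-1]≡c*N))) (m*n/n≡m j p-1 {{p-1≢0}}))
                  (∈-map⁺ (λ c → gen ^ ((N ℕ.* c) ℕ./ p-1)) (∈-upTo⁺ (ℕₚ.*-cancelˡ-< N c p-1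
                    (subst₂ _<_ (trans j*[p-1]≡c*N (ℕₚ.*-comm c N)) refl (ℕₚ.*-monoˡ-< p-1 j<N))))))
      is-root : ∀ {x} → x ∈ t ∷ map cast (upTo p) → x ∈ roots
      is-root (here refl) = root-∈ t t^p≡t
      is-root (there x∈) with ∈-map⁻ cast x∈
      ... | k , _ , refl = root-∈ (cast k) (cast-^p k)

  -- The `tr` of the statement, available here without the parameters 𝕂, ζ and ω.
  trace : F → F
  trace α = ∑ (upTo r) (λ i → α ^ (p ℕ.^ i))

  trace-+ : ∀ x y → trace (x + y) ≡ trace x + trace y
  trace-+ x y = trans (∑-cong (upTo r) (λ i → frobenius^ p-prime char-p i x y))
                      (∑-+ (upTo r) (λ i → x ^ (p ℕ.^ i)) (λ i → y ^ (p ℕ.^ i)))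

  ∑-^p : ∀ {X : Set} (xs : List X) (f : X → F) → ∑ xs f ^ p ≡ ∑ xs (λ x → f x ^ p)
  ∑-^p [] f = 0^ p
  ∑-^p (x ∷ xs) f = trans (frobenius-p (f x) (∑ xs f)) (cong (f x ^ p +_) (∑-^p xs f))

  -- Both sides add up the same n + 1 consecutive values of h. The index map f lets the induction
  -- run along the tails of `applyUpTo`.
  ∑-shift : ∀ (h : ℕ → F) n (f : ℕ → ℕ) → (∀ k → f (suc k) ≡ suc (f k)) →
            ∑ (applyUpTo f n) (λ i → h (suc i)) + h (f 0) ≡ ∑ (applyUpTo f n) h + h (f n)
  ∑-shift h zero f _ = refl
  ∑-shift h (suc n) f f-suc = lin₂ 1# 1# (cong h (sym (f-suc 0)))
    (∑-shift h n (λ k → f (suc k)) (λ k → f-suc (suc k)))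
    (solve 6 (λ s S a T b c → (s :+ S) :+ a :+ :- ((a :+ T) :+ b) :=
      :1 :* (s :+ :- c) :+ :1 :* ((S :+ c) :+ :- (T :+ b))) refl _ _ _ _ _ _)

  -- Raising to the power p moves each term to the next one, and α^q = α closes the cycle. With
  -- `prime-field` this makes the trace a multiple of 1, as `toℕ` expects.
  trace-^p : ∀ α → trace α ^ p ≡ trace α
  trace-^p α = begin
    trace α ^ p                                  ≡⟨ ∑-^p (upTo r) _ ⟩
    ∑ (upTo r) (λ i → (α ^ (p ℕ.^ i)) ^ p)       ≡⟨ ∑-cong (upTo r) (λ i → sym (^-* α p (p ℕ.^ i))) ⟩
    ∑ (upTo r) (λ i → α ^ (p ℕ.^ suc i))         ≡⟨ move (trans (solve 3 (λ s t a → s :+ :- t := s :+ a :+ :- (t :+ a)) refl _ _ _) (diff-0 shifted)) ⟩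
    trace α                                      ∎
    where
    shifted : ∑ (upTo r) (λ i → α ^ (p ℕ.^ suc i)) + α ≡ trace α + α
    shifted = begin
      ∑ (upTo r) (λ i → α ^ (p ℕ.^ suc i)) + α       ≡⟨ cong (∑ (upTo r) (λ i → α ^ (p ℕ.^ suc i)) +_) (sym (*-identityʳ α)) ⟩
      ∑ (upTo r) (λ i → α ^ (p ℕ.^ suc i)) + α ^ 1   ≡⟨ ∑-shift (λ i → α ^ (p ℕ.^ i)) r (λ k → k) (λ k → refl) ⟩
      trace α + α ^ q                                ≡⟨ cong (trace α +_) (^q α) ⟩
      trace α + α                                    ∎

  abstract
    -- Σ x^(N-1) tr x = -1: only the term i = 0 of the trace has an exponent divisible by N.
    trace-nonzero : ∃ λ c → ¬ (trace c ≡ 0#)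
    trace-nonzero with Any.any? (λ x → ¬? (trace x ≟ 0#)) elems
    ... | yes found = Any.lookup found , proof found
      where
      proof : ∀ {xs} (h : Any.Any (λ x → ¬ (trace x ≡ 0#)) xs) → ¬ (trace (Any.lookup h) ≡ 0#)
      proof (here h) = h
      proof (there h) = proof h
    ... | no none = ⊥-elim (1≢0 (trans (sym (-‿involutive 1#)) (trans (cong -_ minus-1≡0) -0#≈0#)))
      where
      all-0 : ∀ x → trace x ≡ 0#
      all-0 x = decidable-stable (trace x ≟ 0#) (All.lookup (Allₚ.¬Any⇒All¬ elems none) (elems-complete x))
      1+N-1≡N : suc (N ∸ 1) ≡ N
      1+N-1≡N = ℕₚ.m+[n∸m]≡n (ℕₚ.<⇒≤ 1<N)
      exponent : ∀ i → N ∸ 1 ℕ.+ p ℕ.^ suc i ≡ N ℕ.+ (p ℕ.^ suc i ∸ 1)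
      exponent i = begin
        N ∸ 1 ℕ.+ p ℕ.^ suc i                     ≡⟨ cong (N ∸ 1 ℕ.+_) (sym (ℕₚ.m+[n∸m]≡n (ℕₚ.m^n>0 p (suc i)))) ⟩
        N ∸ 1 ℕ.+ suc (p ℕ.^ suc i ∸ 1)           ≡⟨ ℕₚ.+-suc (N ∸ 1) _ ⟩
        suc (N ∸ 1) ℕ.+ (p ℕ.^ suc i ∸ 1)         ≡⟨ cong (ℕ._+ (p ℕ.^ suc i ∸ 1)) 1+N-1≡N ⟩
        N ℕ.+ (p ℕ.^ suc i ∸ 1)                   ∎
      higher-0 : ∀ i → suc i < r → Σ (_^ (N ∸ 1 ℕ.+ p ℕ.^ suc i)) ≡ 0#
      higher-0 i 1+i<r = power-sum-0 (N ∸ 1 ℕ.+ p ℕ.^ suc i) λ h → ℕₚ.<⇒≱ small (∣⇒≤ {{ℕ.>-nonZero positive}} (gen^-≡1 (p ℕ.^ suc i ∸ 1) (begin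
        gen ^ (p ℕ.^ suc i ∸ 1)                   ≡⟨ sym (*-identityˡ _) ⟩
        1# * gen ^ (p ℕ.^ suc i ∸ 1)              ≡⟨ cong (_* gen ^ (p ℕ.^ suc i ∸ 1)) (sym gen^N≡1) ⟩
        gen ^ N * gen ^ (p ℕ.^ suc i ∸ 1)         ≡⟨ sym (^-+ gen N (p ℕ.^ suc i ∸ 1)) ⟩
        gen ^ (N ℕ.+ (p ℕ.^ suc i ∸ 1))           ≡⟨ cong (gen ^_) (sym (exponent i)) ⟩
        gen ^ (N ∸ 1 ℕ.+ p ℕ.^ suc i)             ≡⟨ h ⟩
        1#                                        ∎)))
        where
        p≤p^ : p ≤ p ℕ.^ suc i
        p≤p^ = subst (_≤ p ℕ.^ suc i) (ℕₚ.*-identityʳ p) (ℕₚ.^-monoʳ-≤ p {1} {suc i} (s≤s z≤n))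
        positive : 0 < p ℕ.^ suc i ∸ 1
        positive = ℕₚ.m<n⇒0<n∸m (ℕₚ.<-≤-trans (ℕₚ.<-trans (s≤s (s≤s z≤n)) 2<p) p≤p^)
        small : p ℕ.^ suc i ∸ 1 < N
        small = ℕₚ.∸-monoˡ-< (ℕₚ.^-monoʳ-< p (ℕₚ.<-trans (s≤s (s≤s z≤n)) 2<p) {suc i} {r} 1+i<r) (ℕₚ.m^n>0 p (suc i))
      first : ∀ m → 0 < m → m ≤ r → ∑ (upTo m) (λ i → Σ (_^ (N ∸ 1 ℕ.+ p ℕ.^ i))) ≡ - 1#
      first (suc n) _ n<r = trans (cong₂ _+_ (trans (cong (λ k → Σ (_^ k)) (trans (ℕₚ.+-comm (N ∸ 1) 1) 1+N-1≡N)) power-sum-N)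
                                      (rest n suc (λ k k<n → higher-0 k (ℕₚ.<-≤-trans (s≤s k<n) n<r))))
                           (+-identityʳ _)
        where
        rest : ∀ n (f : ℕ → ℕ) → (∀ k → k < n → Σ (_^ (N ∸ 1 ℕ.+ p ℕ.^ f k)) ≡ 0#) →
               ∑ (applyUpTo f n) (λ i → Σ (_^ (N ∸ 1 ℕ.+ p ℕ.^ i))) ≡ 0#
        rest zero f _ = refl
        rest (suc n) f h = trans (cong₂ _+_ (h 0 (s≤s z≤n)) (rest n (λ k → f (suc k)) (λ k k<n → h (suc k) (s≤s k<n))))
                                 (+-identityˡ 0#)
      minus-1≡0 : - 1# ≡ 0#
      minus-1≡0 = begin
        - 1#                                                         ≡⟨ sym (first r r-pos ℕₚ.≤-refl) ⟩
        ∑ (upTo r) (λ i → Σ (_^ (N ∸ 1 ℕ.+ p ℕ.^ i)))                ≡⟨ ∑-swap (upTo r) elems _ ⟩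
        Σ (λ x → ∑ (upTo r) (λ i → x ^ (N ∸ 1 ℕ.+ p ℕ.^ i)))
          ≡⟨ Σ-cong (λ x → trans (∑-cong (upTo r) (λ i → ^-+ x (N ∸ 1) (p ℕ.^ i))) (∑-*ˡ (upTo r) (x ^ (N ∸ 1)) _)) ⟩
        Σ (λ x → x ^ (N ∸ 1) * trace x)                              ≡⟨ Σ-cong (λ x → trans (cong (x ^ (N ∸ 1) *_) (all-0 x)) (zeroʳ _)) ⟩
        Σ (λ _ → 0#)                                                 ≡⟨ Σ-0 ⟩
        0#                                                           ∎

ringOfK : CharZeroField → Ring≡
ringOfK 𝕂 = record { CharZeroField 𝕂 renaming (K to R) }

-- A total inverse on F.

module FiniteFieldInverse (𝔽 : FiniteField) where
  open FiniteField 𝔽 hiding (_^_)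
  open FiniteFieldProperties 𝔽 using (solve; _:+_; _:*_; :-_; _:=_; :1; :0; lin₁; lin₂; *-cancelˡ-≢0; *-≡0;
    unit-≢0; zeroˡ; zeroʳ; *-comm)

  -- Abstract, so that case distinctions on x ≟ 0# do not unfold i x.
  abstract
    i : F → F
    i x with x ≟ 0#
    ... | yes _ = 0#
    ... | no  _ = inv x

    i-0 : i 0# ≡ 0#
    i-0 with 0# ≟ 0#
    ... | yes _ = refl
    ... | no 0≢0 = ⊥-elim (0≢0 refl)

    i-inv : ∀ {x} → ¬ (x ≡ 0#) → i x ≡ inv x
    i-inv {x} x≢0 with x ≟ 0#
    ... | yes x≡0 = ⊥-elim (x≢0 x≡0)
    ... | no _ = refl

  i-r : ∀ {x} → ¬ (x ≡ 0#) → x * i x ≡ 1#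
  i-r {x} x≢0 = trans (cong (x *_) (i-inv x≢0)) (inv-r x x≢0)

  i-unique : ∀ {x y} → x * y ≡ 1# → i x ≡ y
  i-unique {x} e = *-cancelˡ-≢0 (unit-≢0 e) (trans (i-r (unit-≢0 e)) (sym e))

  i-≡0 : ∀ {x} → x ≡ 0# → i x ≡ 0#
  i-≡0 refl = i-0

  i-≢0 : ∀ {x} → ¬ (x ≡ 0#) → ¬ (i x ≡ 0#)
  i-≢0 x≢0 = unit-≢0 (trans (*-comm _ _) (i-r x≢0))

  i-involutive : ∀ x → i (i x) ≡ x
  i-involutive x with x ≟ 0#
  ... | yes refl = trans (cong i i-0) i-0
  ... | no x≢0 = i-unique (trans (*-comm _ _) (i-r x≢0))

  i-* : ∀ x y → i (x * y) ≡ i x * i y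
  i-* x y with x ≟ 0# | y ≟ 0#
  ... | yes refl | _ = trans (i-≡0 (zeroˡ y)) (sym (trans (cong (_* i y) i-0) (zeroˡ _)))
  ... | no _ | yes refl = trans (i-≡0 (zeroʳ x)) (sym (trans (cong (i x *_) i-0) (zeroʳ _)))
  ... | no x≢0 | no y≢0 = i-unique (lin₂ (y * i y) 1# (i-r x≢0) (i-r y≢0)
    (solve 4 (λ x y u v → (x :* y) :* (u :* v) :+ :- :1 :=
      (y :* v) :* (x :* u :+ :- :1) :+ :1 :* (y :* v :+ :- :1)) refl x y (i x) (i y)))

  i-neg : ∀ x → i (- x) ≡ - i x
  i-neg x with x ≟ 0#
  ... | yes refl = trans (i-≡0 -0≡0) (sym (trans (cong -_ i-0) -0≡0))
    where
    -0≡0 : - 0# ≡ 0#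
    -0≡0 = solve 0 (:- :0 := :0) refl
  ... | no x≢0 = i-unique (trans (solve 2 (λ x u → (:- x) :* (:- u) := x :* u) refl _ _) (i-r x≢0))

  neg-≢0 : ∀ {x} → ¬ (x ≡ 0#) → ¬ (- x ≡ 0#)
  neg-≢0 {x} x≢0 e = x≢0 (trans (solve 1 (λ x → x := :- (:- x)) refl x) (trans (cong -_ e) (solve 0 (:- :0 := :0) refl)))

  ≡-or-opposite : ∀ {x y} → x * x ≡ y * y → x ≡ y ⊎ x ≡ - y
  ≡-or-opposite {x} {y} e with (x + - y) ≟ 0#
  ... | yes d = inj₁ (lin₁ 1# d (solve 2 (λ x y → x :+ :- y := :1 :* (x :+ :- y :+ :- :0)) refl x y))
  ... | no d = inj₂ (lin₁ 1# (*-≡0 {x + - y} {x + y} d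
      (lin₁ 1# e (solve 2 (λ x y → (x :+ :- y) :* (x :+ y) :+ :- :0 := :1 :* (x :* x :+ :- (y :* y))) refl x y)))
      (solve 2 (λ x y → x :+ :- (:- y) := :1 :* ((x :+ y) :+ :- :0)) refl x y))

-- Multiplicative characters.

module Characters (𝔽 : FiniteField) (𝕂 : CharZeroField) (ζ ω : CharZeroField.K 𝕂) where

  open FiniteField 𝔽 public renaming
    (_+_ to _+F_; _*_ to _*F_; -_ to -F_; 0# to 0F; 1# to 1F;
     inv to invF; _×1 to _×1F; _^_ to _^F_; isCommutativeRing to isCommutativeRingF; 0≢1 to 0F≢1F; inv-r to invF-r)
  open CharZeroField 𝕂 public
  open Setup 𝔽 𝕂 ζ ω public

  module FP = FiniteFieldProperties 𝔽
  open FiniteFieldProperties 𝔽 public using (N; 1≢0; 2≢0) renaming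
    (solve to solveF; _:+_ to _⊕_; _:*_ to _⊗_; :-_ to ⊝_; _:=_ to _⊜_; :1 to 𝟙; :0 to 𝟘;
     lin₁ to linF₁; lin₂ to linF₂; diff-0 to diffF-0)
  open FiniteFieldInverse 𝔽 public

  ringK : Ring≡
  ringK = ringOfK 𝕂
  module KF = FieldLemmas ringK 0≢1 inv inv-r
  module KP = Powers ringK
  open RingSolver ringK public
  open Sums ringK public hiding (module Finite)
  open Sums.Finite ringK _≟_ elems elems-unique elems-complete public
  open IsCharacter public
  open ≡-Reasoning

  find-spec : ∀ {X : Set} (t : X → Bool) d xs {x} → x ∈ xs → t x ≡ true →
              t (find t d xs) ≡ true × find t d xs ∈ xs
  find-spec t d (y ∷ ys) x∈ tx with t y in eq
  ... | true = eq , here refl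
  find-spec t d (y ∷ ys) (here refl) tx | false with trans (sym eq) tx
  ... | ()
  find-spec t d (y ∷ ys) (there x∈) tx | false with find-spec t d ys x∈ tx
  ... | h , f∈ = h , there f∈

  does-true : ∀ {P : Set} (d : Dec P) → does d ≡ true → P
  does-true (yes p) _ = p

  true-does : ∀ {P : Set} (d : Dec P) → P → does d ≡ true
  true-does (yes _) _ = refl
  true-does (no ¬p) p = ⊥-elim (¬p p)

  any-true : ∀ {X : Set} (t : X → Bool) xs → any t xs ≡ true → ∃ λ x → t x ≡ true
  any-true t (x ∷ xs) h with t x in eq
  ... | true = x , eq
  ... | false = any-true t xs h

  true-any : ∀ {X : Set} (t : X → Bool) xs {x} → x ∈ xs → t x ≡ true → any t xs ≡ true
  true-any t (y ∷ ys) x∈ tx with t y in eq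
  ... | true = refl
  true-any t (y ∷ ys) (here refl) tx | false with trans (sym eq) tx
  ... | ()
  true-any t (y ∷ ys) (there x∈) tx | false = true-any t ys x∈ tx

  χ-i : ∀ {χ} → IsCharacter χ → ∀ {x} → ¬ (x ≡ 0F) → χ x * χ (i x) ≡ 1#
  χ-i {χ} h x≢0 = trans (sym (χ-mul h _ _)) (trans (cong χ (i-r x≢0)) (χ-1 h))

  conj-i : ∀ {χ} → IsCharacter χ → ∀ x → conj χ x ≡ χ (i x)
  conj-i {χ} h x with x ≟ 0F
  ... | yes refl = sym (trans (cong χ i-0) (χ-0 h))
  ... | no x≢0 = cong χ (sym (i-inv x≢0))

  ·-isCharacter : ∀ {χ ψ} → IsCharacter χ → IsCharacter ψ → IsCharacter (χ · ψ)
  ·-isCharacter {χ} {ψ} h k = record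
    { χ-0 = trans (cong (_* ψ 0F) (χ-0 h)) (zeroˡ _)
    ; χ-1 = trans (cong₂ _*_ (χ-1 h) (χ-1 k)) (*-identityˡ 1#)
    ; χ-mul = λ x y → trans (cong₂ _*_ (χ-mul h x y) (χ-mul k x y))
        (solve 4 (λ a b c d → (a :* b) :* (c :* d) := (a :* c) :* (b :* d)) refl _ _ _ _) }

  conj-isCharacter : ∀ {χ} → IsCharacter χ → IsCharacter (conj χ)
  conj-isCharacter {χ} h = record
    { χ-0 = trans (conj-i h 0F) (trans (cong χ i-0) (χ-0 h))
    ; χ-1 = trans (conj-i h 1F) (trans (cong χ (i-unique (FP.*-identityˡ 1F))) (χ-1 h))
    ; χ-mul = λ x y → trans (conj-i h _) (trans (cong χ (i-* x y)) (trans (χ-mul h _ _)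
        (sym (cong₂ _*_ (conj-i h x) (conj-i h y))))) }

  χ-neg² : ∀ {χ} → IsCharacter χ → χ (-F 1F) * χ (-F 1F) ≡ 1#
  χ-neg² {χ} h = trans (sym (χ-mul h _ _)) (trans (cong χ (solveF 0 ((⊝ 𝟙) ⊗ (⊝ 𝟙) ⊜ 𝟙) refl)) (χ-1 h))

  Nontrivial : Char → Set
  Nontrivial χ = Σ χ ≡ 0#

  gen-powers : ∀ {χ} → IsCharacter χ → χ gen ≡ 1# → ∀ j → χ (gen ^F j) ≡ 1#
  gen-powers h e zero = χ-1 h
  gen-powers h e (suc j) = trans (χ-mul h _ _) (trans (cong₂ _*_ e (gen-powers h e j)) (*-identityˡ 1#))

  -- The value χ(gen) determines χ, so χ(gen) = 1 would force χ ≈ ε. Scaling by `gen` gives (χ(gen)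
  -- - 1) Σ χ = 0, and the mere negation of χ(gen) = 1 suffices to cancel the factor.
  ≉ε⇒nontrivial : ∀ {χ} → IsCharacter χ → ¬ (χ ≈χ ε) → Nontrivial χ
  ≉ε⇒nontrivial {χ} h χ≉ε = KF.*-≡0 (KF.diff-≢0 χgen≢1) (begin
    (χ gen + - 1#) * Σ χ
      ≡⟨ solve 2 (λ g s → (g :+ :- :1) :* s := g :* s :+ :- s) refl _ _ ⟩
    χ gen * Σ χ + - Σ χ  ≡⟨ diff-0 (sym scaled) ⟩
    0#                   ∎)
    where
    χgen≢1 : ¬ (χ gen ≡ 1#)
    χgen≢1 e = χ≉ε go
      where
      go : χ ≈χ ε
      go x with x ≟ 0F
      ... | yes refl = χ-0 h
      ... | no x≢0 with gen-generates x x≢0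
      ...   | j , _ , refl = gen-powers h e j
    scaled : Σ χ ≡ χ gen * Σ χ
    scaled = begin
      Σ χ                      ≡⟨ sym (reindex-↔ χ (gen *F_) (i gen *F_)
        (λ x → linF₁ x (i-r FP.gen≢0) (solveF 3 (λ g u x → u ⊗ (g ⊗ x) ⊕ ⊝ x ⊜ x ⊗ (g ⊗ u ⊕ ⊝ 𝟙)) refl _ _ _))
        (λ x → linF₁ x (i-r FP.gen≢0) (solveF 3 (λ g u x → g ⊗ (u ⊗ x) ⊕ ⊝ x ⊜ x ⊗ (g ⊗ u ⊕ ⊝ 𝟙)) refl _ _ _))) ⟩
      Σ (λ x → χ (gen *F x))   ≡⟨ Σ-cong (χ-mul h gen) ⟩
      Σ (λ x → χ gen * χ x)    ≡⟨ Σ-*ˡ (χ gen) ⟩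
      χ gen * Σ χ              ∎

  -- The quadratic character.

  Square : F → Set
  Square x = ∃ λ y → y *F y ≡ x

  square? : ∀ x → (Square x × isSquare x ≡ true) ⊎ (¬ Square x × isSquare x ≡ false)
  square? x with isSquare x in eq
  ... | true with any-true (λ y → does ((y *F y) ≟ x)) elems eq
  ...   | y , h = inj₁ ((y , does-true ((y *F y) ≟ x) h) , refl)
  square? x | false = inj₂ ((λ { (y , e) → false≢true (trans (sym eq)
      (true-any (λ y → does ((y *F y) ≟ x)) elems (elems-complete y) (true-does ((y *F y) ≟ x) e))) }) , refl)
    where
    false≢true : ¬ (false ≡ true)
    false≢true ()

  -- Each case carries the value of φ as an equation, so later case distinctions need not unfold the
  -- search through `elems`.
  data Φ (x : F) : Set where
    zero      : x ≡ 0F → φ x ≡ 0# → Φ x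
    square    : ¬ (x ≡ 0F) → Square x → φ x ≡ 1# → Φ x
    nonsquare : ¬ (x ≡ 0F) → ¬ Square x → φ x ≡ - 1# → Φ x

  φ-view : ∀ x → Φ x
  φ-view x = view x (x ≟ 0F) (square? x)
    where
    φ-0 : ∀ x → x ≡ 0F → φ x ≡ 0#
    φ-0 x e with x ≟ 0F
    ... | yes _ = refl
    ... | no ne = ⊥-elim (ne e)
    φ-≢0 : ∀ x b → ¬ (x ≡ 0F) → isSquare x ≡ b → φ x ≡ (if b then 1# else - 1#)
    φ-≢0 x b ne e with x ≟ 0F
    ... | yes x≡0 = ⊥-elim (ne x≡0)
    ... | no _ = cong (λ b → if b then 1# else - 1#) e
    view : ∀ x → Dec (x ≡ 0F) → (Square x × isSquare x ≡ true) ⊎ (¬ Square x × isSquare x ≡ false) → Φ x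
    view x (yes e) _ = zero e (φ-0 x e)
    view x (no ne) (inj₁ (s , e)) = square ne s (φ-≢0 x true ne e)
    view x (no ne) (inj₂ (ns , e)) = nonsquare ne ns (φ-≢0 x false ne e)

  φ-of-square : ∀ {x} → ¬ (x ≡ 0F) → Square x → φ x ≡ 1#
  φ-of-square {x} x≢0 s with φ-view x
  ... | zero e _ = ⊥-elim (x≢0 e)
  ... | square _ _ e = e
  ... | nonsquare _ ns _ = ⊥-elim (ns s)

  φ-of-nonsquare : ∀ {x} → ¬ (x ≡ 0F) → ¬ Square x → φ x ≡ - 1#
  φ-of-nonsquare {x} x≢0 ns with φ-view x
  ... | zero e _ = ⊥-elim (x≢0 e)
  ... | square _ s _ = ⊥-elim (ns s)
  ... | nonsquare _ _ e = e

  φ-at-0 : φ 0F ≡ 0#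
  φ-at-0 with φ-view 0F
  ... | zero _ e = e
  ... | square ne _ _ = ⊥-elim (ne refl)
  ... | nonsquare ne _ _ = ⊥-elim (ne refl)

  square-* : ∀ {x y} → Square x → Square y → Square (x *F y)
  square-* (a , refl) (b , refl) = a *F b , solveF 2 (λ a b → (a ⊗ b) ⊗ (a ⊗ b) ⊜ (a ⊗ a) ⊗ (b ⊗ b)) refl a b

  square-cancel : ∀ {x y} → ¬ (x ≡ 0F) → Square x → Square (x *F y) → Square y
  square-cancel {x} {y} x≢0 (a , refl) (c , e) = c *F i a , FP.*-cancelˡ-≢0 x≢0
    (linF₂ 1F (c *F c *F (a *F i a +F 1F)) e (i-r a≢0)
      (solveF 4 (λ a u c y → a ⊗ a ⊗ (c ⊗ u ⊗ (c ⊗ u)) ⊕ ⊝ (a ⊗ a ⊗ y) ⊜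
        𝟙 ⊗ (c ⊗ c ⊕ ⊝ (a ⊗ a ⊗ y)) ⊕ (c ⊗ c ⊗ (a ⊗ u ⊕ 𝟙)) ⊗ (a ⊗ u ⊕ ⊝ 𝟙)) refl a (i a) c y))
    where
    a≢0 : ¬ (a ≡ 0F)
    a≢0 refl = x≢0 (FP.zeroˡ 0F)

  -- An even power of `gen` is a square, so a nonsquare is an odd power. For `φ-mul` this shows that
  -- the product of two nonsquares is a square.
  nonsquare-gen : ∀ {x} → ¬ (x ≡ 0F) → ¬ Square x → ∃ λ y → gen *F (y *F y) ≡ x
  nonsquare-gen {x} x≢0 ns with gen-generates x x≢0
  ... | j , _ , refl = odd j ns
    where
    half : ∀ j → (∃ λ y → y *F y ≡ gen ^F j) ⊎ (∃ λ y → gen *F (y *F y) ≡ gen ^F j)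
    half zero = inj₁ (1F , FP.*-identityˡ 1F)
    half (suc j) with half j
    ... | inj₁ (y , e) = inj₂ (y , cong (gen *F_) e)
    ... | inj₂ (y , e) = inj₁ (gen *F y , trans (solveF 2 (λ g y → (g ⊗ y) ⊗ (g ⊗ y) ⊜ g ⊗ (g ⊗ (y ⊗ y))) refl gen y) (cong (gen *F_) e))
    odd : ∀ j → ¬ Square (gen ^F j) → ∃ λ y → gen *F (y *F y) ≡ gen ^F j
    odd j ns with half j
    ... | inj₁ s = ⊥-elim (ns s)
    ... | inj₂ h = h

  φ-mul : ∀ x y → φ (x *F y) ≡ φ x * φ y
  φ-mul x y with φ-view x | φ-view y
  ... | zero refl e | _ = trans (trans (cong φ (FP.zeroˡ y)) φ-at-0) (sym (trans (cong (_* φ y) e) (zeroˡ _)))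
  ... | square _ _ _ | zero refl e = trans (trans (cong φ (FP.zeroʳ x)) φ-at-0) (sym (trans (cong (φ x *_) e) (zeroʳ _)))
  ... | nonsquare _ _ _ | zero refl e = trans (trans (cong φ (FP.zeroʳ x)) φ-at-0) (sym (trans (cong (φ x *_) e) (zeroʳ _)))
  ... | square x≢0 sx ex | square y≢0 sy ey = trans (φ-of-square (FP.*-≢0 x≢0 y≢0) (square-* sx sy))
          (sym (trans (cong₂ _*_ ex ey) (*-identityˡ 1#)))
  ... | square x≢0 sx ex | nonsquare y≢0 ny ey = trans (φ-of-nonsquare (FP.*-≢0 x≢0 y≢0) (λ s → ny (square-cancel x≢0 sx s)))
          (sym (trans (cong₂ _*_ ex ey) (*-identityˡ _)))
  ... | nonsquare x≢0 nx ex | square y≢0 sy ey = trans (φ-of-nonsquare (FP.*-≢0 x≢0 y≢0)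
          (λ s → nx (square-cancel y≢0 sy (subst Square (FP.*-comm x y) s))))
          (sym (trans (cong₂ _*_ ex ey) (*-identityʳ _)))
  ... | nonsquare x≢0 nx ex | nonsquare y≢0 ny ey with nonsquare-gen x≢0 nx | nonsquare-gen y≢0 ny
  ...   | a , refl | b , refl = trans (φ-of-square (FP.*-≢0 x≢0 y≢0)
            (gen *F a *F b , solveF 3 (λ g a b → (g ⊗ a ⊗ b) ⊗ (g ⊗ a ⊗ b) ⊜ (g ⊗ (a ⊗ a)) ⊗ (g ⊗ (b ⊗ b))) refl gen a b))
          (sym (trans (cong₂ _*_ ex ey) (solve 0 ((:- :1) :* (:- :1) := :1) refl)))

  φ-isCharacter : IsCharacter φ
  φ-isCharacter = record { χ-0 = φ-at-0 ; χ-1 = φ-of-square 1≢0 (1F , FP.*-identityˡ 1F) ; χ-mul = φ-mul }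

  φ-sq : ∀ {x} → ¬ (x ≡ 0F) → φ (x *F x) ≡ 1#
  φ-sq x≢0 = φ-of-square (FP.*-≢0 x≢0 x≢0) (_ , refl)

  φ²≡1 : ∀ {x} → ¬ (x ≡ 0F) → φ x * φ x ≡ 1#
  φ²≡1 x≢0 = trans (sym (φ-mul _ _)) (φ-sq x≢0)

  φ-i : ∀ x → φ (i x) ≡ φ x
  φ-i x = cases (x ≟ 0F)
    where
    cases : Dec (x ≡ 0F) → φ (i x) ≡ φ x
    cases (yes refl) = cong φ i-0
    cases (no x≢0) = lin₂ (φ (i x)) (- φ x) (sym (φ²≡1 x≢0)) (sym (χ-i φ-isCharacter x≢0))
      (solve 2 (λ u v → v :+ :- u := v :* (:1 :+ :- (u :* u)) :+ (:- u) :* (:1 :+ :- (u :* v))) refl _ _)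

  x≢-x : ∀ {x} → ¬ (x ≡ 0F) → ¬ (x ≡ -F x)
  x≢-x {x} x≢0 e = FP.*-≢0 2≢0 x≢0 (linF₁ 1F e (solveF 1 (λ x → (𝟙 ⊕ 𝟙) ⊗ x ⊕ ⊝ 𝟘 ⊜ 𝟙 ⊗ (x ⊕ ⊝ (⊝ x))) refl x))

  -- For a nonzero square the two roots y and -y differ because 2 ≠ 0. The lemma serves to turn a
  -- sum of h(γ²) over γ into a sum of (1 + φ(n)) h(n) over n.
  count-square-roots : ∀ n → Σ (λ γ → δ (γ *F γ) n) ≡ 1# + φ n
  count-square-roots n with φ-view n
  ... | zero refl e = begin
    Σ (λ γ → δ (γ *F γ) 0F)   ≡⟨ Σ-cong (λ γ → trans (δ-⇔ (root γ) (λ { refl → FP.zeroˡ 0F })) (sym (*-identityʳ _))) ⟩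
    Σ (λ γ → δ γ 0F * 1#)     ≡⟨ Σ-δ (λ _ → 1#) 0F ⟩
    1#                        ≡⟨ sym (trans (cong (1# +_) e) (+-identityʳ 1#)) ⟩
    1# + φ 0F                 ∎
    where
    root : ∀ γ → γ *F γ ≡ 0F → γ ≡ 0F
    root γ e with γ ≟ 0F
    ... | yes γ≡0 = γ≡0
    ... | no γ≢0 = ⊥-elim (FP.*-≢0 γ≢0 γ≢0 e)
  ... | nonsquare _ ns e = begin
    Σ (λ γ → δ (γ *F γ) n)    ≡⟨ Σ-cong (λ γ → δ-≢ (λ h → ns (γ , h))) ⟩
    Σ (λ γ → 0#)              ≡⟨ Σ-0 ⟩
    0#                        ≡⟨ sym (trans (cong (1# +_) e) (-‿inverseʳ 1#)) ⟩
    1# + φ n                  ∎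
  ... | square n≢0 (y , refl) e = begin
    Σ (λ γ → δ (γ *F γ) (y *F y))             ≡⟨ Σ-cong split ⟩
    Σ (λ γ → δ γ y * 1# + δ γ (-F y) * 1#)    ≡⟨ Σ-+ ⟩
    Σ (λ γ → δ γ y * 1#) + Σ (λ γ → δ γ (-F y) * 1#)  ≡⟨ cong₂ _+_ (Σ-δ (λ _ → 1#) y) (Σ-δ (λ _ → 1#) (-F y)) ⟩
    1# + 1#                                   ≡⟨ cong (1# +_) (sym e) ⟩
    1# + φ (y *F y)                           ∎
    where
    y≢0 : ¬ (y ≡ 0F)
    y≢0 refl = n≢0 (FP.zeroˡ 0F)
    split : ∀ γ → δ (γ *F γ) (y *F y) ≡ δ γ y * 1# + δ γ (-F y) * 1#
    split γ with γ ≟ y | γ ≟ (-F y)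
    ... | yes refl | yes h = ⊥-elim (x≢-x y≢0 h)
    ... | yes refl | no _ = trans (δ-≡ refl) (solve 0 (:1 := :1 :* :1 :+ :0 :* :1) refl)
    ... | no _ | yes refl = trans (δ-≡ (solveF 1 (λ y → (⊝ y) ⊗ (⊝ y) ⊜ y ⊗ y) refl y)) (solve 0 (:1 := :0 :* :1 :+ :1 :* :1) refl)
    ... | no h₁ | no h₂ = trans (δ-≢ λ e → cases (≡-or-opposite e)) (solve 0 (:0 := :0 :* :1 :+ :0 :* :1) refl)
      where
      cases : ¬ (γ ≡ y ⊎ γ ≡ -F y)
      cases (inj₁ h) = h₁ h
      cases (inj₂ h) = h₂ h

  Σ-1 : Σ (λ _ → 1#) ≡ qK
  Σ-1 = trans (go elems) (cong _×1 card)
    where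
    go : ∀ xs → ∑ xs (λ (_ : F) → 1#) ≡ length xs ×1
    go [] = refl
    go (x ∷ xs) = cong (1# +_) (go xs)

  -- Counting F by the squares of its elements gives q = Σ (1 + φ) = q + Σ φ, so no nonsquare has to
  -- be exhibited.
  φ-nontrivial : Nontrivial φ
  φ-nontrivial = begin
    Σ φ              ≡⟨ solve 2 (λ s t → s := (t :+ s) :+ :- t) refl (Σ φ) (Σ (λ _ → 1#)) ⟩
    (Σ (λ _ → 1#) + Σ φ) + - Σ (λ _ → 1#)  ≡⟨ cong (_+ - Σ (λ _ → 1#)) (sym total) ⟩
    Σ (λ _ → 1#) + - Σ (λ _ → 1#)          ≡⟨ -‿inverseʳ _ ⟩
    0#                                     ∎
    where
    total : Σ (λ _ → 1#) ≡ Σ (λ _ → 1#) + Σ φ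
    total = begin
      Σ (λ _ → 1#)                               ≡⟨ Σ-cong (λ γ → sym (Σ-δ (λ _ → 1#) (γ *F γ))) ⟩
      Σ (λ γ → Σ (λ n → δ n (γ *F γ) * 1#))      ≡⟨ Σ-swap ⟩
      Σ (λ n → Σ (λ γ → δ n (γ *F γ) * 1#))      ≡⟨ Σ-cong (λ n → Σ-cong (λ γ → trans (*-identityʳ _) (δ-sym _ _))) ⟩
      Σ (λ n → Σ (λ γ → δ (γ *F γ) n))           ≡⟨ Σ-cong count-square-roots ⟩
      Σ (λ n → 1# + φ n)                         ≡⟨ Σ-+ ⟩
      Σ (λ _ → 1#) + Σ φ                         ∎

module Clausen (𝔽 : FiniteField) (𝕂 : CharZeroField) (ζ ω : CharZeroField.K 𝕂)
  (ζ^p≡1 : CharZeroField._^_ 𝕂 ζ (FiniteField.p 𝔽) ≡ CharZeroField.1# 𝕂)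
  (ζ≢1 : ¬ (ζ ≡ CharZeroField.1# 𝕂))
  (ω^N≡1 : CharZeroField._^_ 𝕂 ω (FiniteFieldProperties.N 𝔽) ≡ CharZeroField.1# 𝕂)
  (ω-primitive : ∀ k → 0 < k → k < FiniteFieldProperties.N 𝔽 →
                 ¬ (CharZeroField._^_ 𝕂 ω k ≡ CharZeroField.1# 𝕂)) where

  open Characters 𝔽 𝕂 ζ ω
  open ≡-Reasoning

  -- Gauss sums

  ∑-map : ∀ {X Y : Set} (h : X → Y) xs (f : Y → K) → ∑ (map h xs) f ≡ ∑ xs (λ x → f (h x))
  ∑-map h [] f = refl
  ∑-map h (x ∷ xs) f = cong (f (h x) +_) (∑-map h xs f)

  dlog-spec : ∀ {x} → ¬ (x ≡ 0F) → gen ^F dlog x ≡ x × dlog x < N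
  dlog-spec {x} x≢0 = does-true ((gen ^F dlog x) ≟ x) (proj₁ found) , ∈-upTo⁻ (proj₂ found)
    where
    log : ∃ λ j → (j < N) × (gen ^F j ≡ x)
    log = gen-generates x x≢0
    test : ℕ → Bool
    test j = does ((gen ^F j) ≟ x)
    found : test (dlog x) ≡ true × dlog x ∈ upTo N
    found = find-spec test 0 (upTo N) (∈-upTo⁺ (proj₁ (proj₂ log))) (true-does ((gen ^F proj₁ log) ≟ x) (proj₂ (proj₂ log)))

  χ[k]-≢0 : ∀ k {x} → ¬ (x ≡ 0F) → χ[ k ] x ≡ (ω ^ dlog x) ^ k
  χ[k]-≢0 k {x} x≢0 with x ≟ 0F
  ... | yes x≡0 = ⊥-elim (x≢0 x≡0)
  ... | no _ = KP.^-* ω k (dlog x)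

  χ[k]-0 : ∀ k {x} → x ≡ 0F → χ[ k ] x ≡ 0#
  χ[k]-0 k {x} x≡0 with x ≟ 0F
  ... | yes _ = refl
  ... | no x≢0 = ⊥-elim (x≢0 x≡0)

  ω^dlog-1 : ω ^ dlog 1F ≡ 1#
  ω^dlog-1 = FP.^-gen ringK {ω} {dlog 1F} {0} ω^N≡1 (proj₁ (dlog-spec 1≢0))

  ω^dlog-* : ∀ {x y} → ¬ (x ≡ 0F) → ¬ (y ≡ 0F) → ω ^ dlog (x *F y) ≡ ω ^ dlog x * ω ^ dlog y
  ω^dlog-* {x} {y} x≢0 y≢0 = trans (FP.^-gen ringK {ω} {dlog (x *F y)} {dlog x ℕ.+ dlog y} ω^N≡1 (begin
      gen ^F dlog (x *F y)                ≡⟨ proj₁ (dlog-spec (FP.*-≢0 x≢0 y≢0)) ⟩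
      x *F y                              ≡⟨ sym (cong₂ _*F_ (proj₁ (dlog-spec x≢0)) (proj₁ (dlog-spec y≢0))) ⟩
      (gen ^F dlog x) *F (gen ^F dlog y)  ≡⟨ sym (Powers.^-+ (ringOf 𝔽) gen (dlog x) (dlog y)) ⟩
      gen ^F (dlog x ℕ.+ dlog y)          ∎))
    (KP.^-+ ω (dlog x) (dlog y))

  χ[k]-isCharacter : ∀ k → IsCharacter χ[ k ]
  χ[k]-isCharacter k = record
    { χ-0 = χ[k]-0 k refl
    ; χ-1 = trans (χ[k]-≢0 k 1≢0) (trans (cong (_^ k) ω^dlog-1) (KP.1^ k))
    ; χ-mul = λ x y → mul x y (x ≟ 0F) (y ≟ 0F) }
    where
    mul : ∀ x y → Dec (x ≡ 0F) → Dec (y ≡ 0F) → χ[ k ] (x *F y) ≡ χ[ k ] x * χ[ k ] y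
    mul x y (yes x≡0) _ = trans (χ[k]-0 k (trans (cong (_*F y) x≡0) (FP.zeroˡ y)))
      (sym (trans (cong (_* χ[ k ] y) (χ[k]-0 k x≡0)) (zeroˡ _)))
    mul x y (no _) (yes y≡0) = trans (χ[k]-0 k (trans (cong (x *F_) y≡0) (FP.zeroʳ x)))
      (sym (trans (cong (χ[ k ] x *_) (χ[k]-0 k y≡0)) (zeroʳ _)))
    mul x y (no x≢0) (no y≢0) = begin
      χ[ k ] (x *F y)                    ≡⟨ χ[k]-≢0 k (FP.*-≢0 x≢0 y≢0) ⟩
      (ω ^ dlog (x *F y)) ^ k            ≡⟨ cong (_^ k) (ω^dlog-* x≢0 y≢0) ⟩
      (ω ^ dlog x * ω ^ dlog y) ^ k      ≡⟨ KP.*-^ _ _ k ⟩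
      (ω ^ dlog x) ^ k * (ω ^ dlog y) ^ k ≡⟨ sym (cong₂ _*_ (χ[k]-≢0 k x≢0) (χ[k]-≢0 k y≢0)) ⟩
      χ[ k ] x * χ[ k ] y                ∎

  -- For t different from 0 and 1 this is a geometric series with ratio ω^(dlog t). The ratio is not
  -- 1, because 0 < dlog t < N and ω is primitive, while its N-th power is 1.
  orthogonality : ∀ t → ∑ (upTo N) (λ k → χ[ k ] t) ≡ δ t 1F * N ×1
  orthogonality t = cases (t ≟ 0F) (t ≟ 1F)
    where
    count : ∀ (xs : List ℕ) → ∑ xs (λ _ → 1#) ≡ length xs ×1
    count [] = refl
    count (x ∷ xs) = cong (1# +_) (count xs)
    none : ∀ {S} → ¬ (t ≡ 1F) → S ≡ 0# → S ≡ δ t 1F * N ×1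
    none t≢1 e = trans e (sym (trans (cong (_* N ×1) (δ-≢ t≢1)) (zeroˡ _)))
    cases : Dec (t ≡ 0F) → Dec (t ≡ 1F) → ∑ (upTo N) (λ k → χ[ k ] t) ≡ δ t 1F * N ×1
    cases _ (yes refl) = begin
      ∑ (upTo N) (λ k → χ[ k ] 1F)   ≡⟨ ∑-cong (upTo N) (λ k → χ-1 (χ[k]-isCharacter k)) ⟩
      ∑ (upTo N) (λ _ → 1#)          ≡⟨ trans (count (upTo N)) (cong _×1 (length-upTo N)) ⟩
      N ×1                           ≡⟨ sym (trans (cong (_* N ×1) (δ-≡ refl)) (*-identityˡ _)) ⟩
      δ 1F 1F * N ×1                 ∎
    cases (yes t≡0) (no t≢1) = none t≢1 (trans (∑-cong (upTo N) (λ k → χ[k]-0 k t≡0)) (∑-0 (upTo N)))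
    cases (no t≢0) (no t≢1) = none t≢1 (KF.*-≡0 (KF.diff-≢0 (ω-primitive (dlog t) positive (proj₂ (dlog-spec t≢0)))) (begin
      (ω ^ dlog t + - 1#) * ∑ (upTo N) (λ k → χ[ k ] t)
        ≡⟨ KP.geometric (ω ^ dlog t) N (λ k → k) (λ k → χ[ k ] t) 1# (λ k → trans (χ[k]-≢0 k t≢0) (sym (*-identityˡ _))) ⟩
      1# * ((ω ^ dlog t) ^ N + - 1#)
        ≡⟨ trans (*-identityˡ _) (diff-0 (trans (sym (KP.^-*-comm ω (dlog t) N)) (KP.^-∣-1 ω {N} ω^N≡1 (divides (dlog t) refl)))) ⟩
      0# ∎))
      where
      positive : 0 < dlog t
      positive with dlog t in eq
      ... | zero = ⊥-elim (t≢1 (trans (sym (proj₁ (dlog-spec t≢0))) (cong (gen ^F_) eq)))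
      ... | suc _ = s≤s z≤n

  -- The additive character.

  toℕ-spec : ∀ α → (toℕ (tr α) ×1F) ≡ tr α × toℕ (tr α) < p
  toℕ-spec α = does-true ((toℕ (tr α) ×1F) ≟ tr α) (proj₁ found) , ∈-upTo⁻ (proj₂ found)
    where
    root : ∃ λ k → (k < p) × (k ×1F ≡ tr α)
    root = FP.prime-field (tr α) (FP.trace-^p α)
    test : ℕ → Bool
    test k = does ((k ×1F) ≟ tr α)
    found : test (toℕ (tr α)) ≡ true × toℕ (tr α) ∈ upTo p
    found = find-spec test 0 (upTo p) (∈-upTo⁺ (proj₁ (proj₂ root))) (true-does ((proj₁ root ×1F) ≟ tr α) (proj₂ (proj₂ root)))

  -- The representative `toℕ` is additive only up to multiples of p, and ζ does not see these.
  ζ^-cong : ∀ m n → m ×1F ≡ n ×1F → ζ ^ m ≡ ζ ^ n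
  ζ^-cong m n e = cases (ℕₚ.≤-total m n)
    where
    go : ∀ m n → m ≤ n → m ×1F ≡ n ×1F → ζ ^ n ≡ ζ ^ m
    go m n m≤n e = begin
      ζ ^ n                   ≡⟨ cong (ζ ^_) (sym (ℕₚ.m+[n∸m]≡n m≤n)) ⟩
      ζ ^ (m ℕ.+ (n ∸ m))     ≡⟨ KP.^-+ ζ m (n ∸ m) ⟩
      ζ ^ m * ζ ^ (n ∸ m)     ≡⟨ cong (ζ ^ m *_) (KP.^-∣-1 ζ {p} {n ∸ m} ζ^p≡1 (FP.cast-≡0 difference)) ⟩
      ζ ^ m * 1#              ≡⟨ *-identityʳ _ ⟩
      ζ ^ m                   ∎
      where
      difference : (n ∸ m) ×1F ≡ 0F
      difference = linF₁ (-F 1F) (trans e (trans (cong _×1F (sym (ℕₚ.m+[n∸m]≡n m≤n))) (Powers.cast-+ (ringOf 𝔽) m (n ∸ m))))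
        (solveF 2 (λ d m → d ⊕ ⊝ 𝟘 ⊜ ⊝ 𝟙 ⊗ (m ⊕ ⊝ (m ⊕ d))) refl _ _)
    cases : m ≤ n ⊎ n ≤ m → ζ ^ m ≡ ζ ^ n
    cases (inj₁ m≤n) = sym (go m n m≤n e)
    cases (inj₂ n≤m) = go n m n≤m (sym e)

  θ-+ : ∀ x y → θ (x +F y) ≡ θ x * θ y
  θ-+ x y = trans (ζ^-cong (toℕ (tr (x +F y))) (toℕ (tr x) ℕ.+ toℕ (tr y)) (begin
      toℕ (tr (x +F y)) ×1F                    ≡⟨ proj₁ (toℕ-spec (x +F y)) ⟩
      tr (x +F y)                              ≡⟨ FP.trace-+ x y ⟩
      tr x +F tr y                             ≡⟨ sym (cong₂ _+F_ (proj₁ (toℕ-spec x)) (proj₁ (toℕ-spec y))) ⟩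
      (toℕ (tr x) ×1F) +F (toℕ (tr y) ×1F)     ≡⟨ sym (Powers.cast-+ (ringOf 𝔽) (toℕ (tr x)) (toℕ (tr y))) ⟩
      (toℕ (tr x) ℕ.+ toℕ (tr y)) ×1F          ∎))
    (KP.^-+ ζ (toℕ (tr x)) (toℕ (tr y)))

  -- An element of nonzero trace has an exponent strictly between 0 and p, hence prime to p. With
  -- ζ^p = 1, the equation θ(c) = 1 would then force ζ = 1.
  θ-nontrivial : ∃ λ c → ¬ (θ c ≡ 1#)
  θ-nontrivial = c , λ θ≡1 → ζ≢1 (KP.^-coprime ζ
      (prime⇒coprime p-prime {{ℕ.≢-nonZero positive}} (proj₂ (toℕ-spec c))) ζ^p≡1 θ≡1)
    where
    c : F
    c = proj₁ FP.trace-nonzero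
    positive : ¬ (toℕ (tr c) ≡ 0)
    positive e = proj₂ FP.trace-nonzero (trans (sym (proj₁ (toℕ-spec c))) (cong _×1F e))

  Σ-θ : Σ θ ≡ 0#
  Σ-θ = KF.*-≡0 (KF.diff-≢0 (proj₂ θ-nontrivial)) (begin
    (θ c + - 1#) * Σ θ
      ≡⟨ solve 2 (λ g s → (g :+ :- :1) :* s := g :* s :+ :- s) refl _ _ ⟩
    θ c * Σ θ + - Σ θ  ≡⟨ diff-0 (sym shifted) ⟩
    0#                 ∎)
    where
    c : F
    c = proj₁ θ-nontrivial
    shifted : Σ θ ≡ θ c * Σ θ
    shifted = begin
      Σ θ                   ≡⟨ sym (reindex-↔ θ (c +F_) (-F c +F_)
        (λ x → solveF 2 (λ c x → ⊝ c ⊕ (c ⊕ x) ⊜ x) refl c x) (λ x → solveF 2 (λ c x → c ⊕ (⊝ c ⊕ x) ⊜ x) refl c x)) ⟩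
      Σ (λ x → θ (c +F x))  ≡⟨ Σ-cong (θ-+ c) ⟩
      Σ (λ x → θ c * θ x)   ≡⟨ Σ-*ˡ (θ c) ⟩
      θ c * Σ θ             ∎

  θ-0 : θ 0F ≡ 1#
  θ-0 = ζ^-cong (toℕ (tr 0F)) 0 (trans (proj₁ (toℕ-spec 0F)) tr-0)
    where
    tr-0 : tr 0F ≡ 0F
    tr-0 = linF₁ (-F 1F) (trans (cong tr (sym (FP.+-identityˡ 0F))) (FP.trace-+ 0F 0F))
      (solveF 1 (λ t → t ⊕ ⊝ 𝟘 ⊜ ⊝ 𝟙 ⊗ (t ⊕ ⊝ (t ⊕ t))) refl (tr 0F))

  i-cancelˡ : ∀ {t} → ¬ (t ≡ 0F) → ∀ x → i t *F (t *F x) ≡ x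
  i-cancelˡ {t} t≢0 x = linF₁ x (i-r t≢0) (solveF 3 (λ t u x → u ⊗ (t ⊗ x) ⊕ ⊝ x ⊜ x ⊗ (t ⊗ u ⊕ ⊝ 𝟙)) refl t (i t) x)

  i-cancelʳ : ∀ {t} → ¬ (t ≡ 0F) → ∀ x → t *F (i t *F x) ≡ x
  i-cancelʳ {t} t≢0 x = linF₁ x (i-r t≢0) (solveF 3 (λ t u x → t ⊗ (u ⊗ x) ⊕ ⊝ x ⊜ x ⊗ (t ⊗ u ⊕ ⊝ 𝟙)) refl t (i t) x)

  Σ-scale : ∀ (f : F → K) {t} → ¬ (t ≡ 0F) → Σ (λ x → f (t *F x)) ≡ Σ f
  Σ-scale f {t} t≢0 = reindex-↔ f (t *F_) (i t *F_) (i-cancelˡ t≢0) (i-cancelʳ t≢0)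

  1-fraction : ∀ {a} → ¬ (1F +F a ≡ 0F) → 1F +F -F (a *F i (1F +F a)) ≡ i (1F +F a)
  1-fraction {a} ne = linF₁ (-F 1F) (i-r ne)
    (solveF 2 (λ a u → 𝟙 ⊕ ⊝ (a ⊗ u) ⊕ ⊝ u ⊜ ⊝ 𝟙 ⊗ ((𝟙 ⊕ a) ⊗ u ⊕ ⊝ 𝟙)) refl a (i (1F +F a)))

  -- The substitution x = a / (1 + a).
  fraction : ∀ {f g : F → K} → f 1F ≡ 0# → g (-F 1F) ≡ 0# →
             (∀ a → ¬ (1F +F a ≡ 0F) → g a ≡ f (a *F i (1F +F a))) → Σ f ≡ Σ g
  fraction {f} {g} f-1 g-1 e = reindex (λ x → x *F i (1F +F -F x)) (λ a → a *F i (1F +F a)) to from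
    where
    σ τ : F → F
    σ x = x *F i (1F +F -F x)
    τ a = a *F i (1F +F a)
    τσ : ∀ x → ¬ (1F +F -F x ≡ 0F) → ¬ (1F +F σ x ≡ 0F) × τ (σ x) ≡ x
    τσ x ne = FP.unit-≢0 inverse , trans (cong (σ x *F_) (i-unique inverse))
      (linF₁ x (i-r ne) (solveF 2 (λ x u → x ⊗ u ⊗ (𝟙 ⊕ ⊝ x) ⊕ ⊝ x ⊜ x ⊗ ((𝟙 ⊕ ⊝ x) ⊗ u ⊕ ⊝ 𝟙)) refl x (i (1F +F -F x))))
      where
      inverse : (1F +F σ x) *F (1F +F -F x) ≡ 1F
      inverse = linF₁ x (i-r ne) (solveF 2 (λ x u → (𝟙 ⊕ x ⊗ u) ⊗ (𝟙 ⊕ ⊝ x) ⊕ ⊝ 𝟙 ⊜ x ⊗ ((𝟙 ⊕ ⊝ x) ⊗ u ⊕ ⊝ 𝟙)) refl x (i (1F +F -F x)))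
    στ : ∀ a → ¬ (1F +F a ≡ 0F) → σ (τ a) ≡ a
    στ a ne = trans (cong (λ u → τ a *F i u) (1-fraction ne)) (trans (cong (τ a *F_) (i-involutive _))
      (linF₁ a (i-r ne) (solveF 2 (λ a u → a ⊗ u ⊗ (𝟙 ⊕ a) ⊕ ⊝ a ⊜ a ⊗ ((𝟙 ⊕ a) ⊗ u ⊕ ⊝ 𝟙)) refl a (i (1F +F a)))))
    to : ∀ x → f x ≡ 0# ⊎ (τ (σ x) ≡ x × g (σ x) ≡ f x)
    to x with (1F +F -F x) ≟ 0F
    ... | yes h = inj₁ (trans (cong f (linF₁ (-F 1F) h (solveF 1 (λ x → x ⊕ ⊝ 𝟙 ⊜ ⊝ 𝟙 ⊗ (𝟙 ⊕ ⊝ x ⊕ ⊝ 𝟘)) refl x))) f-1)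
    ... | no ne = inj₂ (proj₂ (τσ x ne) , trans (e (σ x) (proj₁ (τσ x ne))) (cong f (proj₂ (τσ x ne))))
    from : ∀ a → g a ≡ 0# ⊎ (σ (τ a) ≡ a × f (τ a) ≡ g a)
    from a with (1F +F a) ≟ 0F
    ... | yes h = inj₁ (trans (cong g (linF₁ 1F h (solveF 1 (λ a → a ⊕ ⊝ (⊝ 𝟙) ⊜ 𝟙 ⊗ (𝟙 ⊕ a ⊕ ⊝ 𝟘)) refl a))) g-1)
    ... | no ne = inj₂ (στ a ne , sym (e a ne))

  Σ-θ-scaled : ∀ s → Σ (λ x → θ (s *F x)) ≡ δ s 0F * qK
  Σ-θ-scaled s with s ≟ 0F
  ... | yes refl = trans (Σ-cong (λ x → trans (cong θ (FP.zeroˡ x)) θ-0)) (trans Σ-1 (sym (*-identityˡ qK)))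
  ... | no s≢0 = trans (Σ-scale θ s≢0) (trans Σ-θ (sym (zeroˡ qK)))

  -- For t ≠ 0 this is the substitution x ↦ tx. At t = 0 the convention i 0 = 0 makes the right side
  -- vanish, and nontriviality makes the left side vanish too.
  gauss-scaled : ∀ {χ} → IsCharacter χ → Nontrivial χ → ∀ t → Σ (λ x → χ x * θ (t *F x)) ≡ χ (i t) * g χ
  gauss-scaled {χ} h nt t = cases (t ≟ 0F)
    where
    cases : Dec (t ≡ 0F) → Σ (λ x → χ x * θ (t *F x)) ≡ χ (i t) * g χ
    cases (yes refl) = begin
      Σ (λ x → χ x * θ (0F *F x))   ≡⟨ Σ-cong (λ x → trans (cong (χ x *_) (trans (cong θ (FP.zeroˡ x)) θ-0)) (*-identityʳ _)) ⟩
      Σ χ                           ≡⟨ nt ⟩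
      0#                            ≡⟨ sym (trans (cong (_* g χ) (trans (cong χ i-0) (χ-0 h))) (zeroˡ _)) ⟩
      χ (i 0F) * g χ                ∎
    cases (no t≢0) = begin
      Σ (λ x → χ x * θ (t *F x))
        ≡⟨ Σ-cong (λ x → trans (cong (_* θ (t *F x)) (trans (cong χ (sym (i-cancelˡ t≢0 x))) (χ-mul h _ _))) (*-assoc _ _ _)) ⟩
      Σ (λ x → χ (i t) * (χ (t *F x) * θ (t *F x)))   ≡⟨ Σ-*ˡ (χ (i t)) ⟩
      χ (i t) * Σ (λ x → χ (t *F x) * θ (t *F x))     ≡⟨ cong (χ (i t) *_) (Σ-scale (λ x → χ x * θ x) t≢0) ⟩
      χ (i t) * g χ                                   ∎

  -- Products of Gauss sums.

  Σ-*-Σ : ∀ (f h : F → K) → Σ f * Σ h ≡ Σ (λ x → Σ (λ y → f x * h y))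
  Σ-*-Σ f h = sym (trans (Σ-cong (λ x → Σ-*ˡ (f x))) (Σ-*ʳ (Σ h)))

  -- The substitution y = x t in the double sum of a product of Gauss sums.
  gauss-product : ∀ {A B} → IsCharacter A → IsCharacter B →
                  g A * g B ≡ Σ (λ t → B t * Σ (λ x → A x * B x * θ ((1F +F t) *F x)))
  gauss-product {A} {B} hA hB = begin
    g A * g B
      ≡⟨ Σ-*-Σ (λ x → A x * θ x) (λ y → B y * θ y) ⟩
    Σ (λ x → Σ (λ y → A x * θ x * (B y * θ y)))
      ≡⟨ Σ-cong (λ x → substitute x (x ≟ 0F)) ⟩
    Σ (λ x → Σ (λ t → B t * (A x * B x * θ ((1F +F t) *F x))))
      ≡⟨ Σ-swap ⟩
    Σ (λ t → Σ (λ x → B t * (A x * B x * θ ((1F +F t) *F x))))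
      ≡⟨ Σ-cong (λ t → Σ-*ˡ (B t)) ⟩
    Σ (λ t → B t * Σ (λ x → A x * B x * θ ((1F +F t) *F x)))  ∎
    where
    substitute : ∀ x → Dec (x ≡ 0F) → Σ (λ y → A x * θ x * (B y * θ y)) ≡ Σ (λ t → B t * (A x * B x * θ ((1F +F t) *F x)))
    substitute x (yes refl) = Σ-cong (λ y → trans (cong (λ a → a * θ 0F * (B y * θ y)) (χ-0 hA))
      (trans (solve 4 (λ a b c d → :0 :* a :* b := c :* (:0 :* d)) refl _ _ (B y) (B 0F * θ ((1F +F y) *F 0F)))
        (cong (B y *_) (trans (cong (_* (B 0F * θ ((1F +F y) *F 0F))) (sym (χ-0 hA))) (sym (*-assoc _ _ _))))))
    substitute x (no x≢0) = trans (sym (Σ-scale (λ y → A x * θ x * (B y * θ y)) x≢0)) (Σ-cong λ t → begin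
      A x * θ x * (B (x *F t) * θ (x *F t))
        ≡⟨ cong (λ b → A x * θ x * (b * θ (x *F t))) (χ-mul hB x t) ⟩
      A x * θ x * (B x * B t * θ (x *F t))
        ≡⟨ solve 5 (λ a b c d e → a :* d :* (b :* c :* e) := c :* (a :* b :* (d :* e))) refl _ _ _ _ _ ⟩
      B t * (A x * B x * (θ x * θ (x *F t)))
        ≡⟨ cong (λ u → B t * (A x * B x * u)) (trans (sym (θ-+ _ _)) (cong θ (solveF 2 (λ x t → x ⊕ x ⊗ t ⊜ (𝟙 ⊕ t) ⊗ x) refl x t))) ⟩
      B t * (A x * B x * θ ((1F +F t) *F x))  ∎)

  -- The Jacobi sum Σ B(x) A(1 - x) after x = t / (1 + t), the shape in which `gauss-product`
  -- delivers it.
  jacobi : Char → Char → K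
  jacobi A B = Σ (λ t → B t * (A · B) (i (1F +F t)))

  gauss-jacobi : ∀ {A B} → IsCharacter A → IsCharacter B → Nontrivial (A · B) →
                 g A * g B ≡ jacobi A B * g (A · B)
  gauss-jacobi {A} {B} hA hB nt = trans (gauss-product hA hB) (trans
    (Σ-cong (λ t → trans (cong (B t *_) (gauss-scaled (·-isCharacter hA hB) nt (1F +F t))) (sym (*-assoc _ _ _))))
    (Σ-*ʳ (g (A · B))))

  gauss-cong : ∀ {A B} → A ≈χ B → g A ≡ g B
  gauss-cong e = Σ-cong (λ x → cong (_* θ x) (e x))

  conj-nontrivial : ∀ {χ} → IsCharacter χ → Nontrivial χ → Nontrivial (conj χ)
  conj-nontrivial {χ} h nt = trans (Σ-cong (conj-i h)) (trans (reindex-↔ χ i i i-involutive i-involutive) nt)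

  χ-conj : ∀ {χ} → IsCharacter χ → ∀ x → χ x * conj χ x ≡ 1# + - δ x 0F
  χ-conj {χ} h x with x ≟ 0F
  ... | yes refl = trans (zeroʳ _) (sym (-‿inverseʳ 1#))
  ... | no x≢0 = trans (trans (sym (χ-mul h _ _)) (trans (cong χ (invF-r x x≢0)) (χ-1 h))) (solve 0 (:1 := :1 :+ :- :0) refl)

  -- Since χ times its conjugate is 1 away from 0, the inner sum of `gauss-product` is q at t = -1
  -- and 0 elsewhere, diminished by 1. The constant -1 disappears against Σ conj χ = 0.
  gauss-conj : ∀ {χ} → IsCharacter χ → Nontrivial χ → g χ * g (conj χ) ≡ χ (-F 1F) * qK
  gauss-conj {χ} h nt = begin
    g χ * g (conj χ)  ≡⟨ gauss-product h (conj-isCharacter h) ⟩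
    Σ (λ t → conj χ t * Σ (λ x → χ x * conj χ x * θ ((1F +F t) *F x)))
      ≡⟨ Σ-cong (λ t → cong (conj χ t *_) (inner t)) ⟩
    Σ (λ t → conj χ t * (δ t (-F 1F) * qK + - 1#))
      ≡⟨ Σ-cong (λ t → solve 3 (λ c d q → c :* (d :* q :+ :- :1) := d :* (c :* q) :+ (:- :1) :* c) refl _ _ _) ⟩
    Σ (λ t → δ t (-F 1F) * (conj χ t * qK) + - 1# * conj χ t)
      ≡⟨ Σ-+ ⟩
    Σ (λ t → δ t (-F 1F) * (conj χ t * qK)) + Σ (λ t → - 1# * conj χ t)
      ≡⟨ cong₂ _+_ (Σ-δ (λ t → conj χ t * qK) (-F 1F)) (trans (Σ-*ˡ (- 1#)) (trans (cong (- 1# *_) (conj-nontrivial h nt)) (zeroʳ _))) ⟩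
    conj χ (-F 1F) * qK + 0#
      ≡⟨ trans (+-identityʳ _) (cong (_* qK) (trans (conj-i h _) (cong χ (i-unique (solveF 0 ((⊝ 𝟙) ⊗ (⊝ 𝟙) ⊜ 𝟙) refl))))) ⟩
    χ (-F 1F) * qK    ∎
    where
    inner : ∀ t → Σ (λ x → χ x * conj χ x * θ ((1F +F t) *F x)) ≡ δ t (-F 1F) * qK + - 1#
    inner t = begin
      Σ (λ x → χ x * conj χ x * θ ((1F +F t) *F x))
        ≡⟨ Σ-cong (λ x → trans (cong (_* θ ((1F +F t) *F x)) (χ-conj h x))
             (solve 2 (λ d u → (:1 :+ :- d) :* u := u :+ d :* ((:- :1) :* u)) refl (δ x 0F) (θ ((1F +F t) *F x)))) ⟩
      Σ (λ x → θ ((1F +F t) *F x) + δ x 0F * (- 1# * θ ((1F +F t) *F x)))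
        ≡⟨ Σ-+ ⟩
      Σ (λ x → θ ((1F +F t) *F x)) + Σ (λ x → δ x 0F * (- 1# * θ ((1F +F t) *F x)))
        ≡⟨ cong₂ _+_ (Σ-θ-scaled (1F +F t)) (Σ-δ (λ x → - 1# * θ ((1F +F t) *F x)) 0F) ⟩
      δ (1F +F t) 0F * qK + - 1# * θ ((1F +F t) *F 0F)
        ≡⟨ cong₂ _+_ (cong (_* qK) (δ-⇔ to from)) (trans (cong (- 1# *_) (trans (cong θ (FP.zeroʳ _)) θ-0)) (*-identityʳ _)) ⟩
      δ t (-F 1F) * qK + - 1#  ∎
      where
      to : 1F +F t ≡ 0F → t ≡ -F 1F
      to e = linF₁ 1F e (solveF 1 (λ t → t ⊕ ⊝ (⊝ 𝟙) ⊜ 𝟙 ⊗ ((𝟙 ⊕ t) ⊕ ⊝ 𝟘)) refl t)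
      from : t ≡ -F 1F → 1F +F t ≡ 0F
      from refl = FP.-‿inverseʳ 1F

  qK≢0 : ¬ (qK ≡ 0#)
  qK≢0 e = ℕₚ.<⇒≢ (ℕₚ.<-trans (s≤s z≤n) FP.2<q) (sym (char-0 q e))

  N≢0 : ¬ (N ×1 ≡ 0#)
  N≢0 e = ℕₚ.<⇒≢ (ℕₚ.<-trans (s≤s z≤n) FP.1<N) (sym (char-0 N e))

  K-2≢0 : ¬ (1# + 1# ≡ 0#)
  K-2≢0 e with char-0 2 (trans (cong (1# +_) (+-identityʳ 1#)) e)
  ... | ()

  gauss-≢0 : ∀ {χ} → IsCharacter χ → Nontrivial χ → ¬ (g χ ≡ 0#)
  gauss-≢0 {χ} h nt e = KF.*-≢0 (KF.unit-≢0 (χ-neg² h)) qK≢0 (trans (sym (gauss-conj h nt)) (trans (cong (_* g (conj χ)) e) (zeroˡ _)))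

  -- 4t/(1+t)² = 1 - s² for s = (1-t)/(1+t)
  hasse-davenport : ∀ {A} → IsCharacter A → Nontrivial A → Nontrivial (A · A) → Nontrivial (A · φ) →
                    A 4F * (g A * g (A · φ)) ≡ g (A · A) * g φ
  hasse-davenport {A} hA ntA ntA² ntAφ = KF.*-cancelˡ-≢0 (gauss-≢0 hA ntA) (begin
    g A * (A 4F * (g A * g (A · φ)))
      ≡⟨ solve 3 (λ a f g → a :* (f :* (a :* g)) := f :* (a :* a) :* g) refl _ _ _ ⟩
    A 4F * (g A * g A) * g (A · φ)
      ≡⟨ cong (λ u → A 4F * u * g (A · φ)) (gauss-jacobi hA hA ntA²) ⟩
    A 4F * (jacobi A A * g (A · A)) * g (A · φ)
      ≡⟨ solve 4 (λ f j s t → f :* (j :* s) :* t := (f :* j) :* t :* s) refl _ _ _ _ ⟩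
    (A 4F * jacobi A A) * g (A · φ) * g (A · A)
      ≡⟨ cong (λ u → u * g (A · φ) * g (A · A)) jacobi-duplication ⟩
    jacobi A φ * g (A · φ) * g (A · A)
      ≡⟨ cong (_* g (A · A)) (sym (gauss-jacobi hA φ-isCharacter ntAφ)) ⟩
    g A * g φ * g (A · A)
      ≡⟨ solve 3 (λ a b c → a :* b :* c := a :* (c :* b)) refl _ _ _ ⟩
    g A * (g (A · A) * g φ)  ∎)
    where
    reflect : Σ (λ u → A (1F +F -F u)) ≡ 0#
    reflect = trans (reindex-↔ A (λ u → 1F +F -F u) (λ u → 1F +F -F u) inv² inv²) ntA
      where
      inv² : ∀ x → 1F +F -F (1F +F -F x) ≡ x
      inv² x = solveF 1 (λ x → 𝟙 ⊕ ⊝ (𝟙 ⊕ ⊝ x) ⊜ x) refl x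
    -- The sum of A(1 - s²) over s becomes one over u = s² with weight 1 + φ(u). The weight 1
    -- contributes Σ A(1 - u) = 0, and the weight φ(u) gives the Jacobi sum of A and φ.
    jacobi-duplication : A 4F * jacobi A A ≡ jacobi A φ
    jacobi-duplication = begin
      A 4F * jacobi A A                                   ≡⟨ sym (Σ-*ˡ (A 4F)) ⟩
      Σ (λ t → A 4F * (A t * (A · A) (i (1F +F t))))      ≡⟨ reindex m m to from ⟩
      Σ (λ s → A (1F +F -F (s *F s)))                     ≡⟨ Σ-cong (λ s → sym (Σ-δ (λ u → A (1F +F -F u)) (s *F s))) ⟩
      Σ (λ s → Σ (λ u → δ u (s *F s) * A (1F +F -F u)))   ≡⟨ Σ-swap ⟩
      Σ (λ u → Σ (λ s → δ u (s *F s) * A (1F +F -F u)))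
        ≡⟨ Σ-cong (λ u → trans (Σ-*ʳ (A (1F +F -F u)))
             (cong (_* A (1F +F -F u)) (trans (Σ-cong (λ s → δ-sym _ _)) (count-square-roots u)))) ⟩
      Σ (λ u → (1# + φ u) * A (1F +F -F u))
        ≡⟨ Σ-cong (λ u → solve 2 (λ f a → (:1 :+ f) :* a := a :+ f :* a) refl (φ u) (A (1F +F -F u))) ⟩
      Σ (λ u → A (1F +F -F u) + φ u * A (1F +F -F u))
        ≡⟨ trans (Σ-+) (trans (cong (_+ Σ (λ u → φ u * A (1F +F -F u))) reflect) (+-identityˡ _)) ⟩
      Σ (λ u → φ u * A (1F +F -F u))                      ≡⟨ fraction (trans (cong (φ 1F *_) (trans (cong A (FP.-‿inverseʳ 1F)) (χ-0 hA))) (zeroʳ _))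
          (trans (cong (φ (-F 1F) *_) (trans (cong (A · φ) (i-≡0 (FP.-‿inverseʳ 1F))) (χ-0 (·-isCharacter hA φ-isCharacter)))) (zeroʳ _))
          unfold ⟩
      jacobi A φ                                          ∎
      where
      f : F → K
      f t = A 4F * (A t * (A · A) (i (1F +F t)))
      m : F → F
      m t = (1F +F -F t) *F i (1F +F t)
      value : ∀ t → ¬ (1F +F t ≡ 0F) → A (1F +F -F (m t *F m t)) ≡ f t
      value t 1+t≢0 = begin
        A (1F +F -F (m t *F m t))
          ≡⟨ cong A (linF₁ (-F (1F +F (1F +F t) *F u)) (i-r 1+t≢0) (solveF 2 (λ t u →
               𝟙 ⊕ ⊝ ((𝟙 ⊕ ⊝ t) ⊗ u ⊗ ((𝟙 ⊕ ⊝ t) ⊗ u)) ⊕ ⊝ (((𝟙 ⊕ 𝟙) ⊕ (𝟙 ⊕ 𝟙)) ⊗ (t ⊗ (u ⊗ u)))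
               ⊜ ⊝ (𝟙 ⊕ (𝟙 ⊕ t) ⊗ u) ⊗ ((𝟙 ⊕ t) ⊗ u ⊕ ⊝ 𝟙)) refl t u)) ⟩
        A (4F *F (t *F (u *F u)))
          ≡⟨ trans (χ-mul hA _ _) (cong (A 4F *_) (trans (χ-mul hA _ _) (cong (A t *_) (χ-mul hA _ _)))) ⟩
        A 4F * (A t * (A · A) u)  ∎
        where
        u : F
        u = i (1F +F t)
      h : F
      h = i 2F
      i-1+m : ∀ t → ¬ (1F +F t ≡ 0F) → (1F +F m t) *F ((1F +F t) *F h) ≡ 1F
      i-1+m t 1+t≢0 = linF₂ ((1F +F -F t) *F h) 1F (i-r 1+t≢0) (i-r 2≢0) (solveF 3 (λ t u h →
        (𝟙 ⊕ (𝟙 ⊕ ⊝ t) ⊗ u) ⊗ ((𝟙 ⊕ t) ⊗ h) ⊕ ⊝ 𝟙 ⊜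
        ((𝟙 ⊕ ⊝ t) ⊗ h) ⊗ ((𝟙 ⊕ t) ⊗ u ⊕ ⊝ 𝟙) ⊕ 𝟙 ⊗ ((𝟙 ⊕ 𝟙) ⊗ h ⊕ ⊝ 𝟙)) refl t (i (1F +F t)) h)
      m-involutive : ∀ t → ¬ (1F +F t ≡ 0F) → m (m t) ≡ t
      m-involutive t 1+t≢0 = trans (cong ((1F +F -F m t) *F_) (i-unique (i-1+m t 1+t≢0)))
        (linF₂ (-F ((1F +F -F t) *F h)) t (i-r 1+t≢0) (i-r 2≢0) (solveF 3 (λ t u h →
          (𝟙 ⊕ ⊝ ((𝟙 ⊕ ⊝ t) ⊗ u)) ⊗ ((𝟙 ⊕ t) ⊗ h) ⊕ ⊝ t ⊜
          ⊝ ((𝟙 ⊕ ⊝ t) ⊗ h) ⊗ ((𝟙 ⊕ t) ⊗ u ⊕ ⊝ 𝟙) ⊕ t ⊗ ((𝟙 ⊕ 𝟙) ⊗ h ⊕ ⊝ 𝟙)) refl t (i (1F +F t)) h))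
      to : ∀ t → f t ≡ 0# ⊎ (m (m t) ≡ t × A (1F +F -F (m t *F m t)) ≡ f t)
      to t with (1F +F t) ≟ 0F
      ... | yes e = inj₁ (trans (cong (A 4F *_) (trans (cong (A t *_) (trans (cong (A · A) (i-≡0 e)) (χ-0 (·-isCharacter hA hA)))) (zeroʳ _))) (zeroʳ _))
      ... | no ne = inj₂ (m-involutive t ne , value t ne)
      from : ∀ s → A (1F +F -F (s *F s)) ≡ 0# ⊎ (m (m s) ≡ s × f (m s) ≡ A (1F +F -F (s *F s)))
      from s with (1F +F s) ≟ 0F
      ... | yes e = inj₁ (trans (cong A (linF₁ (1F +F -F s) e (solveF 1 (λ s → 𝟙 ⊕ ⊝ (s ⊗ s) ⊕ ⊝ 𝟘 ⊜ (𝟙 ⊕ ⊝ s) ⊗ ((𝟙 ⊕ s) ⊕ ⊝ 𝟘)) refl s))) (χ-0 hA))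
      ... | no ne = inj₂ (m-involutive s ne , trans (sym (value (m s) (FP.unit-≢0 (i-1+m s ne))))
                      (cong (λ x → A (1F +F -F (x *F x))) (m-involutive s ne)))
      unfold : ∀ t → ¬ (1F +F t ≡ 0F) → φ t * (A · φ) (i (1F +F t)) ≡ φ (t *F i (1F +F t)) * A (1F +F -F (t *F i (1F +F t)))
      unfold t ne = trans (trans (cong (φ t *_) (*-comm _ _)) (sym (*-assoc _ _ _)))
        (cong₂ _*_ (sym (φ-mul _ _)) (cong A (sym (1-fraction ne))))

  -- Greene's series as sums over F

  χ-at-0 : ∀ {χ} → IsCharacter χ → ∀ {x} → x ≡ 0F → χ x ≡ 0#
  χ-at-0 h refl = χ-0 h

  χ-at-i0 : ∀ {χ} → IsCharacter χ → ∀ {x} → x ≡ 0F → χ (i x) ≡ 0#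
  χ-at-i0 h e = χ-at-0 h (i-≡0 e)

  binom-sum : ∀ {A B} → IsCharacter A → IsCharacter B →
              binom A B ≡ (B (-F 1F) / qK) * Σ (λ a → A a * (B (1F +F a) * A (i (1F +F a))))
  binom-sum {A} {B} hA hB = cong ((B (-F 1F) / qK) *_) (fraction
    (trans (cong (A 1F *_) (trans (conj-i hB _) (χ-at-i0 hB (FP.-‿inverseʳ 1F)))) (zeroʳ _))
    (trans (cong (λ b → A (-F 1F) * (b * A (i (1F +F -F 1F)))) (χ-at-0 hB (FP.-‿inverseʳ 1F)))
      (solve 2 (λ a b → a :* (:0 :* b) := :0) refl _ _))
    λ a ne → sym (begin
      A (a *F i (1F +F a)) * conj B (1F +F -F (a *F i (1F +F a)))
        ≡⟨ cong₂ _*_ (χ-mul hA _ _) (trans (conj-i hB _) (cong B (trans (cong i (1-fraction ne)) (i-involutive _)))) ⟩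
      A a * A (i (1F +F a)) * B (1F +F a)
        ≡⟨ solve 3 (λ a b c → a :* b :* c := a :* (c :* b)) refl _ _ _ ⟩
      A a * (B (1F +F a) * A (i (1F +F a)))  ∎))

  -- In the variable a the values of χ at 1 + a and at its inverse cancel, so χ survives only at a
  -- and -1. At a = -1, where the cancellation fails, the factor A(i(1 + a)) is 0 anyway.
  binom-χ : ∀ {A χ} → IsCharacter A → IsCharacter χ →
            binom (A · χ) χ ≡ (χ (-F 1F) / qK) * Σ (λ a → χ a * (A a * A (i (1F +F a))))
  binom-χ {A} {χ} hA hχ = trans (binom-sum (·-isCharacter hA hχ) hχ)
    (cong ((χ (-F 1F) / qK) *_) (Σ-cong λ a → cases a ((1F +F a) ≟ 0F)))
    where
    cases : ∀ a → Dec (1F +F a ≡ 0F) → A a * χ a * (χ (1F +F a) * (A (i (1F +F a)) * χ (i (1F +F a)))) ≡ χ a * (A a * A (i (1F +F a)))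
    cases a (yes e) = trans (cong (λ u → A a * χ a * (χ (1F +F a) * (u * χ (i (1F +F a))))) (χ-at-i0 hA e))
      (trans (solve 5 (λ a b c d e → a :* b :* (c :* (:0 :* d)) := b :* (a :* :0)) refl (A a) (χ a) _ _ 1#)
        (cong (λ u → χ a * (A a * u)) (sym (χ-at-i0 hA e))))
    cases a (no ne) = lin₁ (A a * χ a * A (i (1F +F a))) (χ-i hχ ne)
      (solve 5 (λ a x u v w → a :* x :* (u :* (w :* v)) :+ :- (x :* (a :* w)) := a :* x :* w :* (u :* v :+ :- :1)) refl _ _ _ _ _)

  binom-·χ : ∀ {A B χ} → IsCharacter A → IsCharacter B → IsCharacter χ →
             binom (A · χ) (B · χ) ≡ ((B (-F 1F) * χ (-F 1F)) / qK) * Σ (λ a → χ a * (A a * (B (1F +F a) * A (i (1F +F a)))))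
  binom-·χ {A} {B} {χ} hA hB hχ = trans (binom-sum (·-isCharacter hA hχ) (·-isCharacter hB hχ))
    (cong (((B (-F 1F) * χ (-F 1F)) / qK) *_) (Σ-cong λ a → cases a ((1F +F a) ≟ 0F)))
    where
    cases : ∀ a → Dec (1F +F a ≡ 0F) →
            A a * χ a * (B (1F +F a) * χ (1F +F a) * (A (i (1F +F a)) * χ (i (1F +F a))))
            ≡ χ a * (A a * (B (1F +F a) * A (i (1F +F a))))
    cases a (yes e) = trans (cong (λ u → A a * χ a * (B (1F +F a) * χ (1F +F a) * (u * χ (i (1F +F a))))) (χ-at-i0 hA e))
      (trans (solve 5 (λ a b c d e → a :* b :* (e :* c :* (:0 :* d)) := b :* (a :* (e :* :0))) refl (A a) (χ a) _ _ (B (1F +F a)))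
        (cong (λ u → χ a * (A a * (B (1F +F a) * u))) (sym (χ-at-i0 hA e))))
    cases a (no ne) = lin₁ (A a * χ a * A (i (1F +F a)) * B (1F +F a)) (χ-i hχ ne)
      (solve 6 (λ a x u v w b → a :* x :* (b :* u :* (w :* v)) :+ :- (x :* (a :* (b :* w))) := a :* x :* w :* b :* (u :* v :+ :- :1)) refl _ _ _ _ _ _)

  -- At s = 0 no a satisfies as = 1, whereas i s = 0. The assumption u(0) = 0 reconciles the two.
  Σ-δ-* : ∀ (u : F → K) → u 0F ≡ 0# → ∀ s → Σ (λ a → u a * δ (a *F s) 1F) ≡ u (i s)
  Σ-δ-* u u-0 s = cases (s ≟ 0F)
    where
    cases : Dec (s ≡ 0F) → Σ (λ a → u a * δ (a *F s) 1F) ≡ u (i s)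
    cases (yes refl) = trans (Σ-cong (λ a → trans (cong (u a *_) (δ-≢ (λ e → 1≢0 (trans (sym e) (FP.zeroʳ a))))) (zeroʳ _)))
      (trans (Σ-0) (sym (trans (cong u i-0) u-0)))
    cases (no s≢0) = trans (Σ-cong (λ a → trans (*-comm _ _) (cong (_* u a) (δ-⇔ to from)))) (Σ-δ u (i s))
      where
      to : ∀ {a} → a *F s ≡ 1F → a ≡ i s
      to e = sym (i-unique (trans (FP.*-comm _ _) e))
      from : ∀ {a} → a ≡ i s → a *F s ≡ 1F
      from refl = trans (FP.*-comm _ _) (i-r s≢0)

  -- The Mellin transform of u; each binomial coefficient is one of these up to a constant and a
  -- sign.
  Ψ : Char → (F → K) → K
  Ψ χ u = Σ (λ a → χ a * u a)

  Ψ-Ψ : ∀ {χ} → IsCharacter χ → ∀ u v → Ψ χ u * Ψ χ v ≡ Σ (λ a → Σ (λ b → u a * v b * χ (a *F b)))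
  Ψ-Ψ {χ} h u v = trans (Σ-*-Σ (λ a → χ a * u a) (λ b → χ b * v b)) (Σ-cong λ a → Σ-cong λ b →
    trans (solve 4 (λ a b c d → (a :* b) :* (c :* d) := b :* d :* (a :* c)) refl _ _ _ _)
      (cong (u a * v b *_) (sym (χ-mul h a b))))

  -- Mellin inversion: expanding the transforms leaves χ(abs), and summing over χ forces abs = 1,
  -- that is a = 1 / (bs).
  convolution₂ : ∀ u v → u 0F ≡ 0# → ∀ s →
    ∑ (upTo N) (λ k → Ψ χ[ k ] u * Ψ χ[ k ] v * χ[ k ] s) ≡ Σ (λ b → v b * u (i (b *F s))) * N ×1
  convolution₂ u v u-0 s = begin
    ∑ (upTo N) (λ k → Ψ χ[ k ] u * Ψ χ[ k ] v * χ[ k ] s)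
      ≡⟨ ∑-cong (upTo N) (λ k → expand k) ⟩
    ∑ (upTo N) (λ k → Σ (λ b → Σ (λ a → v b * (u a * χ[ k ] (a *F (b *F s))))))
      ≡⟨ ∑-swap (upTo N) elems _ ⟩
    Σ (λ b → ∑ (upTo N) (λ k → Σ (λ a → v b * (u a * χ[ k ] (a *F (b *F s))))))
      ≡⟨ Σ-cong (λ b → trans (∑-swap (upTo N) elems _) (trans (Σ-cong (λ a → collapse a b)) (finish b))) ⟩
    Σ (λ b → v b * u (i (b *F s)) * N ×1)
      ≡⟨ Σ-*ʳ (N ×1) ⟩
    Σ (λ b → v b * u (i (b *F s))) * N ×1  ∎
    where
    expand : ∀ k → Ψ χ[ k ] u * Ψ χ[ k ] v * χ[ k ] s ≡ Σ (λ b → Σ (λ a → v b * (u a * χ[ k ] (a *F (b *F s)))))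
    expand k = begin
      Ψ χ[ k ] u * Ψ χ[ k ] v * χ[ k ] s
        ≡⟨ cong (_* χ[ k ] s) (trans (Ψ-Ψ (χ[k]-isCharacter k) u v) (Σ-swap)) ⟩
      Σ (λ b → Σ (λ a → u a * v b * χ[ k ] (a *F b))) * χ[ k ] s
        ≡⟨ sym (trans (Σ-cong (λ b → Σ-*ʳ (χ[ k ] s))) (Σ-*ʳ (χ[ k ] s))) ⟩
      Σ (λ b → Σ (λ a → u a * v b * χ[ k ] (a *F b) * χ[ k ] s))
        ≡⟨ Σ-cong (λ b → Σ-cong λ a → trans (solve 4 (λ u v x y → u :* v :* x :* y := v :* (u :* (x :* y))) refl _ _ _ _)
             (cong (λ x → v b * (u a * x)) (trans (sym (χ-mul (χ[k]-isCharacter k) _ _)) (cong χ[ k ] (FP.*-assoc a b s))))) ⟩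
      Σ (λ b → Σ (λ a → v b * (u a * χ[ k ] (a *F (b *F s)))))  ∎
    collapse : ∀ a b → ∑ (upTo N) (λ k → v b * (u a * χ[ k ] (a *F (b *F s)))) ≡ v b * N ×1 * (u a * δ (a *F (b *F s)) 1F)
    collapse a b = trans (∑-*ˡ (upTo N) (v b) _) (trans (cong (v b *_) (trans (∑-*ˡ (upTo N) (u a) _) (cong (u a *_) (orthogonality _))))
      (solve 4 (λ v u d n → v :* (u :* (d :* n)) := v :* n :* (u :* d)) refl _ _ _ _))
    finish : ∀ b → Σ (λ a → v b * N ×1 * (u a * δ (a *F (b *F s)) 1F)) ≡ v b * u (i (b *F s)) * N ×1
    finish b = trans (Σ-*ˡ (v b * N ×1)) (trans (cong (v b * N ×1 *_) (Σ-δ-* u u-0 (b *F s)))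
      (solve 3 (λ v n u → v :* n :* u := v :* u :* n) refl _ _ _))

  -- Only the transform of v is expanded; its χ(a) is absorbed into χ(as), and `convolution₂`
  -- applies with as in place of s.
  convolution₃ : ∀ u v w → u 0F ≡ 0# → ∀ s →
    ∑ (upTo N) (λ k → Ψ χ[ k ] v * Ψ χ[ k ] w * Ψ χ[ k ] u * χ[ k ] s)
    ≡ Σ (λ a → Σ (λ b → v a * (w b * u (i (b *F (a *F s)))))) * N ×1
  convolution₃ u v w u-0 s = begin
    ∑ (upTo N) (λ k → Ψ χ[ k ] v * Ψ χ[ k ] w * Ψ χ[ k ] u * χ[ k ] s)
      ≡⟨ ∑-cong (upTo N) expand ⟩
    ∑ (upTo N) (λ k → Σ (λ a → v a * (Ψ χ[ k ] u * Ψ χ[ k ] w * χ[ k ] (a *F s))))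
      ≡⟨ ∑-swap (upTo N) elems _ ⟩
    Σ (λ a → ∑ (upTo N) (λ k → v a * (Ψ χ[ k ] u * Ψ χ[ k ] w * χ[ k ] (a *F s))))
      ≡⟨ Σ-cong (λ a → trans (∑-*ˡ (upTo N) (v a) _) (trans (cong (v a *_) (convolution₂ u w u-0 (a *F s))) (sym (*-assoc _ _ _)))) ⟩
    Σ (λ a → v a * Σ (λ b → w b * u (i (b *F (a *F s)))) * N ×1)
      ≡⟨ trans (Σ-*ʳ (N ×1)) (cong (_* N ×1) (Σ-cong (λ a → sym (Σ-*ˡ (v a))))) ⟩
    Σ (λ a → Σ (λ b → v a * (w b * u (i (b *F (a *F s)))))) * N ×1  ∎
    where
    expand : ∀ k → Ψ χ[ k ] v * Ψ χ[ k ] w * Ψ χ[ k ] u * χ[ k ] s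
             ≡ Σ (λ a → v a * (Ψ χ[ k ] u * Ψ χ[ k ] w * χ[ k ] (a *F s)))
    expand k = trans
      (trans (solve 4 (λ v w u x → v :* w :* u :* x := v :* (u :* w :* x)) refl _ _ _ _) (sym (Σ-*ʳ _)))
      (Σ-cong λ a → trans (solve 5 (λ x v u w s → x :* v :* (u :* w :* s) := v :* (u :* w :* (x :* s))) refl _ _ _ _ _)
        (cong (λ x → v a * (Ψ χ[ k ] u * Ψ χ[ k ] w * x)) (sym (χ-mul (χ[k]-isCharacter k) a s))))

  -- In the variable v = b / (1 + b) this is Euler's integral for the parameters A, B; φ at 1 - z.
  P : Char → Char → F → K
  P A B z = Σ (λ b → B b * ((A · φ) (1F +F b) * A (i (1F +F z *F b))))

  cancel-inverse : ∀ {A B} → IsCharacter A → IsCharacter B → ∀ x → A x * B x * B (i x) ≡ A x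
  cancel-inverse {A} {B} hA hB x = cases (x ≟ 0F)
    where
    cases : Dec (x ≡ 0F) → A x * B x * B (i x) ≡ A x
    cases (yes e) = trans (cong (λ a → a * B x * B (i x)) (χ-at-0 hA e))
      (trans (solve 2 (λ a b → :0 :* a :* b := :0) refl _ _) (sym (χ-at-0 hA e)))
    cases (no ne) = trans (*-assoc _ _ _) (trans (cong (A x *_) (χ-i hB ne)) (*-identityʳ _))

  -- The two factors χ(-1) of the binomials multiply to 1. Inversion puts a = 1 / (bz), where A(a)
  -- A(1 / (1 + a)) collapses to A(1 / (1 + zb)); this uses z ≠ 0.
  ₂F₁-sum : ∀ {A B} → IsCharacter A → IsCharacter B → ∀ {z} → ¬ (z ≡ 0F) →
            ₂F₁ A B (A · B · φ) z ≡ ((A · B · φ) (-F 1F) / qK) * P A B z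
  ₂F₁-sum {A} {B} hA hB {z} z≢0 = begin
    ₂F₁ A B (A · B · φ) z
      ≡⟨ cong ((qK / (N ×1)) *_) (trans (∑-map χ[_] (upTo N) _) (∑-cong (upTo N) term)) ⟩
    (qK / (N ×1)) * ∑ (upTo N) (λ k → c * inv qK * inv qK * (Ψ χ[ k ] u * Ψ χ[ k ] v * χ[ k ] z))
      ≡⟨ cong ((qK / (N ×1)) *_) (trans (∑-*ˡ (upTo N) (c * inv qK * inv qK) _)
           (cong (c * inv qK * inv qK *_) (convolution₂ u v u-0 z))) ⟩
    (qK / (N ×1)) * (c * inv qK * inv qK * (Σ (λ b → v b * u (i (b *F z))) * N ×1))
      ≡⟨ lin₂ (c * inv qK * Σ (λ b → v b * u (i (b *F z))) * (N ×1 * inv (N ×1))) (c * inv qK * Σ (λ b → v b * u (i (b *F z))))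
           (inv-r qK qK≢0) (inv-r (N ×1) N≢0)
           (solve 6 (λ q q′ n n′ c s → q :* n′ :* (c :* q′ :* q′ :* (s :* n)) :+ :- (c :* q′ :* s) :=
             c :* q′ :* s :* (n :* n′) :* (q :* q′ :+ :- :1) :+ c :* q′ :* s :* (n :* n′ :+ :- :1)) refl _ _ _ _ _ _) ⟩
    (c / qK) * Σ (λ b → v b * u (i (b *F z)))
      ≡⟨ cong ((c / qK) *_) (Σ-cong λ b → summand b (b ≟ 0F)) ⟩
    (c / qK) * P A B z  ∎
    where
    c : K
    c = (A · B · φ) (-F 1F)
    u v : F → K
    u a = A a * A (i (1F +F a))
    v b = B b * ((A · B · φ) (1F +F b) * B (i (1F +F b)))
    u-0 : u 0F ≡ 0#
    u-0 = trans (cong (_* A (i (1F +F 0F))) (χ-0 hA)) (zeroˡ _)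
    hC : IsCharacter (A · B · φ)
    hC = ·-isCharacter (·-isCharacter hA hB) φ-isCharacter
    term : ∀ k → binom (A · χ[ k ]) χ[ k ] * binom (B · χ[ k ]) (A · B · φ · χ[ k ]) * χ[ k ] z
           ≡ c * inv qK * inv qK * (Ψ χ[ k ] u * Ψ χ[ k ] v * χ[ k ] z)
    term k = trans (cong₂ (λ s t → s * t * χ[ k ] z) (binom-χ hA hχ) (binom-·χ hB hC hχ))
      (lin₁ (c * inv qK * inv qK * (Ψ χ[ k ] u * Ψ χ[ k ] v * χ[ k ] z)) (χ-neg² hχ)
        (solve 6 (λ e q c s t z → e :* q :* s :* (c :* e :* q :* t) :* z :+ :- (c :* q :* q :* (s :* t :* z)) :=
          c :* q :* q :* (s :* t :* z) :* (e :* e :+ :- :1)) refl _ _ _ _ _ _))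
      where
      hχ : IsCharacter χ[ k ]
      hχ = χ[k]-isCharacter k
    summand : ∀ b → Dec (b ≡ 0F) → v b * u (i (b *F z)) ≡ B b * ((A · φ) (1F +F b) * A (i (1F +F z *F b)))
    summand b (yes refl) = trans (cong (λ s → s * ((A · B · φ) (1F +F 0F) * B (i (1F +F 0F))) * u (i (0F *F z))) (χ-0 hB))
      (trans (solve 3 (λ a b c → :0 :* a :* b := :0 :* c) refl _ _ ((A · φ) (1F +F 0F) * A (i (1F +F z *F 0F))))
        (cong (_* ((A · φ) (1F +F 0F) * A (i (1F +F z *F 0F)))) (sym (χ-0 hB))))
    summand b (no b≢0) = begin
      B b * ((A · B · φ) (1F +F b) * B (i (1F +F b))) * u (i (b *F z))
        ≡⟨ cong₂ (λ s t → B b * s * t)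
             (trans (solve 4 (λ a b f u → a :* b :* f :* u := a :* f :* b :* u) refl _ _ _ _)
               (cancel-inverse (·-isCharacter hA φ-isCharacter) hB (1F +F b)))
             (trans (sym (χ-mul hA _ _)) (cong A (trans (sym (i-* _ _)) (cong i simplify)))) ⟩
      B b * (A (1F +F b) * φ (1F +F b)) * A (i (1F +F z *F b))
        ≡⟨ *-assoc _ _ _ ⟩
      B b * ((A · φ) (1F +F b) * A (i (1F +F z *F b)))  ∎
      where
      simplify : b *F z *F (1F +F i (b *F z)) ≡ 1F +F z *F b
      simplify = linF₁ 1F (i-r (FP.*-≢0 b≢0 z≢0)) (solveF 3 (λ b z t → b ⊗ z ⊗ (𝟙 ⊕ t) ⊕ ⊝ (𝟙 ⊕ z ⊗ b) ⊜
        𝟙 ⊗ (b ⊗ z ⊗ t ⊕ ⊝ 𝟙)) refl b z (i (b *F z)))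

  -- Three binomials leave a single factor χ(-1), which turns χ(z) into χ(-z). Hence the third
  -- variable is fixed by inversion as 1 / (b a (-z)).
  S : Char → Char → F → K
  S A B z = Σ (λ a → Σ (λ b → (A · A) a * (A · A) (i (1F +F a)) * ((B · B) b * (A · A) (1F +F b) *
    ((A · B) (i (b *F (a *F -F z))) * φ (1F +F i (b *F (a *F -F z)))))))

  ₃F₂-sum : ∀ {A B} → IsCharacter A → IsCharacter B → ∀ z →
            ₃F₂ (A · A) (B · B) (A · B) ((A · A) · (B · B)) (A · B · φ) z
            ≡ ((A · B · φ) (-F 1F) / (qK * qK)) * S A B z
  ₃F₂-sum {A} {B} hA hB z = begin
    ₃F₂ (A · A) (B · B) (A · B) ((A · A) · (B · B)) (A · B · φ) z
      ≡⟨ cong ((qK / (N ×1)) *_) (trans (∑-map χ[_] (upTo N) _) (∑-cong (upTo N) term)) ⟩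
    (qK / (N ×1)) * ∑ (upTo N) (λ k → c * q⁻¹ * q⁻¹ * q⁻¹ * (Ψ χ[ k ] v * Ψ χ[ k ] w * Ψ χ[ k ] u * χ[ k ] (-F z)))
      ≡⟨ cong ((qK / (N ×1)) *_) (trans (∑-*ˡ (upTo N) (c * q⁻¹ * q⁻¹ * q⁻¹) _)
           (cong (c * q⁻¹ * q⁻¹ * q⁻¹ *_) (convolution₃ u v w u-0 (-F z)))) ⟩
    (qK / (N ×1)) * (c * q⁻¹ * q⁻¹ * q⁻¹ * (T * N ×1))
      ≡⟨ lin₂ (c * q⁻¹ * q⁻¹ * T * (N ×1 * inv (N ×1))) (c * q⁻¹ * q⁻¹ * T)
           (inv-r qK qK≢0) (inv-r (N ×1) N≢0)
           (solve 6 (λ q q′ n n′ c s → q :* n′ :* (c :* q′ :* q′ :* q′ :* (s :* n)) :+ :- (c :* (q′ :* q′) :* s) :=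
             c :* q′ :* q′ :* s :* (n :* n′) :* (q :* q′ :+ :- :1) :+ c :* q′ :* q′ :* s :* (n :* n′ :+ :- :1)) refl _ _ _ _ _ _) ⟩
    c * (q⁻¹ * q⁻¹) * T
      ≡⟨ cong₂ (λ s t → c * s * t) (sym inv-q²) (Σ-cong λ a → Σ-cong λ b → cong₂ (λ s t → v a * (s * t)) (w-simplify b) (u-simplify _)) ⟩
    (c / (qK * qK)) * S A B z  ∎
    where
    c q⁻¹ : K
    c = (A · B · φ) (-F 1F)
    q⁻¹ = inv qK
    inv-q² : inv (qK * qK) ≡ q⁻¹ * q⁻¹
    inv-q² = KF.*-cancelˡ-≢0 (KF.*-≢0 qK≢0 qK≢0) (trans (inv-r _ (KF.*-≢0 qK≢0 qK≢0))
      (lin₁ (- (1# + qK * q⁻¹)) (inv-r qK qK≢0)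
        (solve 2 (λ q u → :1 :+ :- (q :* q :* (u :* u)) := (:- (:1 :+ q :* u)) :* (q :* u :+ :- :1)) refl _ _)))
    hA² : IsCharacter (A · A)
    hA² = ·-isCharacter hA hA
    hB² : IsCharacter (B · B)
    hB² = ·-isCharacter hB hB
    hC : IsCharacter (A · B)
    hC = ·-isCharacter hA hB
    u v w : F → K
    v a = (A · A) a * (A · A) (i (1F +F a))
    w b = (B · B) b * (((A · A) · (B · B)) (1F +F b) * (B · B) (i (1F +F b)))
    u c = (A · B) c * ((A · B · φ) (1F +F c) * (A · B) (i (1F +F c)))
    T : K
    T = Σ (λ a → Σ (λ b → v a * (w b * u (i (b *F (a *F -F z))))))
    u-0 : u 0F ≡ 0#
    u-0 = trans (cong (_* ((A · B · φ) (1F +F 0F) * (A · B) (i (1F +F 0F)))) (χ-0 hC)) (zeroˡ _)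
    w-simplify : ∀ b → w b ≡ (B · B) b * (A · A) (1F +F b)
    w-simplify b = cong ((B · B) b *_) (cancel-inverse hA² hB² (1F +F b))
    u-simplify : ∀ c → u c ≡ (A · B) c * φ (1F +F c)
    u-simplify c = cong ((A · B) c *_) (trans (cong (_* (A · B) (i (1F +F c))) (*-comm ((A · B) (1F +F c)) (φ (1F +F c))))
      (cancel-inverse φ-isCharacter hC (1F +F c)))
    term : ∀ k → binom ((A · A) · χ[ k ]) χ[ k ] * binom ((B · B) · χ[ k ]) ((A · A) · (B · B) · χ[ k ])
                 * binom ((A · B) · χ[ k ]) (A · B · φ · χ[ k ]) * χ[ k ] z
           ≡ c * q⁻¹ * q⁻¹ * q⁻¹ * (Ψ χ[ k ] v * Ψ χ[ k ] w * Ψ χ[ k ] u * χ[ k ] (-F z))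
    term k = begin
      binom ((A · A) · χ[ k ]) χ[ k ] * binom ((B · B) · χ[ k ]) ((A · A) · (B · B) · χ[ k ])
        * binom ((A · B) · χ[ k ]) (A · B · φ · χ[ k ]) * χ[ k ] z
        ≡⟨ cong₂ (λ r s → r * s * χ[ k ] z)
             (cong₂ _*_ (binom-χ hA² hχ) (binom-·χ hB² (·-isCharacter hA² hB²) hχ))
             (binom-·χ hC (·-isCharacter hC φ-isCharacter) hχ) ⟩
      e * q⁻¹ * Ψ χ[ k ] v * (a₁ * a₁ * (b₁ * b₁) * e * q⁻¹ * Ψ χ[ k ] w) * (c * e * q⁻¹ * Ψ χ[ k ] u) * χ[ k ] z
        ≡⟨ solve 9 (λ a b e q c v w u z → e :* q :* v :* (a :* a :* (b :* b) :* e :* q :* w) :* (c :* e :* q :* u) :* z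
             := (a :* a) :* (b :* b) :* (e :* e) :* (c :* q :* q :* q :* (v :* w :* u :* (e :* z)))) refl a₁ b₁ e q⁻¹ c (Ψ χ[ k ] v) (Ψ χ[ k ] w) (Ψ χ[ k ] u) (χ[ k ] z) ⟩
      (a₁ * a₁) * (b₁ * b₁) * (e * e) * (c * q⁻¹ * q⁻¹ * q⁻¹ * (Ψ χ[ k ] v * Ψ χ[ k ] w * Ψ χ[ k ] u * (e * χ[ k ] z)))
        ≡⟨ cong₂ (λ r s → r * (c * q⁻¹ * q⁻¹ * q⁻¹ * (Ψ χ[ k ] v * Ψ χ[ k ] w * Ψ χ[ k ] u * s)))
             (cong₂ _*_ (cong₂ _*_ (χ-neg² hA) (χ-neg² hB)) (χ-neg² hχ))
             (trans (sym (χ-mul hχ _ _)) (cong χ[ k ] (solveF 1 (λ z → (⊝ 𝟙) ⊗ z ⊜ ⊝ z) refl z))) ⟩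
      1# * 1# * 1# * (c * q⁻¹ * q⁻¹ * q⁻¹ * (Ψ χ[ k ] v * Ψ χ[ k ] w * Ψ χ[ k ] u * χ[ k ] (-F z)))
        ≡⟨ solve 1 (λ x → :1 :* :1 :* :1 :* x := x) refl _ ⟩
      c * q⁻¹ * q⁻¹ * q⁻¹ * (Ψ χ[ k ] v * Ψ χ[ k ] w * Ψ χ[ k ] u * χ[ k ] (-F z))  ∎
      where
      hχ : IsCharacter χ[ k ]
      hχ = χ[k]-isCharacter k
      a₁ b₁ e : K
      a₁ = A (-F 1F)
      b₁ = B (-F 1F)
      e = χ[ k ] (-F 1F)

  ratio : Char → Char → F → K
  ratio A B ρ = A ρ * B (i ρ)

  -- For ρ ≠ 0 the argument of φ is (1 + γz)² + γ(ρ - 1)²/ρ at γ = -κ/z, a scaling that turns 1 + γz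
  -- into 1 - κ.
  kernel : Char → Char → F → F → F → K
  kernel A B z κ ρ = ratio A B ρ *
    φ ((κ +F -F 1F) *F (κ +F -F 1F) +F -F (κ *F ((ρ +F -F 1F) *F (ρ +F -F 1F)) *F i (z *F ρ)))

  -- The common form to which the product of the two P and the double sum `S` are both reduced. The
  -- factor in front is what AB(γ) leaves when γ = -κ/z.
  U : Char → Char → F → K
  U A B z = (A · B) (-F i z) * Σ (λ κ → (A · B) κ * Σ (kernel A B z κ))

  -- Exchanging A and B

  private
    -- P in the variables v = b/(1+b) and n = -v.
    Pᵛ : Char → Char → F → K
    Pᵛ A B y = Σ (λ v → B v * ((B · φ) (i (1F +F -F v)) * A (i (1F +F -F (y *F v)))))

    Pⁿ : Char → Char → F → K
    Pⁿ A B y = Σ (λ n → A n * (B (i (1F +F y *F n)) * (A · φ) (i (1F +F n))))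

    Pᵛ≡P : ∀ {A B} → IsCharacter A → IsCharacter B → ∀ z → Pᵛ A B (1F +F -F z) ≡ P A B z
    Pᵛ≡P {A} {B} hA hB z = fraction
      (trans (cong (λ u → B 1F * (u * A (i (1F +F -F ((1F +F -F z) *F 1F))))) (χ-at-i0 hBφ (FP.-‿inverseʳ 1F)))
        (solve 2 (λ a b → a :* (:0 :* b) := :0) refl _ _))
      (trans (cong (λ u → B (-F 1F) * (u * A (i (1F +F z *F -F 1F)))) (χ-at-0 hAφ (FP.-‿inverseʳ 1F)))
        (solve 2 (λ a b → a :* (:0 :* b) := :0) refl _ _))
      λ b ne → sym (begin
        B (b *F i (1F +F b)) * ((B · φ) (i (1F +F -F (b *F i (1F +F b)))) * A (i (1F +F -F ((1F +F -F z) *F (b *F i (1F +F b))))))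
          ≡⟨ cong₂ (λ s t → s * t) (χ-mul hB _ _) (cong₂ (λ s t → (B · φ) s * A t)
               (trans (cong i (1-fraction ne)) (i-involutive _))
               (trans (cong i (linF₁ (-F 1F) (i-r ne) (solveF 3 (λ b z u →
                  𝟙 ⊕ ⊝ ((𝟙 ⊕ ⊝ z) ⊗ (b ⊗ u)) ⊕ ⊝ ((𝟙 ⊕ z ⊗ b) ⊗ u) ⊜ ⊝ 𝟙 ⊗ ((𝟙 ⊕ b) ⊗ u ⊕ ⊝ 𝟙)) refl b z (i (1F +F b)))))
                 (trans (i-* _ _) (cong (i (1F +F z *F b) *F_) (i-involutive _))))) ⟩
        B b * B (i (1F +F b)) * ((B · φ) (1F +F b) * A (i (1F +F z *F b) *F (1F +F b)))
          ≡⟨ cong (λ t → B b * B (i (1F +F b)) * ((B · φ) (1F +F b) * t)) (χ-mul hA _ _) ⟩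
        B b * B (i (1F +F b)) * ((B · φ) (1F +F b) * (A (i (1F +F z *F b)) * A (1F +F b)))
          ≡⟨ lin₁ (B b * A (1F +F b) * φ (1F +F b) * A (i (1F +F z *F b))) (χ-i hB ne)
               (solve 6 (λ b u v f w a → b :* u :* (v :* f :* (w :* a)) :+ :- (b :* (a :* f :* w)) :=
                 b :* a :* f :* w :* (v :* u :+ :- :1)) refl _ _ _ _ _ _) ⟩
        B b * ((A · φ) (1F +F b) * A (i (1F +F z *F b)))  ∎)
      where
      hAφ : IsCharacter (A · φ)
      hAφ = ·-isCharacter hA φ-isCharacter
      hBφ : IsCharacter (B · φ)
      hBφ = ·-isCharacter hB φ-isCharacter

    Pᵛ≡Pⁿ : ∀ {A B} → IsCharacter A → ∀ y → Pᵛ B A y ≡ A (-F 1F) * Pⁿ A B y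
    Pᵛ≡Pⁿ {A} {B} hA y = begin
      Pᵛ B A y
        ≡⟨ sym (reindex-↔ _ -F_ -F_ FP.-‿involutive FP.-‿involutive) ⟩
      Σ (λ n → A (-F n) * ((A · φ) (i (1F +F -F (-F n))) * B (i (1F +F -F (y *F -F n)))))
        ≡⟨ Σ-cong (λ n → trans (cong₂ _*_ (trans (cong A (solveF 1 (λ n → ⊝ n ⊜ ⊝ 𝟙 ⊗ n) refl n)) (χ-mul hA _ _))
             (cong₂ (λ s t → (A · φ) (i s) * B (i t)) (solveF 1 (λ n → 𝟙 ⊕ ⊝ (⊝ n) ⊜ 𝟙 ⊕ n) refl n)
               (solveF 2 (λ y n → 𝟙 ⊕ ⊝ (y ⊗ ⊝ n) ⊜ 𝟙 ⊕ y ⊗ n) refl y n)))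
             (solve 4 (λ e a c b → e :* a :* (c :* b) := e :* (a :* (b :* c))) refl _ _ _ _)) ⟩
      Σ (λ n → A (-F 1F) * (A n * (B (i (1F +F y *F n)) * (A · φ) (i (1F +F n)))))
        ≡⟨ Σ-*ˡ (A (-F 1F)) ⟩
      A (-F 1F) * Pⁿ A B y  ∎

    -- The Gauss sums of Bφ and A absorb the two inverse factors and open them into exponential sums
    -- over m and n. Then v occurs only in B and in an exponential, so its sum is a Gauss sum of B.
    -- Scaling n by m makes the sum over m a Gauss sum of Aφ, and a sum over n is left.
    gauss-Pᵛ-Pⁿ : ∀ {A B} → IsCharacter A → IsCharacter B → Nontrivial A → Nontrivial B →
                Nontrivial (A · φ) → Nontrivial (B · φ) → ∀ y →
                g A * g (B · φ) * Pᵛ A B y ≡ B (-F 1F) * g B * g (A · φ) * Pⁿ A B y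
    gauss-Pᵛ-Pⁿ {A} {B} hA hB nA nB nAφ nBφ y = begin
      g A * g (B · φ) * Pᵛ A B y
        ≡⟨ sym (Σ-*ˡ (g A * g (B · φ))) ⟩
      Σ (λ v → g A * g (B · φ) * (B v * ((B · φ) (i (1F +F -F v)) * A (i (1F +F -F (y *F v))))))
        ≡⟨ Σ-cong expand ⟩
      Σ (λ v → Σ (λ m → Σ (λ n → k m n * (B v * θ (-F (m +F y *F n) *F v)))))
        ≡⟨ Σ-swap ⟩
      Σ (λ m → Σ (λ v → Σ (λ n → k m n * (B v * θ (-F (m +F y *F n) *F v)))))
        ≡⟨ Σ-cong (λ m → Σ-swap) ⟩
      Σ (λ m → Σ (λ n → Σ (λ v → k m n * (B v * θ (-F (m +F y *F n) *F v)))))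
        ≡⟨ Σ-cong (λ m → Σ-cong λ n → trans (Σ-*ˡ (k m n)) (cong (k m n *_) (gauss-scaled hB nB _))) ⟩
      Σ (λ m → Σ (λ n → k m n * (B (i (-F (m +F y *F n))) * g B)))
        ≡⟨ Σ-cong (λ m → homogenise m (m ≟ 0F)) ⟩
      Σ (λ m → Σ (λ n → c * (A n * B (i (1F +F y *F n))) * ((A · φ) m * θ ((1F +F n) *F m))))
        ≡⟨ Σ-swap ⟩
      Σ (λ n → Σ (λ m → c * (A n * B (i (1F +F y *F n))) * ((A · φ) m * θ ((1F +F n) *F m))))
        ≡⟨ Σ-cong (λ n → trans (Σ-*ˡ (c * (A n * B (i (1F +F y *F n)))))
             (trans (cong (c * (A n * B (i (1F +F y *F n))) *_) (gauss-scaled hAφ nAφ (1F +F n)))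
               (solve 5 (λ c a b f h → c :* (a :* b) :* (f :* h) := c :* h :* (a :* (b :* f))) refl _ _ _ _ _))) ⟩
      Σ (λ n → c * g (A · φ) * (A n * (B (i (1F +F y *F n)) * (A · φ) (i (1F +F n)))))
        ≡⟨ Σ-*ˡ (c * g (A · φ)) ⟩
      c * g (A · φ) * Pⁿ A B y  ∎
      where
      c : K
      c = B (-F 1F) * g B
      hAφ : IsCharacter (A · φ)
      hAφ = ·-isCharacter hA φ-isCharacter
      hBφ : IsCharacter (B · φ)
      hBφ = ·-isCharacter hB φ-isCharacter
      k : F → F → K
      k m n = (B · φ) m * A n * θ (m +F n)
      expand : ∀ v → g A * g (B · φ) * (B v * ((B · φ) (i (1F +F -F v)) * A (i (1F +F -F (y *F v)))))
               ≡ Σ (λ m → Σ (λ n → k m n * (B v * θ (-F (m +F y *F n) *F v))))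
      expand v = begin
        g A * g (B · φ) * (B v * ((B · φ) (i (1F +F -F v)) * A (i (1F +F -F (y *F v)))))
          ≡⟨ solve 5 (λ a b v s t → a :* b :* (v :* (s :* t)) := v :* ((s :* b) :* (t :* a))) refl _ _ _ _ _ ⟩
        B v * (((B · φ) (i (1F +F -F v)) * g (B · φ)) * (A (i (1F +F -F (y *F v))) * g A))
          ≡⟨ cong (B v *_) (sym (cong₂ _*_ (gauss-scaled hBφ nBφ _) (gauss-scaled hA nA _))) ⟩
        B v * (Σ (λ m → (B · φ) m * θ ((1F +F -F v) *F m)) * Σ (λ n → A n * θ ((1F +F -F (y *F v)) *F n)))
          ≡⟨ cong (B v *_) (Σ-*-Σ _ _) ⟩
        B v * Σ (λ m → Σ (λ n → (B · φ) m * θ ((1F +F -F v) *F m) * (A n * θ ((1F +F -F (y *F v)) *F n))))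
          ≡⟨ sym (trans (Σ-cong (λ m → Σ-*ˡ (B v))) (Σ-*ˡ (B v))) ⟩
        Σ (λ m → Σ (λ n → B v * ((B · φ) m * θ ((1F +F -F v) *F m) * (A n * θ ((1F +F -F (y *F v)) *F n)))))
          ≡⟨ Σ-cong (λ m → Σ-cong λ n → begin
            B v * ((B · φ) m * θ ((1F +F -F v) *F m) * (A n * θ ((1F +F -F (y *F v)) *F n)))
              ≡⟨ solve 5 (λ v b s a t → v :* (b :* s :* (a :* t)) := b :* a :* v :* (s :* t)) refl _ _ _ _ _ ⟩
            (B · φ) m * A n * B v * (θ ((1F +F -F v) *F m) * θ ((1F +F -F (y *F v)) *F n))
              ≡⟨ cong ((B · φ) m * A n * B v *_) (trans (sym (θ-+ _ _)) (trans (cong θ (solveF 4 (λ v y m n →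
                   (𝟙 ⊕ ⊝ v) ⊗ m ⊕ (𝟙 ⊕ ⊝ (y ⊗ v)) ⊗ n ⊜ (m ⊕ n) ⊕ ⊝ (m ⊕ y ⊗ n) ⊗ v) refl v y m n)) (θ-+ _ _))) ⟩
            (B · φ) m * A n * B v * (θ (m +F n) * θ (-F (m +F y *F n) *F v))
              ≡⟨ solve 5 (λ b a v s t → b :* a :* v :* (s :* t) := b :* a :* s :* (v :* t)) refl _ _ _ _ _ ⟩
            k m n * (B v * θ (-F (m +F y *F n) *F v))  ∎) ⟩
        Σ (λ m → Σ (λ n → k m n * (B v * θ (-F (m +F y *F n) *F v))))  ∎
      -- After n ↦ mn the factor B(m) of Bφ(m) cancels against B(1/m) from the Gauss sum, so m
      -- carries A times φ. At m = 0 both sides vanish termwise.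
      homogenise : ∀ m → Dec (m ≡ 0F) → Σ (λ n → k m n * (B (i (-F (m +F y *F n))) * g B))
                   ≡ Σ (λ n → c * (A n * B (i (1F +F y *F n))) * ((A · φ) m * θ ((1F +F n) *F m)))
      homogenise m (yes e) = Σ-cong λ n → trans
        (trans (cong (λ b → b * A n * θ (m +F n) * (B (i (-F (m +F y *F n))) * g B)) (χ-at-0 hBφ e))
          (solve 4 (λ a b d e → :0 :* a :* b :* d := e :* (:0 :* :1)) refl _ _ _ (c * (A n * B (i (1F +F y *F n))))))
        (sym (trans (cong (λ a → c * (A n * B (i (1F +F y *F n))) * (a * θ ((1F +F n) *F m))) (χ-at-0 hAφ e))
          (solve 2 (λ a b → a :* (:0 :* b) := a :* (:0 :* :1)) refl _ _)))
      homogenise m (no m≢0) = trans (sym (Σ-scale (λ n → k m n * (B (i (-F (m +F y *F n))) * g B)) m≢0)) (Σ-cong λ n → begin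
        B m * φ m * A (m *F n) * θ (m +F m *F n) * (B (i (-F (m +F y *F (m *F n)))) * g B)
          ≡⟨ cong₂ (λ s t → B m * φ m * s * t * (B (i (-F (m +F y *F (m *F n)))) * g B))
               (χ-mul hA m n) (cong θ (solveF 2 (λ m n → m ⊕ m ⊗ n ⊜ (𝟙 ⊕ n) ⊗ m) refl m n)) ⟩
        B m * φ m * (A m * A n) * θ ((1F +F n) *F m) * (B (i (-F (m +F y *F (m *F n)))) * g B)
          ≡⟨ cong (λ s → B m * φ m * (A m * A n) * θ ((1F +F n) *F m) * (s * g B)) (begin
            B (i (-F (m +F y *F (m *F n))))
              ≡⟨ cong (λ s → B (i s)) (solveF 3 (λ m y n → ⊝ (m ⊕ y ⊗ (m ⊗ n)) ⊜ ⊝ (m ⊗ (𝟙 ⊕ y ⊗ n))) refl m y n) ⟩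
            B (i (-F (m *F (1F +F y *F n))))
              ≡⟨ cong B (trans (i-neg _) (trans (cong -F_ (i-* _ _)) (solveF 1 (λ n → ⊝ n ⊜ ⊝ 𝟙 ⊗ n) refl _))) ⟩
            B (-F 1F *F (i m *F i (1F +F y *F n)))
              ≡⟨ trans (χ-mul hB _ _) (cong (B (-F 1F) *_) (χ-mul hB _ _)) ⟩
            B (-F 1F) * (B (i m) * B (i (1F +F y *F n)))  ∎) ⟩
        B m * φ m * (A m * A n) * θ ((1F +F n) *F m) * (B (-F 1F) * (B (i m) * B (i (1F +F y *F n))) * g B)
          ≡⟨ lin₁ (φ m * (A m * A n) * θ ((1F +F n) *F m) * B (-F 1F) * B (i (1F +F y *F n)) * g B) (χ-i hB m≢0)
               (solve 9 (λ b f a α t e b′ β h → b :* f :* (a :* α) :* t :* (e :* (b′ :* β) :* h)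
                  :+ :- (e :* h :* (α :* β) :* (a :* f :* t))
                  := f :* (a :* α) :* t :* e :* β :* h :* (b :* b′ :+ :- :1))
                refl (B m) (φ m) (A m) (A n) (θ ((1F +F n) *F m)) (B (-F 1F)) (B (i m)) (B (i (1F +F y *F n))) (g B)) ⟩
        c * (A n * B (i (1F +F y *F n))) * ((A · φ) m * θ ((1F +F n) *F m))  ∎)

  -- The integral left by `gauss-Pᵛ-Pⁿ` is the one for B and A at the reflected variable n = -v, so
  -- it differs from P(B,A) only by A(-1).
  P-symmetry : ∀ {A B} → IsCharacter A → IsCharacter B → Nontrivial A → Nontrivial B →
               Nontrivial (A · φ) → Nontrivial (B · φ) → ∀ z →
               g A * g (B · φ) * P A B z ≡ (A · B) (-F 1F) * (g B * g (A · φ)) * P B A z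
  P-symmetry {A} {B} hA hB nA nB nAφ nBφ z = begin
    g A * g (B · φ) * P A B z
      ≡⟨ cong (g A * g (B · φ) *_) (sym (Pᵛ≡P hA hB z)) ⟩
    g A * g (B · φ) * Pᵛ A B y                              ≡⟨ gauss-Pᵛ-Pⁿ hA hB nA nB nAφ nBφ y ⟩
    B (-F 1F) * g B * g (A · φ) * Pⁿ A B y
      ≡⟨ lin₁ (- (B (-F 1F) * g B * g (A · φ) * Pⁿ A B y)) (χ-neg² hA)
           (solve 5 (λ b s t w a → b :* s :* t :* w :+ :- (a :* b :* (s :* t) :* (a :* w)) :=
             (:- (b :* s :* t :* w)) :* (a :* a :+ :- :1)) refl _ _ _ _ (A (-F 1F))) ⟩
    (A · B) (-F 1F) * (g B * g (A · φ)) * (A (-F 1F) * Pⁿ A B y)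
      ≡⟨ cong ((A · B) (-F 1F) * (g B * g (A · φ)) *_) (trans (sym (Pᵛ≡Pⁿ {A} {B} hA y)) (Pᵛ≡P hB hA z)) ⟩
    (A · B) (-F 1F) * (g B * g (A · φ)) * P B A z  ∎
    where
    y : F
    y = 1F +F -F z

  -- Roots of a quadratic against square roots

  φ-complete-square : ∀ {x a s} → ¬ (s ≡ 0F) → a *F x ≡ s *F s → φ x ≡ φ a
  φ-complete-square {x} {a} {s} s≢0 e = lin₂ (φ x) (- φ a) (sym aa) (trans (sym (φ-sq s≢0)) (trans (cong φ (sym e)) (φ-mul a x)))
    (solve 2 (λ x a → x :+ :- a := x :* (:1 :+ :- (a :* a)) :+ (:- a) :* (:1 :+ :- (a :* x))) refl _ _)
    where
    a≢0 : ¬ (a ≡ 0F)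
    a≢0 refl = FP.*-≢0 s≢0 s≢0 (trans (sym e) (FP.zeroˡ x))
    aa : φ a * φ a ≡ 1#
    aa = φ²≡1 a≢0

  -- If ξ runs over the roots of ξ² - X ξ + n y² and γ over the square roots of n, then
  -- (X - 2γy) ξ = (ξ - γy)². Summing φ(ξ) over all pairs (γ, ξ) gives 2 Σ φ(ξ), because
  -- ξ ↦ n y²/ξ shows Σ φ(ξ) = φ(n) Σ φ(ξ), and also 2 Σ φ(X - 2γy), because
  -- (X - 2γy)(X + 2γy) is the discriminant.
  module _ (X n y : F) (n≢0 : ¬ (n ≡ 0F)) (y≢0 : ¬ (y ≡ 0F)) where

    private
      E : F → F
      E ξ = ξ *F ξ +F -F (X *F ξ) +F n *F (y *F y)

      D : F
      D = X *F X +F -F (4F *F (n *F (y *F y)))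

      r₀ s₀ : F → K
      r₀ ξ = δ (E ξ) 0F
      s₀ γ = δ (γ *F γ) n

      ℓ : F → F
      ℓ γ = X +F -F (2F *F (γ *F y))

      M R W : K
      M = Σ (λ γ → s₀ γ * φ (ℓ γ))
      R = Σ (λ ξ → r₀ ξ * φ ξ)
      W = Σ (λ γ → s₀ γ * (r₀ (γ *F y) * φ (γ *F y)))

      ny²≢0 : ¬ (n *F (y *F y) ≡ 0F)
      ny²≢0 = FP.*-≢0 n≢0 (FP.*-≢0 y≢0 y≢0)

      root-≢0 : ∀ {ξ} → E ξ ≡ 0F → ¬ (ξ ≡ 0F)
      root-≢0 e refl = ny²≢0 (trans (solveF 2 (λ X c → c ⊜ 𝟘 ⊗ 𝟘 ⊕ ⊝ (X ⊗ 𝟘) ⊕ c) refl X (n *F (y *F y))) e)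

      count-roots : Σ r₀ ≡ 1# + φ D
      count-roots = begin
        Σ r₀                                  ≡⟨ Σ-cong (λ ξ → δ-⇔ (to ξ) (from ξ)) ⟩
        Σ (λ ξ → δ (shift ξ *F shift ξ) D)    ≡⟨ reindex-↔ (λ η → δ (η *F η) D) shift unshift
          (λ ξ → linF₁ ξ (i-r 2≢0) (solveF 3 (λ ξ X h → h ⊗ (((𝟙 ⊕ 𝟙) ⊗ ξ ⊕ ⊝ X) ⊕ X) ⊕ ⊝ ξ ⊜ ξ ⊗ ((𝟙 ⊕ 𝟙) ⊗ h ⊕ ⊝ 𝟙)) refl ξ X (i 2F)))
          (λ η → linF₁ (η +F X) (i-r 2≢0) (solveF 3 (λ η X h → (𝟙 ⊕ 𝟙) ⊗ (h ⊗ (η ⊕ X)) ⊕ ⊝ X ⊕ ⊝ η ⊜ (η ⊕ X) ⊗ ((𝟙 ⊕ 𝟙) ⊗ h ⊕ ⊝ 𝟙)) refl η X (i 2F))) ⟩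
        Σ (λ η → δ (η *F η) D)                ≡⟨ count-square-roots D ⟩
        1# + φ D                              ∎
        where
        shift unshift : F → F
        shift ξ = 2F *F ξ +F -F X
        unshift η = i 2F *F (η +F X)
        to : ∀ ξ → E ξ ≡ 0F → shift ξ *F shift ξ ≡ D
        to ξ e = linF₁ 4F e (solveF 3 (λ ξ X c → ((𝟙 ⊕ 𝟙) ⊗ ξ ⊕ ⊝ X) ⊗ ((𝟙 ⊕ 𝟙) ⊗ ξ ⊕ ⊝ X) ⊕ ⊝ (X ⊗ X ⊕ ⊝ ((𝟙 ⊕ 𝟙 ⊕ (𝟙 ⊕ 𝟙)) ⊗ c))
          ⊜ (𝟙 ⊕ 𝟙 ⊕ (𝟙 ⊕ 𝟙)) ⊗ (ξ ⊗ ξ ⊕ ⊝ (X ⊗ ξ) ⊕ c ⊕ ⊝ 𝟘)) refl ξ X (n *F (y *F y)))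
        from : ∀ ξ → shift ξ *F shift ξ ≡ D → E ξ ≡ 0F
        from ξ e = FP.*-≡0 (FP.*-≢0 2≢0 2≢0) (linF₁ 1F e
          (solveF 3 (λ ξ X c → (𝟙 ⊕ 𝟙) ⊗ (𝟙 ⊕ 𝟙) ⊗ (ξ ⊗ ξ ⊕ ⊝ (X ⊗ ξ) ⊕ c) ⊕ ⊝ 𝟘 ⊜
            𝟙 ⊗ (((𝟙 ⊕ 𝟙) ⊗ ξ ⊕ ⊝ X) ⊗ ((𝟙 ⊕ 𝟙) ⊗ ξ ⊕ ⊝ X) ⊕ ⊝ (X ⊗ X ⊕ ⊝ ((𝟙 ⊕ 𝟙 ⊕ (𝟙 ⊕ 𝟙)) ⊗ c)))) refl ξ X (n *F (y *F y))))

      R-φn : R ≡ φ n * R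
      R-φn = trans (reindex ι ι (λ ξ → to ξ (ξ ≟ 0F)) (λ ξ → from ξ (ξ ≟ 0F))) (Σ-*ˡ (φ n))
        where
        ι : F → F
        ι ξ = n *F (y *F y) *F i ξ
        ι-≢0 : ∀ {ξ} → ¬ (ξ ≡ 0F) → ¬ (ι ξ ≡ 0F)
        ι-≢0 ne = FP.*-≢0 ny²≢0 (i-≢0 ne)
        ι-ι : ∀ {ξ} → ¬ (ξ ≡ 0F) → ι (ι ξ) ≡ ξ
        ι-ι {ξ} ne = trans (cong (n *F (y *F y) *F_) (trans (i-* _ _) (cong (i (n *F (y *F y)) *F_) (i-involutive ξ))))
          (i-cancelʳ ny²≢0 ξ)
        root-ι : ∀ {ξ} → ¬ (ξ ≡ 0F) → E ξ ≡ 0F → E (ι ξ) ≡ 0F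
        root-ι {ξ} ne e = linF₂ (n *F (y *F y) *F (i ξ *F i ξ)) (n *F (y *F y) *F (-F X *F i ξ +F 1F +F ξ *F i ξ) *F -F 1F) e (i-r ne)
          (solveF 4 (λ c u x X → c ⊗ u ⊗ (c ⊗ u) ⊕ ⊝ (X ⊗ (c ⊗ u)) ⊕ c ⊕ ⊝ 𝟘 ⊜
            c ⊗ (u ⊗ u) ⊗ (x ⊗ x ⊕ ⊝ (X ⊗ x) ⊕ c ⊕ ⊝ 𝟘)
            ⊕ c ⊗ (⊝ X ⊗ u ⊕ 𝟙 ⊕ x ⊗ u) ⊗ ⊝ 𝟙 ⊗ (x ⊗ u ⊕ ⊝ 𝟙)) refl (n *F (y *F y)) (i ξ) ξ X)
        φ-ι : ∀ ξ → φ (ι ξ) ≡ φ n * φ ξ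
        φ-ι ξ = trans (φ-mul _ _) (cong₂ _*_ (trans (φ-mul _ _) (trans (cong (φ n *_) (φ-sq y≢0)) (*-identityʳ _))) (φ-i ξ))
        value : ∀ {ξ} → ¬ (ξ ≡ 0F) → φ n * (r₀ (ι ξ) * φ (ι ξ)) ≡ r₀ ξ * φ ξ
        value {ξ} ne = trans (cong₂ (λ a b → φ n * (a * b)) (δ-⇔ (λ e → subst (λ x → E x ≡ 0F) (ι-ι ne) (root-ι (ι-≢0 ne) e)) (root-ι ne)) (φ-ι ξ))
          (lin₁ (r₀ ξ * φ ξ) (φ²≡1 n≢0) (solve 3 (λ n r x → n :* (r :* (n :* x)) :+ :- (r :* x) := r :* x :* (n :* n :+ :- :1)) refl _ _ _))
        at-0 : ∀ {ξ} → ξ ≡ 0F → r₀ ξ * φ ξ ≡ 0#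
        at-0 e = trans (cong₂ _*_ refl (χ-at-0 φ-isCharacter e)) (zeroʳ _)
        to : ∀ ξ → Dec (ξ ≡ 0F) → r₀ ξ * φ ξ ≡ 0# ⊎ (ι (ι ξ) ≡ ξ × φ n * (r₀ (ι ξ) * φ (ι ξ)) ≡ r₀ ξ * φ ξ)
        to ξ (yes e) = inj₁ (at-0 e)
        to ξ (no ne) = inj₂ (ι-ι ne , value ne)
        from : ∀ ξ → Dec (ξ ≡ 0F) → φ n * (r₀ ξ * φ ξ) ≡ 0# ⊎ (ι (ι ξ) ≡ ξ × r₀ (ι ξ) * φ (ι ξ) ≡ φ n * (r₀ ξ * φ ξ))
        from ξ (yes e) = inj₁ (trans (cong (φ n *_) (at-0 e)) (zeroʳ _))
        from ξ (no ne) = inj₂ (ι-ι ne , trans (sym (value (ι-≢0 ne))) (cong (λ x → φ n * (r₀ x * φ x)) (ι-ι ne)))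

      vanish₁ : ∀ {a} → a ≡ 0# → ∀ p q w d → a * p ≡ a * q * w + d * (a * p)
      vanish₁ refl p q w d = solve 4 (λ p q w d → :0 :* p := :0 :* q :* w :+ d :* (:0 :* p)) refl p q w d

      vanish₂ : ∀ {b} → b ≡ 0# → ∀ a p q d → a * (b * p) ≡ a * q * b + d * (a * (b * p))
      vanish₂ refl a p q d = solve 4 (λ a p q d → a :* (:0 :* p) := a :* q :* :0 :+ d :* (a :* (:0 :* p))) refl a p q d

      discriminant : ∀ {γ ξ} → γ *F γ ≡ n → E ξ ≡ 0F → ξ *F ℓ γ ≡ (ξ +F -F (γ *F y)) *F (ξ +F -F (γ *F y))
      discriminant {γ} {ξ} γ²≡n e = linF₂ (-F 1F) (-F (y *F y)) e γ²≡n
        (solveF 5 (λ ξ γ X y n → ξ ⊗ (X ⊕ ⊝ ((𝟙 ⊕ 𝟙) ⊗ (γ ⊗ y))) ⊕ ⊝ ((ξ ⊕ ⊝ (γ ⊗ y)) ⊗ (ξ ⊕ ⊝ (γ ⊗ y))) ⊜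
          ⊝ 𝟙 ⊗ (ξ ⊗ ξ ⊕ ⊝ (X ⊗ ξ) ⊕ n ⊗ (y ⊗ y) ⊕ ⊝ 𝟘) ⊕ ⊝ (y ⊗ y) ⊗ (γ ⊗ γ ⊕ ⊝ n)) refl ξ γ X y n)

      -- Completing the square gives φ(ξ) = φ(ℓ γ) unless ξ = γy. There ℓ γ is 0 while φ(ξ) is not,
      -- and the δ-term records the defect; its total is `W`.
      pairs : ∀ γ ξ → s₀ γ * (r₀ ξ * φ ξ) ≡ s₀ γ * φ (ℓ γ) * r₀ ξ + δ ξ (γ *F y) * (s₀ γ * (r₀ ξ * φ ξ))
      pairs γ ξ = cases ((γ *F γ) ≟ n) (E ξ ≟ 0F) (ξ ≟ (γ *F y))
        where
        cases : Dec (γ *F γ ≡ n) → Dec (E ξ ≡ 0F) → Dec (ξ ≡ γ *F y) →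
                s₀ γ * (r₀ ξ * φ ξ) ≡ s₀ γ * φ (ℓ γ) * r₀ ξ + δ ξ (γ *F y) * (s₀ γ * (r₀ ξ * φ ξ))
        cases (no ne) _ _ = vanish₁ (δ-≢ ne) _ _ _ _
        cases (yes _) (no ne) _ = vanish₂ (δ-≢ ne) _ _ _ _
        cases (yes γ²≡n) (yes e) (yes ξ≡γy) = trans
          (solve 3 (λ s r f → s :* (r :* f) := s :* :0 :* r :+ :1 :* (s :* (r :* f))) refl _ _ _)
          (cong₂ (λ a b → s₀ γ * a * r₀ ξ + b * (s₀ γ * (r₀ ξ * φ ξ))) (sym (χ-at-0 φ-isCharacter ℓ≡0)) (sym (δ-≡ ξ≡γy)))
          where
          ℓ≡0 : ℓ γ ≡ 0F
          ℓ≡0 = FP.*-≡0 (root-≢0 e) (trans (discriminant γ²≡n e)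
            (trans (cong (_*F (ξ +F -F (γ *F y))) (trans (cong (_+F -F (γ *F y)) ξ≡γy) (FP.-‿inverseʳ _))) (FP.zeroˡ _)))
        cases (yes γ²≡n) (yes e) (no ξ≢γy) = trans
          (solve 3 (λ s r f → s :* (r :* f) := s :* f :* r :+ :0 :* (s :* (r :* f))) refl _ _ _)
          (cong₂ (λ a b → s₀ γ * a * r₀ ξ + b * (s₀ γ * (r₀ ξ * φ ξ)))
            (sym (φ-complete-square (FP.diff-≢0 ξ≢γy) (discriminant γ²≡n e))) (sym (δ-≢ ξ≢γy)))

      -- The discriminant is ℓ(γ) ℓ(-γ), and φ(ℓ γ)² = 1 unless ℓ γ = 0. In that case ℓ(-γ) = 4γy,
      -- and γy is a root because E(γy) = -γy ℓ(γ). The defect is thus `W` again, with the opposite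
      -- sign, and the two cancel in `root-duality`.
      conjugate : ∀ γ → s₀ γ * φ (ℓ γ) * φ D ≡ s₀ γ * φ (ℓ (-F γ)) + - (s₀ γ * (r₀ (γ *F y) * φ (γ *F y)))
      conjugate γ = cases ((γ *F γ) ≟ n) (ℓ γ ≟ 0F)
        where
        factor : γ *F γ ≡ n → D ≡ ℓ γ *F ℓ (-F γ)
        factor e = linF₁ (4F *F (y *F y)) e (solveF 4 (λ X n y γ →
          X ⊗ X ⊕ ⊝ ((𝟙 ⊕ 𝟙 ⊕ (𝟙 ⊕ 𝟙)) ⊗ (n ⊗ (y ⊗ y))) ⊕ ⊝ ((X ⊕ ⊝ ((𝟙 ⊕ 𝟙) ⊗ (γ ⊗ y))) ⊗ (X ⊕ ⊝ ((𝟙 ⊕ 𝟙) ⊗ (⊝ γ ⊗ y))))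
          ⊜ (𝟙 ⊕ 𝟙 ⊕ (𝟙 ⊕ 𝟙)) ⊗ (y ⊗ y) ⊗ (γ ⊗ γ ⊕ ⊝ n)) refl X n y γ)
        E-γy : γ *F γ ≡ n → E (γ *F y) ≡ -F (γ *F y) *F ℓ γ
        E-γy e = linF₁ (-F (y *F y)) e (solveF 4 (λ X n y γ →
          γ ⊗ y ⊗ (γ ⊗ y) ⊕ ⊝ (X ⊗ (γ ⊗ y)) ⊕ n ⊗ (y ⊗ y) ⊕ ⊝ (⊝ (γ ⊗ y) ⊗ (X ⊕ ⊝ ((𝟙 ⊕ 𝟙) ⊗ (γ ⊗ y))))
          ⊜ ⊝ (y ⊗ y) ⊗ (γ ⊗ γ ⊕ ⊝ n)) refl X n y γ)
        γ≢0 : γ *F γ ≡ n → ¬ (γ ≡ 0F)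
        γ≢0 e refl = n≢0 (trans (sym e) (FP.zeroˡ 0F))
        cases : Dec (γ *F γ ≡ n) → Dec (ℓ γ ≡ 0F) →
                s₀ γ * φ (ℓ γ) * φ D ≡ s₀ γ * φ (ℓ (-F γ)) + - (s₀ γ * (r₀ (γ *F y) * φ (γ *F y)))
        cases (no ne) _ = go (δ-≢ ne) _ _ _ _
          where
          go : ∀ {a} → a ≡ 0# → ∀ b c d e → a * b * c ≡ a * d + - (a * e)
          go refl b c d e = solve 4 (λ b c d e → :0 :* b :* c := :0 :* d :+ :- (:0 :* e)) refl b c d e
        cases (yes γ²≡n) (yes ℓ≡0) = begin
          s₀ γ * φ (ℓ γ) * φ D                          ≡⟨ cong (λ a → s₀ γ * a * φ D) (χ-at-0 φ-isCharacter ℓ≡0) ⟩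
          s₀ γ * 0# * φ D                               ≡⟨ solve 3 (λ s d f → s :* :0 :* d := s :* f :+ :- (s :* (:1 :* f))) refl _ _ (φ (γ *F y)) ⟩
          s₀ γ * φ (γ *F y) + - (s₀ γ * (1# * φ (γ *F y)))
            ≡⟨ cong₂ (λ a b → s₀ γ * a + - (s₀ γ * (b * φ (γ *F y)))) (sym opposite)
                 (sym (δ-≡ (trans (E-γy γ²≡n) (trans (cong (-F (γ *F y) *F_) ℓ≡0) (FP.zeroʳ _))))) ⟩
          s₀ γ * φ (ℓ (-F γ)) + - (s₀ γ * (r₀ (γ *F y) * φ (γ *F y)))  ∎
          where
          opposite : φ (ℓ (-F γ)) ≡ φ (γ *F y)
          opposite = trans (cong φ (linF₁ 1F ℓ≡0 (solveF 3 (λ X γ y → X ⊕ ⊝ ((𝟙 ⊕ 𝟙) ⊗ (⊝ γ ⊗ y)) ⊕ ⊝ ((𝟙 ⊕ 𝟙) ⊗ (𝟙 ⊕ 𝟙) ⊗ (γ ⊗ y))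
              ⊜ 𝟙 ⊗ (X ⊕ ⊝ ((𝟙 ⊕ 𝟙) ⊗ (γ ⊗ y)) ⊕ ⊝ 𝟘)) refl X γ y)))
            (trans (φ-mul _ _) (trans (cong (_* φ (γ *F y)) (φ-sq 2≢0)) (*-identityˡ _)))
        cases (yes γ²≡n) (no ℓ≢0) = begin
          s₀ γ * φ (ℓ γ) * φ D                          ≡⟨ cong (s₀ γ * φ (ℓ γ) *_) (trans (cong φ (factor γ²≡n)) (φ-mul _ _)) ⟩
          s₀ γ * φ (ℓ γ) * (φ (ℓ γ) * φ (ℓ (-F γ)))
            ≡⟨ lin₁ (s₀ γ * φ (ℓ (-F γ))) (φ²≡1 ℓ≢0) (solve 4 (λ s l m f → s :* l :* (l :* m) :+ :- (s :* m :+ :- (s :* (:0 :* f)))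
                 := s :* m :* (l :* l :+ :- :1)) refl _ _ _ (φ (γ *F y))) ⟩
          s₀ γ * φ (ℓ (-F γ)) + - (s₀ γ * (0# * φ (γ *F y)))
            ≡⟨ cong (λ a → s₀ γ * φ (ℓ (-F γ)) + - (s₀ γ * (a * φ (γ *F y)))) (sym (δ-≢ λ e → ℓ≢0 (FP.*-≡0 (neg-≢0 (FP.*-≢0 (γ≢0 γ²≡n) y≢0)) (trans (sym (E-γy γ²≡n)) e)))) ⟩
          s₀ γ * φ (ℓ (-F γ)) + - (s₀ γ * (r₀ (γ *F y) * φ (γ *F y)))  ∎

      M-conjugate : M * φ D ≡ M + - W
      M-conjugate = begin
        M * φ D                                           ≡⟨ sym (Σ-*ʳ (φ D)) ⟩
        Σ (λ γ → s₀ γ * φ (ℓ γ) * φ D)                    ≡⟨ Σ-cong (λ γ → trans (conjugate γ) (cong (s₀ γ * φ (ℓ (-F γ)) +_) (solve 1 (λ w → :- w := :- :1 :* w) refl _))) ⟩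
        Σ (λ γ → s₀ γ * φ (ℓ (-F γ)) + - 1# * (s₀ γ * (r₀ (γ *F y) * φ (γ *F y))))  ≡⟨ Σ-+ ⟩
        Σ (λ γ → s₀ γ * φ (ℓ (-F γ))) + Σ (λ γ → - 1# * (s₀ γ * (r₀ (γ *F y) * φ (γ *F y))))
          ≡⟨ cong₂ _+_
               (trans (Σ-cong (λ γ → cong (λ x → δ x n * φ (ℓ (-F γ))) (solveF 1 (λ γ → γ ⊗ γ ⊜ ⊝ γ ⊗ ⊝ γ) refl γ)))
                 (reindex-↔ (λ γ → s₀ γ * φ (ℓ γ)) -F_ -F_ FP.-‿involutive FP.-‿involutive))
               (trans (Σ-*ˡ (- 1#)) (solve 1 (λ w → :- :1 :* w := :- w) refl _)) ⟩
        M + - W                                           ∎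

      double-sum : (1# + φ n) * R ≡ M * (1# + φ D) + W
      double-sum = begin
        (1# + φ n) * R                                    ≡⟨ cong (_* R) (sym (count-square-roots n)) ⟩
        Σ s₀ * R                                          ≡⟨ Σ-*-Σ s₀ (λ ξ → r₀ ξ * φ ξ) ⟩
        Σ (λ γ → Σ (λ ξ → s₀ γ * (r₀ ξ * φ ξ)))           ≡⟨ Σ-cong (λ γ → trans (Σ-cong (pairs γ)) (Σ-+)) ⟩
        Σ (λ γ → Σ (λ ξ → s₀ γ * φ (ℓ γ) * r₀ ξ) + Σ (λ ξ → δ ξ (γ *F y) * (s₀ γ * (r₀ ξ * φ ξ))))
          ≡⟨ Σ-cong (λ γ → cong₂ _+_ (Σ-*ˡ (s₀ γ * φ (ℓ γ))) (Σ-δ (λ ξ → s₀ γ * (r₀ ξ * φ ξ)) (γ *F y))) ⟩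
        Σ (λ γ → s₀ γ * φ (ℓ γ) * Σ r₀ + s₀ γ * (r₀ (γ *F y) * φ (γ *F y)))
          ≡⟨ trans (Σ-+) (cong (_+ W) (Σ-*ʳ (Σ r₀))) ⟩
        M * Σ r₀ + W                                      ≡⟨ cong (λ u → M * u + W) count-roots ⟩
        M * (1# + φ D) + W                                ∎

    root-duality : Σ (λ γ → δ (γ *F γ) n * φ (X +F -F (2F *F (γ *F y))))
                   ≡ Σ (λ ξ → δ (ξ *F ξ +F -F (X *F ξ) +F n *F (y *F y)) 0F * φ ξ)
    root-duality = sym (KF.*-cancelˡ-≢0 K-2≢0 (begin
      (1# + 1#) * R             ≡⟨ lin₁ 1# R-φn (solve 2 (λ r f → (:1 :+ :1) :* r :+ :- ((:1 :+ f) :* r) := :1 :* (r :+ :- (f :* r))) refl R (φ n)) ⟩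
      (1# + φ n) * R            ≡⟨ double-sum ⟩
      M * (1# + φ D) + W        ≡⟨ lin₁ 1# M-conjugate (solve 3 (λ m d w → m :* (:1 :+ d) :+ w :+ :- ((:1 :+ :1) :* m) := :1 :* (m :* d :+ :- (m :+ :- w))) refl M (φ D) W) ⟩
      (1# + 1#) * M             ∎))

  -- The product P(A,B) P(B,A)

  module _ {A B : Char} (hA : IsCharacter A) (hB : IsCharacter B) (nA : Nontrivial A) (nB : Nontrivial B)
           (nAφ : Nontrivial (A · φ)) (nBφ : Nontrivial (B · φ))
           {z : F} (z≢0 : ¬ (z ≡ 0F)) (1-z≢0 : ¬ (1F +F -F z ≡ 0F)) where

    private
      y : F
      y = 1F +F -F z

      -- With b = α(1 + za)/(1 + a), these are (1 + a)(1 + b) and (1 + a)(1 + zb), and `arg` is β.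
      -- Multiplied out, they keep a meaning when 1 + a or 1 + za is 0.
      ξ ξ′ : F → F → F
      ξ α a = 1F +F a +F α *F (1F +F z *F a)
      ξ′ α a = 1F +F a +F α *F (z *F (1F +F z *F a))

      arg : F → F → F
      arg α a = a *F ξ α a *F i (ξ′ α a)

      t : F → F → K
      t α a = A α * (B (arg α a) * φ (ξ α a))

      P₁ : F → K
      P₁ a = B a * ((A · φ) (1F +F a) * A (i (1F +F z *F a)))

      P₂ : F → K
      P₂ b = A b * ((B · φ) (1F +F b) * B (i (1F +F z *F b)))

      -- Generically b is a nonzero multiple of α, so this is a scaling. If 1 + a or 1 + za is 0
      -- there is no such scaling, but then the left side has the factor 0, and the right side is a
      -- multiple of Σ Aφ or of Σ A.
      row-a : ∀ a → Dec (1F +F a ≡ 0F) → Dec (1F +F z *F a ≡ 0F) → Σ (λ b → P₁ a * P₂ b) ≡ Σ (λ α → t α a)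
      row-a a (yes e) _ = trans (vanishing p-0) (sym (trans (Σ-cong (λ α → value α (α ≟ 0F)))
          (trans (Σ-*ˡ (B (-F i z) * φ y)) (trans (cong (B (-F i z) * φ y *_) nAφ) (zeroʳ _)))))
        where
        p-0 : P₁ a ≡ 0#
        p-0 = trans (cong (λ u → B a * (u * A (i (1F +F z *F a)))) (χ-at-0 (·-isCharacter hA φ-isCharacter) e))
          (solve 2 (λ a b → a :* (:0 :* b) := :0) refl _ _)
        vanishing : P₁ a ≡ 0# → Σ (λ b → P₁ a * P₂ b) ≡ 0#
        vanishing h = trans (Σ-*ˡ (P₁ a)) (trans (cong (_* Σ P₂) h) (zeroˡ _))
        value : ∀ α → Dec (α ≡ 0F) → t α a ≡ B (-F i z) * φ y * (A · φ) α
        value α (yes α≡0) = trans (cong (_* (B (arg α a) * φ (ξ α a))) (χ-at-0 hA α≡0))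
          (trans (solve 3 (λ a b c → :0 :* a := b :* (:0 :* c)) refl _ (B (-F i z) * φ y) (φ α))
            (cong (λ u → B (-F i z) * φ y * (u * φ α)) (sym (χ-at-0 hA α≡0))))
        value α (no α≢0) = trans (cong₂ (λ u v → A α * (B u * v)) argument (trans (cong φ ξ≡) (φ-mul α y)))
          (solve 4 (λ a b α y → a :* (b :* (α :* y)) := b :* y :* (a :* α)) refl _ _ _ _)
          where
          ξ≡ : ξ α a ≡ α *F y
          ξ≡ = linF₁ (1F +F α *F z) e (solveF 3 (λ a α z → 𝟙 ⊕ a ⊕ α ⊗ (𝟙 ⊕ z ⊗ a) ⊕ ⊝ (α ⊗ (𝟙 ⊕ ⊝ z)) ⊜ (𝟙 ⊕ α ⊗ z) ⊗ (𝟙 ⊕ a ⊕ ⊝ 𝟘)) refl a α z)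
          ξ′≡ : ξ′ α a ≡ α *F y *F z
          ξ′≡ = linF₁ (1F +F α *F z *F z) e (solveF 3 (λ a α z → 𝟙 ⊕ a ⊕ α ⊗ (z ⊗ (𝟙 ⊕ z ⊗ a)) ⊕ ⊝ (α ⊗ (𝟙 ⊕ ⊝ z) ⊗ z) ⊜ (𝟙 ⊕ α ⊗ z ⊗ z) ⊗ (𝟙 ⊕ a ⊕ ⊝ 𝟘)) refl a α z)
          argument : arg α a ≡ -F i z
          argument = trans (cong₂ (λ u v → a *F u *F v) ξ≡ (trans (cong i ξ′≡) (i-* _ _)))
            (linF₂ (i z) (-F i z) (trans (cong (_*F ((α *F y) *F i (α *F y))) e) (FP.zeroˡ _)) (i-r (FP.*-≢0 α≢0 1-z≢0))
              (solveF 4 (λ a w u v → a ⊗ w ⊗ (u ⊗ v) ⊕ ⊝ (⊝ v) ⊜ v ⊗ ((𝟙 ⊕ a) ⊗ (w ⊗ u) ⊕ ⊝ 𝟘) ⊕ ⊝ v ⊗ (w ⊗ u ⊕ ⊝ 𝟙)) refl a (α *F y) (i (α *F y)) (i z)))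
      row-a a (no _) (yes e) = trans (vanishing p-0) (sym (trans (Σ-cong value)
          (trans (Σ-*ʳ (B (a *F (1F +F a) *F i (1F +F a)) * φ (1F +F a))) (trans (cong (_* (B (a *F (1F +F a) *F i (1F +F a)) * φ (1F +F a))) nA) (zeroˡ _)))))
        where
        p-0 : P₁ a ≡ 0#
        p-0 = trans (cong (λ u → B a * ((A · φ) (1F +F a) * u)) (χ-at-i0 hA e))
          (solve 2 (λ a b → a :* (b :* :0) := :0) refl _ _)
        vanishing : P₁ a ≡ 0# → Σ (λ b → P₁ a * P₂ b) ≡ 0#
        vanishing h = trans (Σ-*ˡ (P₁ a)) (trans (cong (_* Σ P₂) h) (zeroˡ _))
        value : ∀ α → t α a ≡ A α * (B (a *F (1F +F a) *F i (1F +F a)) * φ (1F +F a))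
        value α = cong₂ (λ u v → A α * (B (a *F u *F i v) * φ u))
          (linF₁ α e (solveF 3 (λ a α w → 𝟙 ⊕ a ⊕ α ⊗ w ⊕ ⊝ (𝟙 ⊕ a) ⊜ α ⊗ (w ⊕ ⊝ 𝟘)) refl a α (1F +F z *F a)))
          (linF₁ (α *F z) e (solveF 4 (λ a α z w → 𝟙 ⊕ a ⊕ α ⊗ (z ⊗ w) ⊕ ⊝ (𝟙 ⊕ a) ⊜ α ⊗ z ⊗ (w ⊕ ⊝ 𝟘)) refl a α z (1F +F z *F a)))
      row-a a (no 1+a≢0) (no w≢0) = trans (sym (Σ-scale (λ b → P₁ a * P₂ b) m≢0)) (Σ-cong λ α → begin
          P₁ a * P₂ (m *F α)
            ≡⟨ cong₂ (λ s r → P₁ a * (s * r))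
                 (trans (χ-mul hA _ _) (cong (_* A α) (χ-mul hA _ _)))
                 (cong₂ _*_ (trans (cong (B · φ) (1+mα α)) (cong₂ _*_ (χ-mul hB _ _) (φ-mul _ _)))
                   (trans (cong (λ s → B (i s)) (1+zmα α)) (trans (cong B (trans (i-* _ _) (cong (i (ξ′ α a) *F_) (i-involutive _)))) (χ-mul hB _ _)))) ⟩
          P₁ a * (A w * A u * A α * (B (ξ α a) * B u * (φ (ξ α a) * φ u) * (B (i (ξ′ α a)) * B (1F +F a))))
            ≡⟨ solve 13 (λ ba a₁ f₁ aw′ aw au aα bξ bu fξ fu bξ′ b₁ →
                 ba :* (a₁ :* f₁ :* aw′) :* (aw :* au :* aα :* (bξ :* bu :* (fξ :* fu) :* (bξ′ :* b₁)))
                 := (a₁ :* au) :* (aw :* aw′) :* ((b₁ :* bu) :* (f₁ :* fu)) :* (aα :* (ba :* bξ :* bξ′ :* fξ)))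
                 refl (B a) (A (1F +F a)) (φ (1F +F a)) (A (i w)) (A w) (A u) (A α) (B (ξ α a)) (B u) (φ (ξ α a)) (φ u) (B (i (ξ′ α a))) (B (1F +F a)) ⟩
          (A (1F +F a) * A u) * (A w * A (i w)) * ((B (1F +F a) * B u) * (φ (1F +F a) * φ u)) * (A α * (B a * B (ξ α a) * B (i (ξ′ α a)) * φ (ξ α a)))
            ≡⟨ cong₂ _*_ (cong₂ _*_ (cong₂ _*_ (χ-i hA 1+a≢0) (χ-i hA w≢0)) (cong₂ _*_ (χ-i hB 1+a≢0) (χ-i φ-isCharacter 1+a≢0)))
                 (cong (λ s → A α * (s * φ (ξ α a))) (sym (trans (χ-mul hB _ _) (cong (_* B (i (ξ′ α a))) (χ-mul hB _ _))))) ⟩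
          1# * 1# * (1# * 1#) * t α a
            ≡⟨ solve 1 (λ x → :1 :* :1 :* (:1 :* :1) :* x := x) refl _ ⟩
          t α a  ∎)
        where
        u w m : F
        u = i (1F +F a)
        w = 1F +F z *F a
        m = w *F u
        m≢0 : ¬ (m ≡ 0F)
        m≢0 = FP.*-≢0 w≢0 (i-≢0 1+a≢0)
        1+mα : ∀ α → 1F +F m *F α ≡ ξ α a *F u
        1+mα α = linF₁ (-F 1F) (i-r 1+a≢0) (solveF 4 (λ a z α u → 𝟙 ⊕ (𝟙 ⊕ z ⊗ a) ⊗ u ⊗ α ⊕ ⊝ ((𝟙 ⊕ a ⊕ α ⊗ (𝟙 ⊕ z ⊗ a)) ⊗ u)
          ⊜ ⊝ 𝟙 ⊗ ((𝟙 ⊕ a) ⊗ u ⊕ ⊝ 𝟙)) refl a z α u)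
        1+zmα : ∀ α → 1F +F z *F (m *F α) ≡ ξ′ α a *F u
        1+zmα α = linF₁ (-F 1F) (i-r 1+a≢0) (solveF 4 (λ a z α u → 𝟙 ⊕ z ⊗ ((𝟙 ⊕ z ⊗ a) ⊗ u ⊗ α) ⊕ ⊝ ((𝟙 ⊕ a ⊕ α ⊗ (z ⊗ (𝟙 ⊕ z ⊗ a))) ⊗ u)
          ⊜ ⊝ 𝟙 ⊗ ((𝟙 ⊕ a) ⊗ u ⊕ ⊝ 𝟙)) refl a z α u)

      P-product : P A B z * P B A z ≡ Σ (λ α → Σ (λ a → t α a))
      P-product = trans (Σ-*-Σ P₁ P₂) (trans (Σ-cong (λ a → row-a a ((1F +F a) ≟ 0F) ((1F +F z *F a) ≟ 0F))) (Σ-swap))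

      E : F → F → F → F
      E α β x = x *F x +F -F ((1F +F α +F β +F α *F β *F (z *F z)) *F x) +F α *F β *F (y *F y)

      roots : F → K
      roots α = Σ (λ x → φ x * Σ (λ β → B β * δ (E α β x) 0F))

      c₀ α₀ : F
      α₀ = -F i z
      c₀ = -F (y *F i z)

      extra : K
      extra = qK * (B α₀ * φ c₀)

      -- For fixed α the substitution a ↦ ξ is affine and E is linear in β; only for α = -1/z do both
      -- degenerate, and there E = (x - c₀)(x - βy).
      row-α : ∀ α → Dec (1F +F α *F z ≡ 0F) → Σ (λ a → B (arg α a) * φ (ξ α a))
              ≡ roots α + δ α α₀ * extra
      row-α α (no e≢0) = begin
        Σ (λ a → B (arg α a) * φ (ξ α a))
          ≡⟨ Σ-cong (λ a → sym (value a (ξ α a ≟ 0F) (ξ′ α a ≟ 0F))) ⟩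
        Σ (λ a → φ (ξ α a) * Σ (λ β → B β * δ (E α β (ξ α a)) 0F))
          ≡⟨ reindex-↔ (λ x → φ x * Σ (λ β → B β * δ (E α β x) 0F)) (ξ α) τ τσ στ ⟩
        roots α
          ≡⟨ sym (trans (cong (λ d → roots α + d * extra) (δ-≢ α≢α₀)) (solve 2 (λ a b → a :+ :0 :* b := a) refl _ _)) ⟩
        roots α + δ α α₀ * extra  ∎
        where
        α≢α₀ : ¬ (α ≡ α₀)
        α≢α₀ refl = e≢0 (linF₁ (-F 1F) (i-r z≢0) (solveF 2 (λ z u → 𝟙 ⊕ ⊝ u ⊗ z ⊕ ⊝ 𝟘 ⊜ ⊝ 𝟙 ⊗ (z ⊗ u ⊕ ⊝ 𝟙)) refl z (i z)))
        τ : F → F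
        τ x = (x +F -F (1F +F α)) *F i (1F +F α *F z)
        τσ : ∀ a → τ (ξ α a) ≡ a
        τσ a = linF₁ a (i-r e≢0) (solveF 4 (λ α a z u → (𝟙 ⊕ a ⊕ α ⊗ (𝟙 ⊕ z ⊗ a) ⊕ ⊝ (𝟙 ⊕ α)) ⊗ u ⊕ ⊝ a ⊜ a ⊗ ((𝟙 ⊕ α ⊗ z) ⊗ u ⊕ ⊝ 𝟙)) refl α a z (i (1F +F α *F z)))
        στ : ∀ x → ξ α (τ x) ≡ x
        στ x = linF₁ (x +F -F (1F +F α)) (i-r e≢0) (solveF 4 (λ α x z u →
          𝟙 ⊕ (x ⊕ ⊝ (𝟙 ⊕ α)) ⊗ u ⊕ α ⊗ (𝟙 ⊕ z ⊗ ((x ⊕ ⊝ (𝟙 ⊕ α)) ⊗ u)) ⊕ ⊝ x ⊜ (x ⊕ ⊝ (𝟙 ⊕ α)) ⊗ ((𝟙 ⊕ α ⊗ z) ⊗ u ⊕ ⊝ 𝟙)) refl α x z (i (1F +F α *F z)))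
        E-linear : ∀ a β → E α β (ξ α a) ≡ (1F +F α *F z) *F (a *F ξ α a +F -F (β *F ξ′ α a))
        E-linear a β = solveF 4 (λ α β a z →
          (𝟙 ⊕ a ⊕ α ⊗ (𝟙 ⊕ z ⊗ a)) ⊗ (𝟙 ⊕ a ⊕ α ⊗ (𝟙 ⊕ z ⊗ a))
            ⊕ ⊝ ((𝟙 ⊕ α ⊕ β ⊕ α ⊗ β ⊗ (z ⊗ z)) ⊗ (𝟙 ⊕ a ⊕ α ⊗ (𝟙 ⊕ z ⊗ a)))
            ⊕ α ⊗ β ⊗ ((𝟙 ⊕ ⊝ z) ⊗ (𝟙 ⊕ ⊝ z))
          ⊜ (𝟙 ⊕ α ⊗ z) ⊗ (a ⊗ (𝟙 ⊕ a ⊕ α ⊗ (𝟙 ⊕ z ⊗ a)) ⊕ ⊝ (β ⊗ (𝟙 ⊕ a ⊕ α ⊗ (z ⊗ (𝟙 ⊕ z ⊗ a)))))) refl α β a z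
        value : ∀ a → Dec (ξ α a ≡ 0F) → Dec (ξ′ α a ≡ 0F) →
                φ (ξ α a) * Σ (λ β → B β * δ (E α β (ξ α a)) 0F) ≡ B (arg α a) * φ (ξ α a)
        value a (yes ξ≡0) _ = trans (cong₂ _*_ (χ-at-0 φ-isCharacter ξ≡0) refl)
          (trans (solve 2 (λ a b → :0 :* a := b :* :0) refl _ _) (cong (B (arg α a) *_) (sym (χ-at-0 φ-isCharacter ξ≡0))))
        -- Here the linear equation for β has no solution, and `arg` is 0 by the convention on `i`,
        -- so both sides vanish.
        value a (no ξ≢0) (yes ξ′≡0) = trans
          (cong (φ (ξ α a) *_) (trans (Σ-cong (λ β → trans (cong (B β *_) (δ-≢ (no-root β))) (zeroʳ _))) (Σ-0)))
          (trans (solve 1 (λ a → a :* :0 := :0 :* a) refl _) (cong (_* φ (ξ α a)) (sym (trans (cong B (trans (cong (a *F ξ α a *F_) (i-≡0 ξ′≡0)) (FP.zeroʳ _))) (χ-0 hB)))))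
          where
          a≢0 : ¬ (a ≡ 0F)
          a≢0 refl = e≢0 (trans (solveF 2 (λ α z → 𝟙 ⊕ α ⊗ z ⊜ 𝟙 ⊕ 𝟘 ⊕ α ⊗ (z ⊗ (𝟙 ⊕ z ⊗ 𝟘))) refl α z) ξ′≡0)
          no-root : ∀ β → ¬ (E α β (ξ α a) ≡ 0F)
          no-root β e = FP.*-≢0 a≢0 ξ≢0 (linF₂ 1F β (FP.*-≡0 e≢0 (trans (sym (E-linear a β)) e)) ξ′≡0
            (solveF 3 (λ s β t → s ⊕ ⊝ 𝟘 ⊜ 𝟙 ⊗ ((s ⊕ ⊝ (β ⊗ t)) ⊕ ⊝ 𝟘) ⊕ β ⊗ (t ⊕ ⊝ 𝟘)) refl (a *F ξ α a) β (ξ′ α a)))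
        value a (no ξ≢0) (no ξ′≢0) = trans
          (cong (φ (ξ α a) *_) (trans (Σ-cong (λ β → trans (*-comm _ _) (cong (_* B β) (δ-⇔ (to β) (from β))))) (Σ-δ B (arg α a))))
          (*-comm _ _)
          where
          to : ∀ β → E α β (ξ α a) ≡ 0F → β ≡ arg α a
          to β e = linF₂ (-F i (ξ′ α a)) (-F β) (FP.*-≡0 e≢0 (trans (sym (E-linear a β)) e)) (i-r ξ′≢0)
            (solveF 4 (λ s β t u → β ⊕ ⊝ (s ⊗ u) ⊜ ⊝ u ⊗ ((s ⊕ ⊝ (β ⊗ t)) ⊕ ⊝ 𝟘) ⊕ ⊝ β ⊗ (t ⊗ u ⊕ ⊝ 𝟙)) refl (a *F ξ α a) β (ξ′ α a) (i (ξ′ α a)))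
          from : ∀ β → β ≡ arg α a → E α β (ξ α a) ≡ 0F
          from β refl = trans (E-linear a β) (linF₁ (-F ((1F +F α *F z) *F (a *F ξ α a))) (i-r ξ′≢0)
            (solveF 4 (λ e s t u → e ⊗ (s ⊕ ⊝ (s ⊗ u ⊗ t)) ⊕ ⊝ 𝟘 ⊜ ⊝ (e ⊗ s) ⊗ (t ⊗ u ⊕ ⊝ 𝟙)) refl (1F +F α *F z) (a *F ξ α a) (ξ′ α a) (i (ξ′ α a))))
      row-α α (yes e≡0) = trans (cong row α≡α₀) (trans special (cong row′ (sym α≡α₀)))
        where
        row row′ : F → K
        row α = Σ (λ a → B (arg α a) * φ (ξ α a))
        row′ α = roots α + δ α α₀ * extra
        α≡α₀ : α ≡ α₀
        α≡α₀ = linF₂ (i z) (-F α) e≡0 (i-r z≢0) (solveF 3 (λ α z u → α ⊕ ⊝ (⊝ u) ⊜ u ⊗ (𝟙 ⊕ α ⊗ z ⊕ ⊝ 𝟘) ⊕ ⊝ α ⊗ (z ⊗ u ⊕ ⊝ 𝟙)) refl α z (i z))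
        ξ₀ : ∀ a → ξ α₀ a ≡ c₀
        ξ₀ a = linF₁ (-F a +F -F 1F) (i-r z≢0) (solveF 3 (λ a z u → 𝟙 ⊕ a ⊕ ⊝ u ⊗ (𝟙 ⊕ z ⊗ a) ⊕ ⊝ (⊝ ((𝟙 ⊕ ⊝ z) ⊗ u)) ⊜ (⊝ a ⊕ ⊝ 𝟙) ⊗ (z ⊗ u ⊕ ⊝ 𝟙)) refl a z (i z))
        ξ′₀ : ∀ a → ξ′ α₀ a ≡ y *F a
        ξ′₀ a = linF₁ (-F (1F +F z *F a)) (i-r z≢0) (solveF 3 (λ a z u → 𝟙 ⊕ a ⊕ ⊝ u ⊗ (z ⊗ (𝟙 ⊕ z ⊗ a)) ⊕ ⊝ ((𝟙 ⊕ ⊝ z) ⊗ a) ⊜ ⊝ (𝟙 ⊕ z ⊗ a) ⊗ (z ⊗ u ⊕ ⊝ 𝟙)) refl a z (i z))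
        left-value : ∀ a → Dec (a ≡ 0F) → B (a *F ξ α₀ a *F i (ξ′ α₀ a)) * φ (ξ α₀ a) ≡ B α₀ * φ c₀ * 1# + δ a 0F * (- 1# * (B α₀ * φ c₀))
        left-value a (yes a≡0) = trans
          (cong (_* φ (ξ α₀ a)) (χ-at-0 hB (trans (cong (λ s → s *F ξ α₀ a *F i (ξ′ α₀ a)) a≡0) (solveF 2 (λ s t → 𝟘 ⊗ s ⊗ t ⊜ 𝟘) refl _ _))))
          (trans (solve 2 (λ a b → :0 :* a := b :* :1 :+ :1 :* (:- :1 :* b)) refl _ (B α₀ * φ c₀))
            (cong (λ d → B α₀ * φ c₀ * 1# + d * (- 1# * (B α₀ * φ c₀))) (sym (δ-≡ a≡0))))
        left-value a (no a≢0) = trans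
          (cong₂ (λ s t → B s * φ t) (trans (cong₂ (λ s t → a *F s *F i t) (ξ₀ a) (ξ′₀ a)) argument) (ξ₀ a))
          (trans (solve 1 (λ b → b := b :* :1 :+ :0 :* (:- :1 :* b)) refl _)
            (cong (λ d → B α₀ * φ c₀ * 1# + d * (- 1# * (B α₀ * φ c₀))) (sym (δ-≢ a≢0))))
          where
          argument : a *F c₀ *F i (y *F a) ≡ α₀
          argument = linF₁ (-F i z) (i-r (FP.*-≢0 1-z≢0 a≢0)) (solveF 4 (λ a y u v → a ⊗ ⊝ (y ⊗ u) ⊗ v ⊕ ⊝ (⊝ u) ⊜ ⊝ u ⊗ (y ⊗ a ⊗ v ⊕ ⊝ 𝟙)) refl a y (i z) (i (y *F a)))
        left : row α₀ ≡ B α₀ * φ c₀ * qK + - 1# * (B α₀ * φ c₀)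
        left = trans (Σ-cong (λ a → left-value a (a ≟ 0F))) (trans (Σ-+)
          (cong₂ _+_ (trans (Σ-*ˡ (B α₀ * φ c₀)) (cong (B α₀ * φ c₀ *_) Σ-1)) (Σ-δ (λ _ → - 1# * (B α₀ * φ c₀)) 0F)))
        E₀ : ∀ β x → E α₀ β x ≡ (x +F -F c₀) *F (x +F -F (β *F y))
        E₀ β x = linF₁ (x +F β *F z *F x) (i-r z≢0) (solveF 4 (λ x β z u →
          x ⊗ x ⊕ ⊝ ((𝟙 ⊕ ⊝ u ⊕ β ⊕ ⊝ u ⊗ β ⊗ (z ⊗ z)) ⊗ x) ⊕ ⊝ u ⊗ β ⊗ ((𝟙 ⊕ ⊝ z) ⊗ (𝟙 ⊕ ⊝ z))
            ⊕ ⊝ ((x ⊕ ⊝ (⊝ ((𝟙 ⊕ ⊝ z) ⊗ u))) ⊗ (x ⊕ ⊝ (β ⊗ (𝟙 ⊕ ⊝ z))))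
          ⊜ (x ⊕ β ⊗ z ⊗ x) ⊗ (z ⊗ u ⊕ ⊝ 𝟙)) refl x β z (i z))
        right-value : ∀ x → Dec (x ≡ c₀) → φ x * Σ (λ β → B β * δ (E α₀ β x) 0F) ≡ B (i y) * (B · φ) x + δ x c₀ * (- 1# * (B (i y) * (B · φ) x))
        right-value x (yes x≡c₀) = trans
          (cong (φ x *_) (trans (Σ-cong (λ β → trans (cong (B β *_) (δ-≡ (trans (E₀ β x) (trans (cong (_*F (x +F -F (β *F y))) (diffF-0 x≡c₀)) (FP.zeroˡ _))))) (*-identityʳ _))) nB))
          (trans (solve 2 (λ f b → f :* :0 := b :+ :1 :* (:- :1 :* b)) refl (φ x) (B (i y) * (B · φ) x))
            (cong (λ d → B (i y) * (B · φ) x + d * (- 1# * (B (i y) * (B · φ) x))) (sym (δ-≡ x≡c₀))))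
        right-value x (no x≢c₀) = trans
          (cong (φ x *_) (trans (Σ-cong (λ β → trans (*-comm _ _) (cong (_* B β) (δ-⇔ (to β) (from β))))) (trans (Σ-δ B (x *F i y)) (χ-mul hB _ _))))
          (trans (solve 3 (λ f b c → f :* (b :* c) := c :* (b :* f) :+ :0 :* (:- :1 :* (c :* (b :* f)))) refl (φ x) (B x) (B (i y)))
            (cong (λ d → B (i y) * (B · φ) x + d * (- 1# * (B (i y) * (B · φ) x))) (sym (δ-≢ x≢c₀))))
          where
          to : ∀ β → E α₀ β x ≡ 0F → β ≡ x *F i y
          to β e = linF₂ (-F i y) (-F β) (FP.*-≡0 (FP.diff-≢0 x≢c₀) (trans (sym (E₀ β x)) e)) (i-r 1-z≢0)
            (solveF 4 (λ x β t u → β ⊕ ⊝ (x ⊗ u) ⊜ ⊝ u ⊗ ((x ⊕ ⊝ (β ⊗ t)) ⊕ ⊝ 𝟘) ⊕ ⊝ β ⊗ (t ⊗ u ⊕ ⊝ 𝟙)) refl x β y (i y))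
          from : ∀ β → β ≡ x *F i y → E α₀ β x ≡ 0F
          from β refl = trans (E₀ β x) (linF₁ (-F ((x +F -F c₀) *F x)) (i-r 1-z≢0)
            (solveF 4 (λ e s t u → e ⊗ (s ⊕ ⊝ (s ⊗ u ⊗ t)) ⊕ ⊝ 𝟘 ⊜ ⊝ (e ⊗ s) ⊗ (t ⊗ u ⊕ ⊝ 𝟙)) refl (x +F -F c₀) x y (i y)))
        right : Σ (λ x → φ x * Σ (λ β → B β * δ (E α₀ β x) 0F)) ≡ - 1# * (B α₀ * φ c₀)
        right = begin
          Σ (λ x → φ x * Σ (λ β → B β * δ (E α₀ β x) 0F))
            ≡⟨ Σ-cong (λ x → right-value x (x ≟ c₀)) ⟩
          Σ (λ x → B (i y) * (B · φ) x + δ x c₀ * (- 1# * (B (i y) * (B · φ) x)))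
            ≡⟨ trans (Σ-+) (cong₂ _+_ (trans (Σ-*ˡ (B (i y))) (trans (cong (B (i y) *_) nBφ) (zeroʳ _)))
                 (Σ-δ (λ x → - 1# * (B (i y) * (B · φ) x)) c₀)) ⟩
          0# + - 1# * (B (i y) * (B c₀ * φ c₀))
            ≡⟨ trans (solve 3 (λ a b c → :0 :+ :- :1 :* (a :* (b :* c)) := :- :1 :* (a :* b :* c)) refl _ _ _)
                 (cong (λ b → - 1# * (b * φ c₀)) (trans (sym (χ-mul hB _ _)) (cong B
                   (linF₁ (-F i z) (i-r 1-z≢0) (solveF 3 (λ y u v → v ⊗ ⊝ (y ⊗ u) ⊕ ⊝ (⊝ u) ⊜ ⊝ u ⊗ (y ⊗ v ⊕ ⊝ 𝟙)) refl y (i z) (i y)))))) ⟩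
          - 1# * (B α₀ * φ c₀)  ∎
        special : row α₀ ≡ row′ α₀
        special = trans left (sym (trans (cong₂ (λ s d → s + d * extra) right (δ-≡ refl))
          (solve 2 (λ b q → :- :1 :* b :+ :1 :* (q :* b) := b :* q :+ :- :1 :* b) refl (B α₀ * φ c₀) qK)))

      T : K
      T = Σ (λ α → A α * roots α)

      P-product-T : P A B z * P B A z ≡ T + A α₀ * extra
      P-product-T = begin
        P A B z * P B A z                 ≡⟨ P-product ⟩
        Σ (λ α → Σ (λ a → t α a))         ≡⟨ Σ-cong (λ α → Σ-*ˡ (A α)) ⟩
        Σ (λ α → A α * Σ (λ a → B (arg α a) * φ (ξ α a)))
          ≡⟨ Σ-cong (λ α → trans (cong (A α *_) (row-α α ((1F +F α *F z) ≟ 0F)))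
               (solve 4 (λ a s d c → a :* (s :+ d :* c) := a :* s :+ d :* (a :* c)) refl _ _ _ _)) ⟩
        Σ (λ α → A α * roots α + δ α α₀ * (A α * extra))
          ≡⟨ trans (Σ-+) (cong (T +_) (Σ-δ (λ α → A α * extra) α₀)) ⟩
        T + A α₀ * extra   ∎

      X : F → F → F
      X α β = 1F +F α +F β +F α *F β *F (z *F z)

      ψ : F → F → F → K
      ψ α β γ = φ (X α β +F -F (2F *F (γ *F y)))

      dual : F → F → F → K
      dual α β γ = δ (γ *F γ) (α *F β) * ψ α β γ

      duals : F → F → K
      duals α γ = Σ (λ β → B β * dual α β γ)

      -- `E α β` is the quadratic of `root-duality` with n = αβ. Terms with αβ = 0 vanish on both
      -- sides, so the duality is used only for n ≠ 0.
      T-dual : T ≡ Σ (λ α → Σ (λ γ → A α * duals α γ))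
      T-dual = Σ-cong λ α → row α (α ≟ 0F)
        where
        column : ∀ α → ¬ (α ≡ 0F) → ∀ β → Dec (β ≡ 0F) →
                 Σ (λ x → φ x * (B β * δ (E α β x) 0F)) ≡ Σ (λ γ → B β * dual α β γ)
        column α α≢0 β (yes β≡0) = Σ-trivial
          where
          Σ-trivial : Σ (λ x → φ x * (B β * δ (E α β x) 0F)) ≡ Σ (λ γ → B β * dual α β γ)
          Σ-trivial = Σ-cong λ x → trans (cong (λ b → φ x * (b * δ (E α β x) 0F)) (χ-at-0 hB β≡0))
            (trans (solve 3 (λ f d e → f :* (:0 :* d) := :0 :* e) refl _ _ (dual α β x)) (cong (_* dual α β x) (sym (χ-at-0 hB β≡0))))
        column α α≢0 β (no β≢0) = begin
          Σ (λ x → φ x * (B β * δ (E α β x) 0F))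
            ≡⟨ trans (Σ-cong (λ x → solve 3 (λ f b d → f :* (b :* d) := b :* (d :* f)) refl _ _ _)) (Σ-*ˡ (B β)) ⟩
          B β * Σ (λ x → δ (E α β x) 0F * φ x)
            ≡⟨ cong (B β *_) (sym (root-duality (X α β) (α *F β) y (FP.*-≢0 α≢0 β≢0) 1-z≢0)) ⟩
          B β * Σ (λ γ → dual α β γ)
            ≡⟨ sym (Σ-*ˡ (B β)) ⟩
          Σ (λ γ → B β * dual α β γ)  ∎
        row : ∀ α → Dec (α ≡ 0F) → A α * roots α
              ≡ Σ (λ γ → A α * duals α γ)
        row α (yes α≡0) = trans (cong (_* roots α) (χ-at-0 hA α≡0))
          (trans (zeroˡ _) (sym (trans (Σ-cong (λ γ → trans (cong (_* duals α γ) (χ-at-0 hA α≡0)) (zeroˡ _))) (Σ-0))))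
        row α (no α≢0) = begin
          A α * roots α
            ≡⟨ cong (A α *_) (trans (Σ-cong (λ x → sym (Σ-*ˡ (φ x)))) (Σ-swap)) ⟩
          A α * Σ (λ β → Σ (λ x → φ x * (B β * δ (E α β x) 0F)))
            ≡⟨ cong (A α *_) (trans (Σ-cong (λ β → column α α≢0 β (β ≟ 0F))) (Σ-swap)) ⟩
          A α * Σ (λ γ → duals α γ)
            ≡⟨ sym (Σ-*ˡ (A α)) ⟩
          Σ (λ γ → A α * duals α γ)  ∎

    private
      D : F → K
      D = ratio A B

      f : F → F → K
      f = kernel A B z

      hC : IsCharacter (A · B)
      hC = ·-isCharacter hA hB

      -- This is X - 2γy at α = γρ, β = γ/ρ. Substituting y = 1 - z shows it, for ρ ≠ 0, as (1 +
      -- γz)² + γ(ρ - 1)²/ρ.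
      Y : F → F → F
      Y γ ρ = 1F +F γ *F ρ +F γ *F i ρ +F γ *F γ *F (z *F z) +F -F (2F *F (γ *F y))

      -- The square root γ of αβ and the ratio ρ = α/γ replace (α, β).
      parametrise : ∀ γ → Dec (γ ≡ 0F) → Σ (λ α → A α * duals α γ) ≡ (A · B) γ * Σ (λ ρ → D ρ * φ (Y γ ρ))
      parametrise γ γ-dec = trans (Σ-cong (λ α → solve-β α (α ≟ 0F))) (scale-α γ-dec)
        where
        solve-β : ∀ α → Dec (α ≡ 0F) → A α * duals α γ
                  ≡ A α * (B (γ *F γ *F i α) * ψ α (γ *F γ *F i α) γ)
        solve-β α (yes α≡0) = trans (cong (_* duals α γ) (χ-at-0 hA α≡0))
          (trans (solve 2 (λ a b → :0 :* a := :0 :* b) refl _ (B (γ *F γ *F i α) * ψ α (γ *F γ *F i α) γ))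
            (cong (_* (B (γ *F γ *F i α) * ψ α (γ *F γ *F i α) γ)) (sym (χ-at-0 hA α≡0))))
        solve-β α (no α≢0) = cong (A α *_) (trans
          (Σ-cong (λ β → trans (solve 3 (λ b d f → b :* (d :* f) := d :* (b :* f)) refl _ _ _)
            (cong (_* (B β * ψ α β γ)) (δ-⇔ (to β) (from β)))))
          (Σ-δ (λ β → B β * ψ α β γ) (γ *F γ *F i α)))
          where
          to : ∀ β → γ *F γ ≡ α *F β → β ≡ γ *F γ *F i α
          to β e = linF₂ (-F i α) (-F β) e (i-r α≢0) (solveF 4 (λ a u b g → b ⊕ ⊝ (g ⊗ u) ⊜ ⊝ u ⊗ (g ⊕ ⊝ (a ⊗ b)) ⊕ ⊝ b ⊗ (a ⊗ u ⊕ ⊝ 𝟙)) refl α (i α) β (γ *F γ))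
          from : ∀ β → β ≡ γ *F γ *F i α → γ *F γ ≡ α *F β
          from β refl = linF₁ (-F (γ *F γ)) (i-r α≢0) (solveF 3 (λ a u g → g ⊕ ⊝ (a ⊗ (g ⊗ u)) ⊜ ⊝ g ⊗ (a ⊗ u ⊕ ⊝ 𝟙)) refl α (i α) (γ *F γ))
        scale-α : Dec (γ ≡ 0F) → Σ (λ α → A α * (B (γ *F γ *F i α) * ψ α (γ *F γ *F i α) γ))
                  ≡ (A · B) γ * Σ (λ ρ → D ρ * φ (Y γ ρ))
        scale-α (yes γ≡0) = trans
          (trans (Σ-cong (λ α → trans (cong (λ b → A α * (b * ψ α (γ *F γ *F i α) γ))
            (χ-at-0 hB (trans (cong (λ s → s *F γ *F i α) γ≡0) (solveF 2 (λ a b → 𝟘 ⊗ a ⊗ b ⊜ 𝟘) refl γ (i α)))))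
            (solve 2 (λ a b → a :* (:0 :* b) := :0) refl _ _))) (Σ-0))
          (sym (trans (cong (_* Σ (λ ρ → D ρ * φ (Y γ ρ))) (χ-at-0 hC γ≡0)) (zeroˡ _)))
        scale-α (no γ≢0) = begin
          Σ (λ α → A α * (B (γ *F γ *F i α) * ψ α (γ *F γ *F i α) γ))
            ≡⟨ sym (Σ-scale _ γ≢0) ⟩
          Σ (λ ρ → A (γ *F ρ) * (B (γ *F γ *F i (γ *F ρ)) * φ (X (γ *F ρ) (γ *F γ *F i (γ *F ρ)) +F -F (2F *F (γ *F y)))))
            ≡⟨ Σ-cong (λ ρ → value ρ (ρ ≟ 0F)) ⟩
          Σ (λ ρ → (A · B) γ * (D ρ * φ (Y γ ρ)))
            ≡⟨ Σ-*ˡ ((A · B) γ) ⟩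
          (A · B) γ * Σ (λ ρ → D ρ * φ (Y γ ρ))  ∎
          where
          β≡ : ∀ ρ → γ *F γ *F i (γ *F ρ) ≡ γ *F i ρ
          β≡ ρ = trans (cong (γ *F γ *F_) (i-* γ ρ)) (linF₁ (γ *F i ρ) (i-r γ≢0)
            (solveF 3 (λ g u r → g ⊗ g ⊗ (u ⊗ r) ⊕ ⊝ (g ⊗ r) ⊜ g ⊗ r ⊗ (g ⊗ u ⊕ ⊝ 𝟙)) refl γ (i γ) (i ρ)))
          value : ∀ ρ → Dec (ρ ≡ 0F) →
            A (γ *F ρ) * (B (γ *F γ *F i (γ *F ρ)) * φ (X (γ *F ρ) (γ *F γ *F i (γ *F ρ)) +F -F (2F *F (γ *F y))))
            ≡ (A · B) γ * (D ρ * φ (Y γ ρ))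
          value ρ (yes ρ≡0) = trans
            (cong₂ _*_ (trans (χ-mul hA γ ρ) (cong (A γ *_) (χ-at-0 hA ρ≡0))) refl)
            (trans (solve 5 (λ a w b c d → a :* :0 :* w := a :* b :* (:0 :* c :* d)) refl _ _ (B γ) (B (i ρ)) (φ (Y γ ρ)))
              (cong (λ s → (A · B) γ * (s * B (i ρ) * φ (Y γ ρ))) (sym (χ-at-0 hA ρ≡0))))
          value ρ (no ρ≢0) = begin
            A (γ *F ρ) * (B (γ *F γ *F i (γ *F ρ)) * φ (X (γ *F ρ) (γ *F γ *F i (γ *F ρ)) +F -F (2F *F (γ *F y))))
              ≡⟨ cong (λ β → A (γ *F ρ) * (B β * φ (X (γ *F ρ) β +F -F (2F *F (γ *F y))))) (β≡ ρ) ⟩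
            A (γ *F ρ) * (B (γ *F i ρ) * φ (X (γ *F ρ) (γ *F i ρ) +F -F (2F *F (γ *F y))))
              ≡⟨ cong₂ _*_ (χ-mul hA γ ρ) (cong₂ _*_ (χ-mul hB γ (i ρ)) (cong φ (linF₁ (γ *F γ *F (z *F z)) (i-r ρ≢0)
                   (solveF 5 (λ g r u z y →
                     𝟙 ⊕ g ⊗ r ⊕ g ⊗ u ⊕ g ⊗ r ⊗ (g ⊗ u) ⊗ (z ⊗ z) ⊕ ⊝ ((𝟙 ⊕ 𝟙) ⊗ (g ⊗ y))
                     ⊕ ⊝ (𝟙 ⊕ g ⊗ r ⊕ g ⊗ u ⊕ g ⊗ g ⊗ (z ⊗ z) ⊕ ⊝ ((𝟙 ⊕ 𝟙) ⊗ (g ⊗ y)))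
                     ⊜ g ⊗ g ⊗ (z ⊗ z) ⊗ (r ⊗ u ⊕ ⊝ 𝟙)) refl γ ρ (i ρ) z y)))) ⟩
            A γ * A ρ * (B γ * B (i ρ) * φ (Y γ ρ))
              ≡⟨ solve 5 (λ a r b s f → a :* r :* (b :* s :* f) := a :* b :* (r :* s :* f)) refl _ _ _ _ _ ⟩
            (A · B) γ * (D ρ * φ (Y γ ρ))  ∎

      T≡U : T ≡ U A B z
      T≡U = begin
        T                                                                 ≡⟨ T-dual ⟩
        Σ (λ α → Σ (λ γ → A α * duals α γ))              ≡⟨ Σ-swap ⟩
        Σ (λ γ → Σ (λ α → A α * duals α γ))              ≡⟨ Σ-cong (λ γ → parametrise γ (γ ≟ 0F)) ⟩
        Σ (λ γ → (A · B) γ * Σ (λ ρ → D ρ * φ (Y γ ρ)))                   ≡⟨ sym (Σ-scale _ (neg-≢0 (i-≢0 z≢0))) ⟩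
        Σ (λ κ → (A · B) (α₀ *F κ) * Σ (λ ρ → D ρ * φ (Y (α₀ *F κ) ρ)))
          ≡⟨ Σ-cong (λ κ → trans (cong₂ _*_ (χ-mul hC α₀ κ) (Σ-cong (λ ρ → value κ ρ (ρ ≟ 0F)))) (*-assoc _ _ _)) ⟩
        Σ (λ κ → (A · B) α₀ * ((A · B) κ * Σ (f κ)))                      ≡⟨ Σ-*ˡ ((A · B) α₀) ⟩
        U A B z                                                           ∎
        where
        value : ∀ κ ρ → Dec (ρ ≡ 0F) → D ρ * φ (Y (α₀ *F κ) ρ) ≡ f κ ρ
        value κ ρ (yes ρ≡0) = trans (cong (λ a → a * B (i ρ) * φ (Y (α₀ *F κ) ρ)) (χ-at-0 hA ρ≡0))
          (trans (solve 3 (λ b c d → :0 :* b :* c := :0 :* b :* d) refl _ _ _) (cong (λ a → a * B (i ρ) * φ _) (sym (χ-at-0 hA ρ≡0))))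
        value κ ρ (no ρ≢0) = cong (λ s → D ρ * φ s) (trans
          (linF₂ (κ *F κ *F (1F +F z *F i z) +F κ *F (-F (1F +F 1F))) (κ *F i z *F (-F (1F +F 1F) +F ρ)) (i-r z≢0) (i-r ρ≢0)
            (solveF 5 (λ k r v z u →
              𝟙 ⊕ ⊝ u ⊗ k ⊗ r ⊕ ⊝ u ⊗ k ⊗ v ⊕ ⊝ u ⊗ k ⊗ (⊝ u ⊗ k) ⊗ (z ⊗ z) ⊕ ⊝ ((𝟙 ⊕ 𝟙) ⊗ (⊝ u ⊗ k ⊗ (𝟙 ⊕ ⊝ z)))
              ⊕ ⊝ ((k ⊕ ⊝ 𝟙) ⊗ (k ⊕ ⊝ 𝟙) ⊕ ⊝ (k ⊗ ((r ⊕ ⊝ 𝟙) ⊗ (r ⊕ ⊝ 𝟙)) ⊗ (u ⊗ v)))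
              ⊜ (k ⊗ k ⊗ (𝟙 ⊕ z ⊗ u) ⊕ k ⊗ ⊝ (𝟙 ⊕ 𝟙)) ⊗ (z ⊗ u ⊕ ⊝ 𝟙) ⊕ k ⊗ u ⊗ (⊝ (𝟙 ⊕ 𝟙) ⊕ r) ⊗ (r ⊗ v ⊕ ⊝ 𝟙))
              refl κ ρ (i ρ) z (i z)))
          (cong (λ s → (κ +F -F 1F) *F (κ +F -F 1F) +F -F (κ *F ((ρ +F -F 1F) *F (ρ +F -F 1F)) *F s)) (sym (i-* z ρ))))

    P-product-formula : P A B z * P B A z ≡ U A B z + (A · B) (-F i z) * (qK * φ (-F ((1F +F -F z) *F i z)))
    P-product-formula = trans P-product-T (cong₂ _+_ T≡U (solve 4 (λ a q b f → a :* (q :* (b :* f)) := a :* b :* (q :* f)) refl _ _ _ _))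

  -- The double sum of the ₃F₂

  -- A Jacobi sum: with t = a / (1 + a) the two factors at 1 + a form a square, leaving φ(a) for a ≠
  -- -1. The result is Σ φ without its term at -1.
  Σ-φφ : Σ (λ t → φ t * φ (1F +F -F t)) ≡ - φ (-F 1F)
  Σ-φφ = begin
    Σ (λ t → φ t * φ (1F +F -F t))
      ≡⟨ fraction (trans (cong (φ 1F *_) (χ-at-0 φ-isCharacter (FP.-‿inverseʳ 1F))) (zeroʳ _)) at-minus-1 value ⟩
    Σ (λ a → φ a + δ a (-F 1F) * - φ a)
      ≡⟨ trans (Σ-+) (cong₂ _+_ φ-nontrivial (Σ-δ (λ a → - φ a) (-F 1F))) ⟩
    0# + - φ (-F 1F)
      ≡⟨ +-identityˡ _ ⟩
    - φ (-F 1F)  ∎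
    where
    at-minus-1 : φ (-F 1F) + δ (-F 1F) (-F 1F) * - φ (-F 1F) ≡ 0#
    at-minus-1 = trans (cong (λ d → φ (-F 1F) + d * - φ (-F 1F)) (δ-≡ refl)) (solve 1 (λ f → f :+ :1 :* :- f := :0) refl _)
    value : ∀ a → ¬ (1F +F a ≡ 0F) → φ a + δ a (-F 1F) * - φ a ≡ φ (a *F i (1F +F a)) * φ (1F +F -F (a *F i (1F +F a)))
    value a ne = trans
      (trans (cong (λ d → φ a + d * - φ a) (δ-≢ λ { refl → ne (FP.-‿inverseʳ 1F) })) (solve 1 (λ f → f :+ :0 :* :- f := f) refl _))
      (sym (trans (cong₂ _*_ (φ-mul _ _) (cong φ (1-fraction ne)))
        (lin₁ (φ a) (φ²≡1 (i-≢0 ne)) (solve 2 (λ f u → f :* u :* u :+ :- f := f :* (u :* u :+ :- :1)) refl _ _))))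

  -- Replacing r² by u introduces the weight 1 + φ(u). The weight 1 leaves φ of an affine bijection,
  -- which sums to 0; for the weight φ(u), the scaling u = zt leads to `Σ-φφ`.
  Σ-φ-quadratic : ∀ {z} → ¬ (z ≡ 0F) → Σ (λ r → φ (1F +F -F (r *F r *F i z))) ≡ - φ (-F z)
  Σ-φ-quadratic {z} z≢0 = begin
    Σ (λ r → ψ (r *F r))
      ≡⟨ Σ-cong (λ r → sym (Σ-δ ψ (r *F r))) ⟩
    Σ (λ r → Σ (λ u → δ u (r *F r) * ψ u))
      ≡⟨ Σ-swap ⟩
    Σ (λ u → Σ (λ r → δ u (r *F r) * ψ u))
      ≡⟨ Σ-cong (λ u → trans (Σ-*ʳ (ψ u)) (trans (cong (_* ψ u) (trans (Σ-cong (λ r → δ-sym _ _)) (count-square-roots u)))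
           (solve 2 (λ f p → (:1 :+ f) :* p := p :+ f :* p) refl _ _))) ⟩
    Σ (λ u → ψ u + φ u * ψ u)
      ≡⟨ trans (Σ-+) (trans (cong (_+ Σ (λ u → φ u * ψ u)) affine) (+-identityˡ _)) ⟩
    Σ (λ u → φ u * ψ u)
      ≡⟨ sym (Σ-scale _ z≢0) ⟩
    Σ (λ t → φ (z *F t) * ψ (z *F t))
      ≡⟨ Σ-cong (λ t → trans (cong₂ _*_ (φ-mul z t) (cong φ (linF₁ (-F t) (i-r z≢0) (solveF 3 (λ z u t →
           𝟙 ⊕ ⊝ (z ⊗ t ⊗ u) ⊕ ⊝ (𝟙 ⊕ ⊝ t) ⊜ ⊝ t ⊗ (z ⊗ u ⊕ ⊝ 𝟙)) refl z (i z) t)))) (*-assoc _ _ _)) ⟩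
    Σ (λ t → φ z * (φ t * φ (1F +F -F t)))
      ≡⟨ trans (Σ-*ˡ (φ z)) (cong (φ z *_) Σ-φφ) ⟩
    φ z * - φ (-F 1F)
      ≡⟨ trans (solve 2 (λ a b → a :* :- b := :- (b :* a)) refl _ _)
           (cong -_ (trans (sym (φ-mul _ _)) (cong φ (solveF 1 (λ z → (⊝ 𝟙) ⊗ z ⊜ ⊝ z) refl z)))) ⟩
    - φ (-F z)  ∎
    where
    ψ : F → K
    ψ u = φ (1F +F -F (u *F i z))
    affine : Σ ψ ≡ 0#
    affine = trans (reindex-↔ φ (λ u → 1F +F -F (u *F i z)) (λ x → (1F +F -F x) *F z)
      (λ u → linF₁ u (i-r z≢0) (solveF 3 (λ z t u → (𝟙 ⊕ ⊝ (𝟙 ⊕ ⊝ (u ⊗ t))) ⊗ z ⊕ ⊝ u ⊜ u ⊗ (z ⊗ t ⊕ ⊝ 𝟙)) refl z (i z) u))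
      (λ x → linF₁ (x +F -F 1F) (i-r z≢0) (solveF 3 (λ z t x → 𝟙 ⊕ ⊝ ((𝟙 ⊕ ⊝ x) ⊗ z ⊗ t) ⊕ ⊝ x ⊜ (x ⊕ ⊝ 𝟙) ⊗ (z ⊗ t ⊕ ⊝ 𝟙)) refl z (i z) x)))
      φ-nontrivial

  module _ {A B : Char} (hA : IsCharacter A) (hB : IsCharacter B)
           (nA² : Nontrivial (A · A)) (nC : Nontrivial (A · B)) (nDφ : Σ (λ ρ → ratio A B ρ * φ ρ) ≡ 0#)
           {z : F} (z≢0 : ¬ (z ≡ 0F)) where

    private
      A² B² C : Char
      A² = A · A
      B² = B · B
      C = A · B

      c₀ φ₁ : K
      c₀ = C (-F i z)
      φ₁ = φ (1F +F -F i z)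

      hA² : IsCharacter A²
      hA² = ·-isCharacter hA hA
      hB² : IsCharacter B²
      hB² = ·-isCharacter hB hB
      hC : IsCharacter C
      hC = ·-isCharacter hA hB

      D : F → K
      D = ratio A B

      f : F → F → K
      f = kernel A B z

      c : F → F → F
      c a b = i (b *F (a *F -F z))

      W H : F → F → K
      W a b = C (c a b) * φ (1F +F c a b)
      H a b = A² a * A² (i (1F +F a)) * (B² b * A² (1F +F b) * W a b)

      -- The coordinate κ = (1 + b) / (1 + a), solved for b. It is natural because A² is evaluated
      -- at 1 + b and at 1 / (1 + a), hence at κ.
      β : F → F → F
      β κ a = κ *F (1F +F a) +F -F 1F

      H-0 : ∀ {a} b → a ≡ 0F → H a b ≡ 0#
      H-0 {a} b e = trans (cong (λ s → s * A² (i (1F +F a)) * (B² b * A² (1F +F b) * W a b)) (χ-at-0 hA² e))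
        (solve 2 (λ a b → :0 :* a :* b := :0) refl _ _)

      H-minus-1 : ∀ {a} b → 1F +F a ≡ 0F → H a b ≡ 0#
      H-minus-1 {a} b e = trans (cong (λ s → A² a * s * (B² b * A² (1F +F b) * W a b)) (χ-at-i0 hA² e))
        (solve 2 (λ a b → a :* :0 :* b := :0) refl _ _)

      H-b-0 : ∀ a {b} → b ≡ 0F → H a b ≡ 0#
      H-b-0 a {b} e = trans (cong (λ s → A² a * A² (i (1F +F a)) * (s * A² (1F +F b) * W a b)) (χ-at-0 hB² e))
        (solve 4 (λ a b c d → a :* b :* (:0 :* c :* d) := :0) refl _ _ _ _)

      H-b-minus-1 : ∀ a {b} → 1F +F b ≡ 0F → H a b ≡ 0#
      H-b-minus-1 a {b} e = trans (cong (λ s → A² a * A² (i (1F +F a)) * (B² b * s * W a b)) (χ-at-0 hA² e))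
        (solve 4 (λ a b c d → a :* b :* (c :* :0 :* d) := :0) refl _ _ _ _)

      substitute : ∀ a → Dec (1F +F a ≡ 0F) → Σ (H a) ≡ Σ (λ κ → H a (β κ a))
      substitute a (yes e) = Σ-cong λ b → trans (H-minus-1 b e) (sym (H-minus-1 (β b a) e))
      substitute a (no ne) = sym (reindex-↔ (H a) (λ κ → β κ a) (λ b → (1F +F b) *F i (1F +F a))
        (λ κ → linF₁ κ (i-r ne) (solveF 3 (λ k a u → (𝟙 ⊕ (k ⊗ (𝟙 ⊕ a) ⊕ ⊝ 𝟙)) ⊗ u ⊕ ⊝ k ⊜ k ⊗ ((𝟙 ⊕ a) ⊗ u ⊕ ⊝ 𝟙)) refl κ a (i (1F +F a))))
        (λ b → linF₁ (1F +F b) (i-r ne) (solveF 3 (λ b a u → (𝟙 ⊕ b) ⊗ u ⊗ (𝟙 ⊕ a) ⊕ ⊝ 𝟙 ⊕ ⊝ b ⊜ (𝟙 ⊕ b) ⊗ ((𝟙 ⊕ a) ⊗ u ⊕ ⊝ 𝟙)) refl b a (i (1F +F a)))))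

      c-expand : ∀ a b → c a b ≡ i b *F (i a *F -F i z)
      c-expand a b = trans (i-* _ _) (cong (i b *F_) (trans (i-* _ _) (cong (i a *F_) (i-neg z))))

      -- With b for `β κ a`, the factors of A combine to A(κ)² A(a/b) and those of B to B(b/a),
      -- apart from the constant at -1/z. Splitting off AB(κ) leaves D at κa/b, which dictates the
      -- variable ρ = κa/b.
      summand : ∀ {κ a} → ¬ (κ ≡ 0F) → ¬ (a ≡ 0F) → ¬ (1F +F a ≡ 0F) → ¬ (β κ a ≡ 0F) →
                H a (β κ a) ≡ c₀ * (C κ * (D (κ *F a *F i (β κ a)) * φ (1F +F c a (β κ a))))
      summand {κ} {a} κ≢0 a≢0 1+a≢0 b≢0 = begin
        H a b
          ≡⟨ cong₂ (λ s t → A² a * A² (i (1F +F a)) * (B² b * (s * s) * (t * φ (1F +F c a b))))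
               (trans (cong A (solveF 2 (λ k w → 𝟙 ⊕ (k ⊗ w ⊕ ⊝ 𝟙) ⊜ k ⊗ w) refl κ (1F +F a))) (χ-mul hA κ (1F +F a)))
               (cong₂ _*_ (expand-c hA) (expand-c hB)) ⟩
        A² a * A² (i (1F +F a)) * (B² b * (A κ * A (1F +F a) * (A κ * A (1F +F a)))
          * (A (i b) * (A (i a) * A (-F i z)) * (B (i b) * (B (i a) * B (-F i z))) * φ (1F +F c a b)))
          ≡⟨ solve 13 (λ aa a₁ a₁′ bb ak aib aia az bib bia bz f t →
               aa :* aa :* (a₁′ :* a₁′) :* (bb :* bb :* (ak :* a₁ :* (ak :* a₁)) :* (aib :* (aia :* az) :* (bib :* (bia :* bz)) :* f))
               := (a₁ :* a₁′) :* (a₁ :* a₁′) :* ((aa :* aia) :* (bb :* bib)) :* (az :* bz :* (ak :* ak :* aa :* aib :* (bia :* bb) :* f)))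
               refl (A a) (A (1F +F a)) (A (i (1F +F a))) (B b) (A κ) (A (i b)) (A (i a)) (A (-F i z)) (B (i b)) (B (i a)) (B (-F i z)) (φ (1F +F c a b)) 0# ⟩
        (A (1F +F a) * A (i (1F +F a))) * (A (1F +F a) * A (i (1F +F a))) * ((A a * A (i a)) * (B b * B (i b))) * R
          ≡⟨ trans (cong (_* R) (cong₂ _*_ (cong₂ _*_ (χ-i hA 1+a≢0) (χ-i hA 1+a≢0)) (cong₂ _*_ (χ-i hA a≢0) (χ-i hB b≢0))))
               (trans (solve 1 (λ r → :1 :* :1 :* (:1 :* :1) :* r := :1 :* r) refl _) (cong (_* R) (sym (χ-i hB κ≢0)))) ⟩
        (B κ * B (i κ)) * R
          ≡⟨ solve 10 (λ az bz ak bk bik aa aib bia bb f → (bk :* bik) :* (az :* bz :* (ak :* ak :* aa :* aib :* (bia :* bb) :* f))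
               := az :* bz :* (ak :* bk :* (ak :* aa :* aib :* (bik :* bia :* bb) :* f)))
               refl (A (-F i z)) (B (-F i z)) (A κ) (B κ) (B (i κ)) (A a) (A (i b)) (B (i a)) (B b) (φ (1F +F c a b)) ⟩
        c₀ * (C κ * (A κ * A a * A (i b) * (B (i κ) * B (i a) * B b) * φ (1F +F c a b)))
          ≡⟨ cong (λ d → c₀ * (C κ * (d * φ (1F +F c a b)))) (sym (cong₂ _*_
               (trans (χ-mul hA _ _) (cong (_* A (i b)) (χ-mul hA _ _)))
               (trans (cong B (trans (i-* _ _) (cong₂ _*F_ (i-* κ a) (i-involutive b)))) (trans (χ-mul hB _ _) (cong (_* B b) (χ-mul hB _ _)))))) ⟩
        c₀ * (C κ * (D (κ *F a *F i b) * φ (1F +F c a b)))  ∎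
        where
        b : F
        b = β κ a
        R : K
        R = A (-F i z) * B (-F i z) * (A κ * A κ * A a * A (i b) * (B (i a) * B b) * φ (1F +F c a b))
        expand-c : ∀ {χ} → IsCharacter χ → χ (c a b) ≡ χ (i b) * (χ (i a) * χ (-F i z))
        expand-c {χ} h = trans (cong χ (c-expand a b)) (trans (χ-mul h _ _) (cong (χ (i b) *_) (χ-mul h _ _)))

      -- For κ ≠ 0, 1 the map a ↦ ρ = κa/β is a bijection onto the ρ ∉ {0, 1, κ}; the two missing
      -- values give the correction terms, which also turn out to be right for κ = 0 and κ = 1.
      target : F → K
      target κ = c₀ * (C κ * Σ (f κ) + (- C κ + - (A² κ * φ₁)))

      row-0 : Σ (λ a → H a (β 0F a)) ≡ target 0F
      row-0 = trans (trans (Σ-cong (λ a → H-b-minus-1 a (solveF 1 (λ a → 𝟙 ⊕ (𝟘 ⊗ (𝟙 ⊕ a) ⊕ ⊝ 𝟙) ⊜ 𝟘) refl a))) (Σ-0))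
        (sym (trans (cong₂ (λ s t → c₀ * (s * Σ (f 0F) + (- s + - (t * φ₁)))) (χ-0 hC) (χ-0 hA²))
          (solve 3 (λ c s p → c :* (:0 :* s :+ (:- :0 :+ :- (:0 :* p))) := :0) refl _ _ _)))

      -- At κ = 1 one has β = a and ρ is constantly 1, so the change of variable collapses. The row
      -- is instead a sum of φ(1 - r²/z) over r = 1/a without r = 0 and r = -1. Its total agrees
      -- with the target because Σ (f 1) is also -φ(-z): there Dφ sums to 0, and only the missing
      -- term ρ = 1 counts.
      row-1 : Σ (λ a → H a (β 1F a)) ≡ target 1F
      row-1 = begin
        Σ (λ a → H a (β 1F a))             ≡⟨ Σ-cong (λ a → value a (a ≟ 0F) ((1F +F a) ≟ 0F)) ⟩
        Σ (λ a → c₀ * G (i a))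
          ≡⟨ trans (Σ-*ˡ (c₀)) (cong (c₀ *_) (reindex-↔ G i i i-involutive i-involutive)) ⟩
        c₀ * Σ G             ≡⟨ cong (c₀ *_) Σ-G ⟩
        c₀ * (- φ (-F z) + (- 1# + - φ₁))
          ≡⟨ cong (c₀ *_) (sym (trans (cong₂ (λ s t → s * Σ (f 1F) + (- s + - (t * φ₁))) (χ-1 hC) (χ-1 hA²))
               (trans (cong (λ s → 1# * s + (- 1# + - (1# * φ₁))) Σ-f-1)
                 (solve 2 (λ s p → :1 :* s :+ (:- :1 :+ :- (:1 :* p)) := s :+ (:- :1 :+ :- p)) refl _ _)))) ⟩
        target 1F                          ∎
        where
        ψ G : F → K
        ψ r = φ (1F +F -F (r *F r *F i z))
        G r = ψ r + (δ r 0F * - ψ r + δ r (-F 1F) * - ψ r)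
        -1≢0 : ¬ (-F 1F ≡ 0F)
        -1≢0 = neg-≢0 1≢0
        Σ-G : Σ G ≡ - φ (-F z) + (- 1# + - φ₁)
        Σ-G = trans (Σ-+) (cong₂ _+_ (Σ-φ-quadratic z≢0) (trans (Σ-+) (cong₂ _+_
          (trans (Σ-δ (λ r → - ψ r) 0F) (cong -_ (trans (cong φ (solveF 1 (λ u → 𝟙 ⊕ ⊝ (𝟘 ⊗ 𝟘 ⊗ u) ⊜ 𝟙) refl (i z))) (χ-1 φ-isCharacter))))
          (trans (Σ-δ (λ r → - ψ r) (-F 1F)) (cong (λ s → - φ s) (solveF 1 (λ u → 𝟙 ⊕ ⊝ (⊝ 𝟙 ⊗ ⊝ 𝟙 ⊗ u) ⊜ 𝟙 ⊕ ⊝ u) refl (i z)))))))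
        zero-at : ∀ {r d e} → d ≡ 1# → e ≡ 0# → ψ r + (d * - ψ r + e * - ψ r) ≡ 0#
        zero-at {r} refl refl = solve 1 (λ p → p :+ (:1 :* :- p :+ :0 :* :- p) := :0) refl (ψ r)
        G-0 : ∀ {r} → r ≡ 0F → G r ≡ 0#
        G-0 {r} e = zero-at {r} (δ-≡ e) (δ-≢ λ e′ → -1≢0 (trans (sym e′) e))
        G-minus-1 : ∀ {r} → r ≡ -F 1F → G r ≡ 0#
        G-minus-1 {r} e = trans (cong (ψ r +_) (+-comm _ _)) (zero-at {r} (δ-≡ e) (δ-≢ λ e′ → -1≢0 (trans (sym e) e′)))
        value : ∀ a → Dec (a ≡ 0F) → Dec (1F +F a ≡ 0F) → H a (β 1F a) ≡ c₀ * G (i a)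
        value a (yes e) _ = trans (H-0 (β 1F a) e) (sym (trans (cong (c₀ *_) (G-0 (i-≡0 e))) (zeroʳ _)))
        value a (no _) (yes e) = trans (H-minus-1 (β 1F a) e) (sym (trans (cong (c₀ *_) (G-minus-1
          (i-unique (linF₁ (-F 1F) e (solveF 1 (λ a → a ⊗ ⊝ 𝟙 ⊕ ⊝ 𝟙 ⊜ ⊝ 𝟙 ⊗ (𝟙 ⊕ a ⊕ ⊝ 𝟘)) refl a))))) (zeroʳ _)))
        value a (no a≢0) (no 1+a≢0) = trans (summand 1≢0 a≢0 1+a≢0 (λ e → a≢0 (trans (sym β≡a) e)))
          (cong (c₀ *_) (begin
            C 1F * (D (1F *F a *F i (β 1F a)) * φ (1F +F c a (β 1F a)))
              ≡⟨ cong₂ _*_ (χ-1 hC) (cong₂ _*_ D≡1 (cong φ c≡)) ⟩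
            1# * (1# * ψ (i a))
              ≡⟨ solve 1 (λ p → :1 :* (:1 :* p) := p :+ (:0 :* :- p :+ :0 :* :- p)) refl _ ⟩
            ψ (i a) + (0# * - ψ (i a) + 0# * - ψ (i a))
              ≡⟨ cong₂ (λ d e → ψ (i a) + (d * - ψ (i a) + e * - ψ (i a))) (sym (δ-≢ (i-≢0 a≢0))) (sym (δ-≢ ia≢-1)) ⟩
            G (i a)  ∎))
          where
          β≡a : β 1F a ≡ a
          β≡a = solveF 1 (λ a → 𝟙 ⊗ (𝟙 ⊕ a) ⊕ ⊝ 𝟙 ⊜ a) refl a
          D≡1 : D (1F *F a *F i (β 1F a)) ≡ 1#
          D≡1 = trans (cong D (trans (cong₂ (λ s t → s *F i t) (FP.*-identityˡ a) β≡a) (i-r a≢0)))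
            (trans (cong₂ _*_ (χ-1 hA) (trans (cong B (i-unique (FP.*-identityˡ 1F))) (χ-1 hB))) (*-identityˡ 1#))
          c≡ : 1F +F c a (β 1F a) ≡ 1F +F -F (i a *F i a *F i z)
          c≡ = cong (1F +F_) (trans (trans (cong (c a) β≡a) (c-expand a a)) (solveF 2 (λ u v → u ⊗ (u ⊗ ⊝ v) ⊜ ⊝ (u ⊗ u ⊗ v)) refl (i a) (i z)))
          ia≢-1 : ¬ (i a ≡ -F 1F)
          ia≢-1 e = 1+a≢0 (linF₂ (-F 1F) a (i-r a≢0) e (solveF 2 (λ a u → 𝟙 ⊕ a ⊕ ⊝ 𝟘 ⊜ ⊝ 𝟙 ⊗ (a ⊗ u ⊕ ⊝ 𝟙) ⊕ a ⊗ (u ⊕ ⊝ (⊝ 𝟙))) refl a (i a)))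
        Σ-f-1 : Σ (f 1F) ≡ - φ (-F z)
        Σ-f-1 = begin
          Σ (f 1F)
            ≡⟨ Σ-cong (λ ρ → f-value ρ (ρ ≟ 1F)) ⟩
          Σ (λ ρ → φ (-F z) * (D ρ * φ ρ) + δ ρ 1F * - (φ (-F z) * (D ρ * φ ρ)))
            ≡⟨ trans (Σ-+) (cong₂ _+_ (trans (Σ-*ˡ (φ (-F z))) (trans (cong (φ (-F z) *_) nDφ) (zeroʳ _)))
                 (Σ-δ (λ ρ → - (φ (-F z) * (D ρ * φ ρ))) 1F)) ⟩
          0# + - (φ (-F z) * (D 1F * φ 1F))
            ≡⟨ trans (cong₂ (λ s t → 0# + - (φ (-F z) * (s * t)))
                 (trans (cong₂ _*_ (χ-1 hA) (trans (cong B (i-unique (FP.*-identityˡ 1F))) (χ-1 hB))) (*-identityˡ 1#)) (χ-1 φ-isCharacter))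
                 (solve 1 (λ p → :0 :+ :- (p :* (:1 :* :1)) := :- p) refl _) ⟩
          - φ (-F z)  ∎
          where
          f-value : ∀ ρ → Dec (ρ ≡ 1F) → f 1F ρ ≡ φ (-F z) * (D ρ * φ ρ) + δ ρ 1F * - (φ (-F z) * (D ρ * φ ρ))
          f-value ρ (yes e) = trans
            (cong (D ρ *_) (χ-at-0 φ-isCharacter (trans (cong (λ s → (1F +F -F 1F) *F (1F +F -F 1F) +F -F (1F *F ((s +F -F 1F) *F (s +F -F 1F)) *F i (z *F ρ))) e)
              (solveF 1 (λ t → (𝟙 ⊕ ⊝ 𝟙) ⊗ (𝟙 ⊕ ⊝ 𝟙) ⊕ ⊝ (𝟙 ⊗ ((𝟙 ⊕ ⊝ 𝟙) ⊗ (𝟙 ⊕ ⊝ 𝟙)) ⊗ t) ⊜ 𝟘) refl (i (z *F ρ))))))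
            (trans (solve 2 (λ d p → d :* :0 := p :+ :1 :* :- p) refl _ (φ (-F z) * (D ρ * φ ρ)))
              (cong (λ d → φ (-F z) * (D ρ * φ ρ) + d * - (φ (-F z) * (D ρ * φ ρ))) (sym (δ-≡ e))))
          f-value ρ (no ρ≢1) = trans
            (cong (D ρ *_) (begin
              φ ((1F +F -F 1F) *F (1F +F -F 1F) +F -F (1F *F ((ρ +F -F 1F) *F (ρ +F -F 1F)) *F i (z *F ρ)))
                ≡⟨ cong φ (trans (solveF 2 (λ s t → (𝟙 ⊕ ⊝ 𝟙) ⊗ (𝟙 ⊕ ⊝ 𝟙) ⊕ ⊝ (𝟙 ⊗ s ⊗ t) ⊜ s ⊗ ⊝ t) refl _ _) (cong ((ρ +F -F 1F) *F (ρ +F -F 1F) *F_) (sym (i-neg _)))) ⟩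
              φ ((ρ +F -F 1F) *F (ρ +F -F 1F) *F i (-F (z *F ρ)))
                ≡⟨ trans (φ-mul _ _) (trans (cong₂ _*_ (φ-sq (FP.diff-≢0 ρ≢1)) (φ-i _)) (*-identityˡ _)) ⟩
              φ (-F (z *F ρ))
                ≡⟨ trans (cong φ (solveF 2 (λ z r → ⊝ (z ⊗ r) ⊜ ⊝ z ⊗ r) refl z ρ)) (φ-mul _ _) ⟩
              φ (-F z) * φ ρ  ∎))
            (trans (solve 3 (λ d z r → d :* (z :* r) := z :* (d :* r) :+ :0 :* :- (z :* (d :* r))) refl _ _ _)
              (cong (λ d → φ (-F z) * (D ρ * φ ρ) + d * - (φ (-F z) * (D ρ * φ ρ))) (sym (δ-≢ ρ≢1))))

      module Generic (κ : F) (κ≢0 : ¬ (κ ≡ 0F)) (κ≢1 : ¬ (κ ≡ 1F)) where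

        κ⁻ : F
        κ⁻ = κ +F -F 1F

        k : K
        k = c₀ * C κ

        h G : F → K
        h a = H a (β κ a)
        G ρ = k * (f κ ρ + (δ ρ 1F * - f κ ρ + δ ρ κ * - f κ ρ))

        -- The map a ↦ ρ = κa/β sends 0 and -1 to 0 and κ, infinity to 1, and the zero of β to
        -- infinity; `τ` solves ρ(κ(1 + a) - 1) = κa for a. The two deltas in `G` remove the values
        -- 1 and κ, which no admissible a attains.
        σ τ : F → F
        σ a = κ *F a *F i (β κ a)
        τ ρ = ρ *F κ⁻ *F i (κ *F (1F +F -F ρ))

        κ-1≢0 : ¬ (κ⁻ ≡ 0F)
        κ-1≢0 = FP.diff-≢0 κ≢1

        1-σ : ∀ {a} → ¬ (β κ a ≡ 0F) → 1F +F -F σ a ≡ κ⁻ *F i (β κ a)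
        1-σ {a} b≢0 = linF₁ (-F 1F) (i-r b≢0) (solveF 3 (λ k a v →
          𝟙 ⊕ ⊝ (k ⊗ a ⊗ v) ⊕ ⊝ ((k ⊕ ⊝ 𝟙) ⊗ v) ⊜ ⊝ 𝟙 ⊗ ((k ⊗ (𝟙 ⊕ a) ⊕ ⊝ 𝟙) ⊗ v ⊕ ⊝ 𝟙)) refl κ a (i (β κ a)))

        σ≢1 : ∀ {a} → ¬ (β κ a ≡ 0F) → ¬ (σ a ≡ 1F)
        σ≢1 {a} b≢0 e = FP.*-≢0 κ-1≢0 (i-≢0 b≢0) (trans (sym (1-σ b≢0)) (trans (cong (λ s → 1F +F -F s) e) (FP.-‿inverseʳ 1F)))

        σ≢κ : ∀ {a} → ¬ (1F +F a ≡ 0F) → ¬ (β κ a ≡ 0F) → ¬ (σ a ≡ κ)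
        σ≢κ {a} 1+a≢0 b≢0 e = FP.*-≢0 (FP.*-≢0 κ≢0 (i-≢0 b≢0)) (FP.*-≢0 1+a≢0 κ-1≢0) (linF₂ κ (-F 1F) (i-r b≢0) e
          (solveF 3 (λ k a v → k ⊗ v ⊗ ((𝟙 ⊕ a) ⊗ (k ⊕ ⊝ 𝟙)) ⊕ ⊝ 𝟘 ⊜
            k ⊗ ((k ⊗ (𝟙 ⊕ a) ⊕ ⊝ 𝟙) ⊗ v ⊕ ⊝ 𝟙) ⊕ ⊝ 𝟙 ⊗ (k ⊗ a ⊗ v ⊕ ⊝ k)) refl κ a (i (β κ a))))

        τσ : ∀ {a} → ¬ (β κ a ≡ 0F) → τ (σ a) ≡ a
        τσ {a} b≢0 = linF₂ a (-F (a *F κ *F i (κ *F (1F +F -F σ a)))) (i-r (FP.*-≢0 κ≢0 (subst (λ s → ¬ (s ≡ 0F)) (sym (1-σ b≢0)) (FP.*-≢0 κ-1≢0 (i-≢0 b≢0)))))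
          (1-σ b≢0)
          (solveF 5 (λ k a v d m → k ⊗ a ⊗ v ⊗ (k ⊕ ⊝ 𝟙) ⊗ m ⊕ ⊝ a ⊜ a ⊗ (k ⊗ d ⊗ m ⊕ ⊝ 𝟙) ⊕ ⊝ (a ⊗ k ⊗ m) ⊗ (d ⊕ ⊝ ((k ⊕ ⊝ 𝟙) ⊗ v)))
            refl κ a (i (β κ a)) (1F +F -F σ a) (i (κ *F (1F +F -F σ a))))

        -- Since 1 - ρ = (κ - 1)/β, the argument of φ in the kernel is (κ - 1)² times the one in
        -- `H`, and a nonzero square does not affect φ.
        value : ∀ {a} → ¬ (a ≡ 0F) → ¬ (1F +F a ≡ 0F) → ¬ (β κ a ≡ 0F) → h a ≡ k * f κ (σ a)
        value {a} a≢0 1+a≢0 b≢0 = trans (summand κ≢0 a≢0 1+a≢0 b≢0)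
          (trans (sym (*-assoc _ _ _)) (cong (λ s → k * (D (σ a) * s)) (sym (begin
            φ (κ⁻ *F κ⁻ +F -F (κ *F ((σ a +F -F 1F) *F (σ a +F -F 1F)) *F i (z *F σ a)))
              ≡⟨ cong φ argument ⟩
            φ (κ⁻ *F κ⁻ *F (1F +F c a b))
              ≡⟨ trans (φ-mul _ _) (trans (cong (_* φ (1F +F c a b)) (φ-sq κ-1≢0)) (*-identityˡ _)) ⟩
            φ (1F +F c a b)  ∎))))
          where
          b v : F
          b = β κ a
          v = i b
          σ-1 : σ a +F -F 1F ≡ -F (κ⁻ *F v)
          σ-1 = linF₁ (-F 1F) (1-σ b≢0) (solveF 2 (λ s t → s ⊕ ⊝ 𝟙 ⊕ ⊝ (⊝ t) ⊜ ⊝ 𝟙 ⊗ (𝟙 ⊕ ⊝ s ⊕ ⊝ t)) refl (σ a) (κ⁻ *F v))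
          i-zσ : i (z *F σ a) ≡ i z *F (i κ *F i a *F b)
          i-zσ = trans (i-* _ _) (cong (i z *F_) (trans (i-* _ _) (cong₂ _*F_ (i-* κ a) (i-involutive b))))
          argument : κ⁻ *F κ⁻ +F -F (κ *F ((σ a +F -F 1F) *F (σ a +F -F 1F)) *F i (z *F σ a))
                     ≡ κ⁻ *F κ⁻ *F (1F +F c a b)
          argument = trans
            (cong₂ (λ s t → κ⁻ *F κ⁻ +F -F (κ *F (s *F s) *F t)) σ-1 i-zσ)
            (trans
              (linF₂ (-F (κ⁻ *F κ⁻ *F (v *F i a *F i z) *F (v *F b))) (-F (κ⁻ *F κ⁻ *F (v *F i a *F i z))) (i-r κ≢0) (i-r b≢0)
                (solveF 6 (λ k b v l u w →
                  (k ⊕ ⊝ 𝟙) ⊗ (k ⊕ ⊝ 𝟙) ⊕ ⊝ (k ⊗ (⊝ ((k ⊕ ⊝ 𝟙) ⊗ v) ⊗ ⊝ ((k ⊕ ⊝ 𝟙) ⊗ v)) ⊗ (w ⊗ (l ⊗ u ⊗ b)))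
                    ⊕ ⊝ ((k ⊕ ⊝ 𝟙) ⊗ (k ⊕ ⊝ 𝟙) ⊗ (𝟙 ⊕ v ⊗ (u ⊗ ⊝ w)))
                  ⊜ ⊝ ((k ⊕ ⊝ 𝟙) ⊗ (k ⊕ ⊝ 𝟙) ⊗ (v ⊗ u ⊗ w) ⊗ (v ⊗ b)) ⊗ (k ⊗ l ⊕ ⊝ 𝟙)
                    ⊕ ⊝ ((k ⊕ ⊝ 𝟙) ⊗ (k ⊕ ⊝ 𝟙) ⊗ (v ⊗ u ⊗ w)) ⊗ (b ⊗ v ⊕ ⊝ 𝟙)) refl κ b v (i κ) (i a) (i z)))
              (cong (λ s → κ⁻ *F κ⁻ *F (1F +F s)) (sym (c-expand a b))))

        G-drop : ∀ {ρ} → ¬ (ρ ≡ 1F) → ¬ (ρ ≡ κ) → G ρ ≡ k * f κ ρ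
        G-drop {ρ} n₁ n₂ = trans (cong₂ (λ d e → k * (f κ ρ + (d * - f κ ρ + e * - f κ ρ))) (δ-≢ n₁) (δ-≢ n₂))
          (solve 2 (λ k f → k :* (f :+ (:0 :* :- f :+ :0 :* :- f)) := k :* f) refl _ _)

        to : ∀ a → Dec (a ≡ 0F) → Dec (1F +F a ≡ 0F) → Dec (β κ a ≡ 0F) → h a ≡ 0# ⊎ (τ (σ a) ≡ a × G (σ a) ≡ h a)
        to a (yes e) _ _ = inj₁ (H-0 (β κ a) e)
        to a (no _) (yes e) _ = inj₁ (H-minus-1 (β κ a) e)
        to a (no _) (no _) (yes e) = inj₁ (H-b-0 a e)
        to a (no a≢0) (no 1+a≢0) (no b≢0) = inj₂ (τσ b≢0 , trans (G-drop (σ≢1 b≢0) (σ≢κ 1+a≢0 b≢0)) (sym (value a≢0 1+a≢0 b≢0)))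

        from : ∀ ρ → Dec (ρ ≡ 0F) → Dec (ρ ≡ 1F) → Dec (ρ ≡ κ) → G ρ ≡ 0# ⊎ (σ (τ ρ) ≡ ρ × h (τ ρ) ≡ G ρ)
        from ρ (yes e) _ _ = inj₁ (go f-0)
          where
          f-0 : f κ ρ ≡ 0#
          f-0 = trans (cong₂ _*_ (trans (cong (_* B (i ρ)) (χ-at-0 hA e)) (zeroˡ _)) refl) (zeroˡ _)
          go : ∀ {x d e} → x ≡ 0# → k * (x + (d * - x + e * - x)) ≡ 0#
          go {d = d} {e} refl = solve 3 (λ k d e → k :* (:0 :+ (d :* :- :0 :+ e :* :- :0)) := :0) refl k d e
        from ρ (no _) (yes e) _ = inj₁ (trans (cong₂ (λ d e → k * (f κ ρ + (d * - f κ ρ + e * - f κ ρ))) (δ-≡ e) (δ-≢ λ e′ → κ≢1 (trans (sym e′) e)))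
          (solve 2 (λ k f → k :* (f :+ (:1 :* :- f :+ :0 :* :- f)) := :0) refl _ _))
        from ρ (no _) (no ρ≢1) (yes e) = inj₁ (trans (cong₂ (λ d e → k * (f κ ρ + (d * - f κ ρ + e * - f κ ρ))) (δ-≢ ρ≢1) (δ-≡ e))
          (solve 2 (λ k f → k :* (f :+ (:0 :* :- f :+ :1 :* :- f)) := :0) refl _ _))
        from ρ (no ρ≢0) (no ρ≢1) (no ρ≢κ) = inj₂ (στ , trans (value τ≢0 1+τ≢0 b≢0) (trans (cong (λ s → k * f κ s) στ) (sym (G-drop ρ≢1 ρ≢κ))))
          where
          w m : F
          w = i (1F +F -F ρ)
          m = i (κ *F (1F +F -F ρ))
          1-ρ≢0 : ¬ (1F +F -F ρ ≡ 0F)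
          1-ρ≢0 = FP.diff-≢0 (λ e → ρ≢1 (sym e))
          M≢0 : ¬ (κ *F (1F +F -F ρ) ≡ 0F)
          M≢0 = FP.*-≢0 κ≢0 1-ρ≢0
          κm : κ *F m ≡ w
          κm = sym (i-unique (trans (solveF 3 (λ r k m → (𝟙 ⊕ ⊝ r) ⊗ (k ⊗ m) ⊜ k ⊗ (𝟙 ⊕ ⊝ r) ⊗ m) refl ρ κ m) (i-r M≢0)))
          τ≢0 : ¬ (τ ρ ≡ 0F)
          τ≢0 = FP.*-≢0 (FP.*-≢0 ρ≢0 κ-1≢0) (i-≢0 M≢0)
          b≡ : β κ (τ ρ) ≡ κ⁻ *F w
          b≡ = linF₂ (ρ *F κ⁻) (-F κ⁻) κm (i-r 1-ρ≢0) (solveF 4 (λ k r m w →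
            k ⊗ (𝟙 ⊕ r ⊗ (k ⊕ ⊝ 𝟙) ⊗ m) ⊕ ⊝ 𝟙 ⊕ ⊝ ((k ⊕ ⊝ 𝟙) ⊗ w) ⊜
            r ⊗ (k ⊕ ⊝ 𝟙) ⊗ (k ⊗ m ⊕ ⊝ w) ⊕ ⊝ (k ⊕ ⊝ 𝟙) ⊗ ((𝟙 ⊕ ⊝ r) ⊗ w ⊕ ⊝ 𝟙)) refl κ ρ m w)
          b≢0 : ¬ (β κ (τ ρ) ≡ 0F)
          b≢0 e = FP.*-≢0 κ-1≢0 (i-≢0 1-ρ≢0) (trans (sym b≡) e)
          1+τ≢0 : ¬ (1F +F τ ρ ≡ 0F)
          1+τ≢0 e = FP.*-≢0 (FP.diff-≢0 (λ e → ρ≢κ (sym e))) (i-≢0 M≢0) (trans (linF₁ 1F (i-r M≢0)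
            (solveF 3 (λ k r m → (k ⊕ ⊝ r) ⊗ m ⊕ ⊝ (𝟙 ⊕ r ⊗ (k ⊕ ⊝ 𝟙) ⊗ m) ⊜ 𝟙 ⊗ (k ⊗ (𝟙 ⊕ ⊝ r) ⊗ m ⊕ ⊝ 𝟙)) refl κ ρ m)) e)
          στ : σ (τ ρ) ≡ ρ
          στ = linF₂ ρ (i (β κ (τ ρ))) (i-r b≢0) (trans (trans (solveF 4 (λ k r m d → k ⊗ (r ⊗ d ⊗ m) ⊜ r ⊗ (d ⊗ (k ⊗ m))) refl κ ρ m κ⁻)
              (cong (λ s → ρ *F (κ⁻ *F s)) κm)) (cong (ρ *F_) (sym b≡)))
            (solveF 4 (λ s r b v → s ⊗ v ⊕ ⊝ r ⊜ r ⊗ (b ⊗ v ⊕ ⊝ 𝟙) ⊕ v ⊗ (s ⊕ ⊝ (r ⊗ b))) refl (κ *F τ ρ) ρ (β κ (τ ρ)) (i (β κ (τ ρ))))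

        f-1 : f κ 1F ≡ 1#
        f-1 = trans (cong₂ _*_ (trans (cong₂ _*_ (χ-1 hA) (trans (cong B (i-unique (FP.*-identityˡ 1F))) (χ-1 hB))) (*-identityˡ 1#))
          (trans (cong φ (solveF 2 (λ k t → (k ⊕ ⊝ 𝟙) ⊗ (k ⊕ ⊝ 𝟙) ⊕ ⊝ (k ⊗ ((𝟙 ⊕ ⊝ 𝟙) ⊗ (𝟙 ⊕ ⊝ 𝟙)) ⊗ t) ⊜ (k ⊕ ⊝ 𝟙) ⊗ (k ⊕ ⊝ 𝟙)) refl κ (i (z *F 1F)))) (φ-sq κ-1≢0)))
          (*-identityˡ 1#)

        f-κ : f κ κ ≡ D κ * φ₁
        f-κ = cong (D κ *_) (trans (cong φ (trans (cong (λ s → κ⁻ *F κ⁻ +F -F (κ *F (κ⁻ *F κ⁻) *F s)) (i-* z κ))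
            (linF₁ (-F (κ⁻ *F κ⁻ *F i z)) (i-r κ≢0) (solveF 4 (λ k l d w → d ⊗ d ⊕ ⊝ (k ⊗ (d ⊗ d) ⊗ (w ⊗ l)) ⊕ ⊝ (d ⊗ d ⊗ (𝟙 ⊕ ⊝ w)) ⊜ ⊝ (d ⊗ d ⊗ w) ⊗ (k ⊗ l ⊕ ⊝ 𝟙)) refl κ (i κ) κ⁻ (i z)))))
          (trans (φ-mul _ _) (trans (cong (_* φ₁) (φ-sq κ-1≢0)) (*-identityˡ _))))

        row : Σ h ≡ target κ
        row = begin
          Σ h   ≡⟨ reindex σ τ (λ a → to a (a ≟ 0F) ((1F +F a) ≟ 0F) (β κ a ≟ 0F)) (λ ρ → from ρ (ρ ≟ 0F) (ρ ≟ 1F) (ρ ≟ κ)) ⟩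
          Σ G   ≡⟨ trans (Σ-*ˡ k) (cong (k *_) (trans (Σ-+) (cong (Σ (f κ) +_) (trans (Σ-+)
                     (cong₂ _+_ (Σ-δ (λ ρ → - f κ ρ) 1F) (Σ-δ (λ ρ → - f κ ρ) κ)))))) ⟩
          k * (Σ (f κ) + (- f κ 1F + - f κ κ))
            ≡⟨ cong₂ (λ s t → k * (Σ (f κ) + (- s + - t))) f-1 f-κ ⟩
          k * (Σ (f κ) + (- 1# + - (D κ * φ₁)))
            -- The term A² of the target arises here, as C(κ) D(κ) = A(κ)².
            ≡⟨ lin₁ (- (c₀ * A κ * A κ * φ₁)) (χ-i hB κ≢0)
                 (solve 6 (λ c a b b′ s p → c :* (a :* b) :* (s :+ (:- :1 :+ :- (a :* b′ :* p)))
                   :+ :- (c :* (a :* b :* s :+ (:- (a :* b) :+ :- (a :* a :* p))))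
                   := (:- (c :* a :* a :* p)) :* (b :* b′ :+ :- :1)) refl (c₀) (A κ) (B κ) (B (i κ)) (Σ (f κ)) (φ₁)) ⟩
          target κ  ∎

      row : ∀ κ → Dec (κ ≡ 0F) → Dec (κ ≡ 1F) → Σ (λ a → H a (β κ a)) ≡ target κ
      row κ (yes refl) _ = row-0
      row κ (no _) (yes refl) = row-1
      row κ (no κ≢0) (no κ≢1) = Generic.row κ κ≢0 κ≢1

    S≡U : S A B z ≡ U A B z
    S≡U = begin
      S A B z
        ≡⟨ trans (Σ-cong (λ a → substitute a ((1F +F a) ≟ 0F))) (Σ-swap) ⟩
      Σ (λ κ → Σ (λ a → H a (β κ a)))
        ≡⟨ Σ-cong (λ κ → row κ (κ ≟ 0F) (κ ≟ 1F)) ⟩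
      Σ target
        ≡⟨ Σ-*ˡ (c₀) ⟩
      c₀ * Σ (λ κ → C κ * Σ (f κ) + (- C κ + - (A² κ * φ₁)))
        ≡⟨ cong (c₀ *_) (trans (Σ-+) (trans (cong (Σ (λ κ → C κ * Σ (f κ)) +_) corrections) (+-identityʳ _))) ⟩
      U A B z  ∎
      where
      -- Summed over κ, the corrections are multiples of Σ AB and Σ A², both of which are 0.
      corrections : Σ (λ κ → - C κ + - (A² κ * φ₁)) ≡ 0#
      corrections = begin
        Σ (λ κ → - C κ + - (A² κ * φ₁))
          ≡⟨ Σ-cong (λ κ → solve 3 (λ c a p → :- c :+ :- (a :* p) := (:- :1) :* c :+ (:- p) :* a) refl _ _ _) ⟩
        Σ (λ κ → - 1# * C κ + - φ₁ * A² κ)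
          ≡⟨ trans (Σ-+) (cong₂ _+_ (trans (Σ-*ˡ (- 1#)) (cong (- 1# *_) nC)) (trans (Σ-*ˡ (- φ₁)) (cong (- φ₁ *_) nA²))) ⟩
        - 1# * 0# + - φ₁ * 0#
          ≡⟨ solve 2 (λ a b → a :* :0 :+ b :* :0 := :0) refl _ _ ⟩
        0#  ∎

  -- Clausen's formula

  inv-* : ∀ {x y} → ¬ (x ≡ 0#) → ¬ (y ≡ 0#) → inv (x * y) ≡ inv x * inv y
  inv-* {x} {y} x≢0 y≢0 = KF.*-cancelˡ-≢0 (KF.*-≢0 x≢0 y≢0) (trans (inv-r _ (KF.*-≢0 x≢0 y≢0))
    (lin₂ (- (y * inv y)) (- 1#) (inv-r x x≢0) (inv-r y y≢0)
      (solve 4 (λ x y u v → :1 :+ :- (x :* y :* (u :* v)) := (:- (y :* v)) :* (x :* u :+ :- :1) :+ (:- :1) :* (y :* v :+ :- :1)) refl _ _ _ _)))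

  ∑-χ-at-0 : ∀ (b : Char → K) → ∑ allChars (λ χ → b χ * χ 0F) ≡ 0#
  ∑-χ-at-0 b = trans (∑-map χ[_] (upTo N) _) (trans
    (∑-cong (upTo N) (λ k → trans (cong (b χ[ k ] *_) (χ-0 (χ[k]-isCharacter k))) (zeroʳ _))) (∑-0 (upTo N)))

  ₂F₁-at-0 : ∀ A₀ A₁ B₁ → ₂F₁ A₀ A₁ B₁ 0F ≡ 0#
  ₂F₁-at-0 A₀ A₁ B₁ = trans (cong ((qK / (N ×1)) *_) (∑-χ-at-0 (λ χ → binom (A₀ · χ) χ * binom (A₁ · χ) (B₁ · χ)))) (zeroʳ _)

  ₃F₂-at-0 : ∀ A₀ A₁ A₂ B₁ B₂ → ₃F₂ A₀ A₁ A₂ B₁ B₂ 0F ≡ 0#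
  ₃F₂-at-0 A₀ A₁ A₂ B₁ B₂ = trans (cong ((qK / (N ×1)) *_)
    (∑-χ-at-0 (λ χ → binom (A₀ · χ) χ * binom (A₁ · χ) (B₁ · χ) * binom (A₂ · χ) (B₂ · χ)))) (zeroʳ _)

  gauss-φ² : g φ * g φ ≡ φ (-F 1F) * qK
  gauss-φ² = trans (cong (g φ *_) (gauss-cong (λ x → sym (trans (conj-i φ-isCharacter x) (φ-i x)))))
    (gauss-conj φ-isCharacter φ-nontrivial)

  module _ {A B : Char} (hA : IsCharacter A) (hB : IsCharacter B)
           (nA : Nontrivial A) (nB : Nontrivial B) (nA² : Nontrivial (A · A)) (nB² : Nontrivial (B · B))
           (nAφ : Nontrivial (A · φ)) (nBφ : Nontrivial (B · φ)) (nC : Nontrivial (A · B))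
           (nDφ : Σ (λ ρ → ratio A B ρ * φ ρ) ≡ 0#) where

    private
      G C₄ c a₂ b₂ a′ b′ q′ : K
      G = g B * g B * g (A · φ) * g (A · φ)
      C₄ = (A · B) 4F
      c = (A · B · φ) (-F 1F)
      a₂ = g (A · A)
      b₂ = g (B · B)
      a′ = inv a₂
      b′ = inv b₂
      q′ = inv qK

      hC : IsCharacter (A · B)
      hC = ·-isCharacter hA hB
      a₂≢0 : ¬ (a₂ ≡ 0#)
      a₂≢0 = gauss-≢0 (·-isCharacter hA hA) nA²
      b₂≢0 : ¬ (b₂ ≡ 0#)
      b₂≢0 = gauss-≢0 (·-isCharacter hB hB) nB²

    -- The product of the Hasse-Davenport relations for A and for B; the resulting g(φ)² accounts
    -- for φ(-1) q.
    gauss-duplication : φ (-F 1F) * (qK * a₂ * b₂) ≡ C₄ * (g A * g (A · φ) * (g B * g (B · φ)))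
    gauss-duplication = begin
      φ (-F 1F) * (qK * a₂ * b₂)
        ≡⟨ trans (solve 4 (λ s q a b → s :* (q :* a :* b) := (s :* q) :* (a :* b)) refl _ _ _ _) (cong (_* (a₂ * b₂)) (sym gauss-φ²)) ⟩
      g φ * g φ * (a₂ * b₂)
        ≡⟨ solve 3 (λ f a b → f :* f :* (a :* b) := (a :* f) :* (b :* f)) refl _ _ _ ⟩
      (a₂ * g φ) * (b₂ * g φ)
        ≡⟨ sym (cong₂ _*_ (hasse-davenport hA nA nA² nAφ) (hasse-davenport hB nB nB² nBφ)) ⟩
      (A 4F * (g A * g (A · φ))) * (B 4F * (g B * g (B · φ)))
        ≡⟨ solve 6 (λ a b c d e f → a :* (b :* c) :* (d :* (e :* f)) := a :* d :* (b :* c :* (e :* f))) refl _ _ _ _ _ _ ⟩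
      C₄ * (g A * g (A · φ) * (g B * g (B · φ)))  ∎

    -- `gauss-duplication` supplies the g(A) g(Bφ) that `P-symmetry` exchanges for g(B) g(Aφ).
    -- Together with the second copy of g(B) g(Aφ) this is the origin of the constant `G`.
    P-ratio : ∀ z → qK * a₂ * b₂ * P A B z ≡ C₄ * G * c * P B A z
    P-ratio z = begin
      qK * a₂ * b₂ * P A B z
        ≡⟨ trans (solve 1 (λ x → x := :1 :* x) refl _) (trans (cong (_* (qK * a₂ * b₂ * P A B z)) (sym (χ-neg² φ-isCharacter)))
             (solve 3 (λ s x p → s :* s :* (x :* p) := s :* (s :* x) :* p) refl _ _ _)) ⟩
      φ (-F 1F) * (φ (-F 1F) * (qK * a₂ * b₂)) * P A B z
        ≡⟨ cong (λ x → φ (-F 1F) * x * P A B z) gauss-duplication ⟩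
      φ (-F 1F) * (C₄ * (g A * g (A · φ) * (g B * g (B · φ)))) * P A B z
        ≡⟨ solve 7 (λ s c a b d e p → s :* (c :* (a :* b :* (d :* e))) :* p := s :* c :* b :* d :* (a :* e :* p)) refl _ _ _ _ _ _ _ ⟩
      φ (-F 1F) * C₄ * g (A · φ) * g B * (g A * g (B · φ) * P A B z)
        ≡⟨ cong (φ (-F 1F) * C₄ * g (A · φ) * g B *_) (P-symmetry hA hB nA nB nAφ nBφ z) ⟩
      φ (-F 1F) * C₄ * g (A · φ) * g B * ((A · B) (-F 1F) * (g B * g (A · φ)) * P B A z)
        ≡⟨ solve 6 (λ s c a b e p → s :* c :* a :* b :* (e :* (b :* a) :* p) := c :* (b :* b :* a :* a) :* (e :* s) :* p) refl _ _ _ _ _ _ ⟩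
      C₄ * G * c * P B A z  ∎

    -- The assumption φ(1 - z) = 1 removes φ(y) from the exceptional term. That term is evaluated at
    -- z, while the theorem has it at w = z/4; the factor AB(4) produced by duplication makes
    -- exactly this difference, as φ(4) = 1.
    clausen : ∀ {z w} → z ≡ 4F *F w → ¬ (z ≡ 0F) → ¬ (1F +F -F z ≡ 0F) → φ (1F +F -F z) ≡ 1# →
      ₂F₁ A B (A · B · φ) z * ₂F₁ A B (A · B · φ) z
      ≡ (C₄ * G) / (qK * a₂ * b₂) * ₃F₂ (A · A) (B · B) (A · B) ((A · A) · (B · B)) (A · B · φ) z
        + (G * (conj A · conj B · φ) w) / (qK * qK * a₂ * b₂)
    clausen {z} {w} z≡4w z≢0 1-z≢0 φ[1-z]≡1 = begin
      ₂F₁ A B (A · B · φ) z * ₂F₁ A B (A · B · φ) z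
        ≡⟨ cong₂ _*_ (₂F₁-sum hA hB z≢0) (₂F₁-sum hA hB z≢0) ⟩
      c * q′ * P₁ * (c * q′ * P₁)
        ≡⟨ lin₁ (q′ * q′ * P₁ * P₁) cc≡1 (solve 3 (λ c q p → c :* q :* p :* (c :* q :* p) :+ :- (q :* q :* (:1 :* (:1 :* :1) :* p :* p)) :=
             q :* q :* p :* p :* (c :* c :+ :- :1)) refl _ _ _) ⟩
      q′ * q′ * (1# * (1# * 1#) * P₁ * P₁)
        -- The factors 1 are expanded so that q g(A²) g(B²) stands next to one copy of P(A,B), as
        -- `P-ratio` requires.
        ≡⟨ cong (λ u → q′ * q′ * (u * P₁ * P₁)) (sym (cong₂ _*_ (inv-r qK qK≢0) (cong₂ _*_ (inv-r a₂ a₂≢0) (inv-r b₂ b₂≢0)))) ⟩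
      q′ * q′ * (qK * q′ * (a₂ * a′ * (b₂ * b′)) * P₁ * P₁)
        ≡⟨ solve 7 (λ q q′ a a′ b b′ p → q′ :* q′ :* (q :* q′ :* (a :* a′ :* (b :* b′)) :* p :* p)
             := q′ :* q′ :* (q′ :* a′ :* b′) :* (q :* a :* b :* p) :* p) refl _ _ _ _ _ _ _ ⟩
      q′ * q′ * (q′ * a′ * b′) * (qK * a₂ * b₂ * P₁) * P₁
        ≡⟨ cong (λ u → q′ * q′ * (q′ * a′ * b′) * u * P₁) (P-ratio z) ⟩
      q′ * q′ * (q′ * a′ * b′) * (C₄ * G * c * P₂) * P₁
        ≡⟨ solve 5 (λ x y c p r → x :* (y :* c :* r) :* p := x :* (y :* c) :* (p :* r)) refl _ _ _ _ _ ⟩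
      q′ * q′ * (q′ * a′ * b′) * (C₄ * G * c) * (P₁ * P₂)
        ≡⟨ cong (q′ * q′ * (q′ * a′ * b′) * (C₄ * G * c) *_) (trans (P-product-formula hA hB nA nB nAφ nBφ z≢0 1-z≢0)
             (cong₂ _+_ (sym (S≡U hA hB nA² nC nDφ z≢0)) extra)) ⟩
      q′ * q′ * (q′ * a′ * b′) * (C₄ * G * c) * (S A B z + c * Λ * qK)
        ≡⟨ lin₂ (q′ * q′ * (q′ * a′ * b′) * C₄ * G * Λ * qK) (q′ * q′ * a′ * b′ * C₄ * G * Λ) cc≡1 (inv-r qK qK≢0)
             (solve 9 (λ q q′ a′ b′ d g c s l →
               q′ :* q′ :* (q′ :* a′ :* b′) :* (d :* g :* c) :* (s :+ c :* l :* q)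
               :+ :- (d :* g :* (q′ :* a′ :* b′) :* (c :* (q′ :* q′) :* s) :+ g :* (d :* l) :* (q′ :* q′ :* a′ :* b′))
               := q′ :* q′ :* (q′ :* a′ :* b′) :* d :* g :* l :* q :* (c :* c :+ :- :1)
                  :+ q′ :* q′ :* a′ :* b′ :* d :* g :* l :* (q :* q′ :+ :- :1)) refl qK q′ a′ b′ C₄ G c (S A B z) Λ) ⟩
      C₄ * G * (q′ * a′ * b′) * (c * (q′ * q′) * S A B z) + G * (C₄ * Λ) * (q′ * q′ * a′ * b′)
        ≡⟨ sym (cong₂ _+_
             (cong₂ (λ u v → C₄ * G * u * v)
               (trans (inv-* (KF.*-≢0 qK≢0 a₂≢0) b₂≢0) (cong (_* b′) (inv-* qK≢0 a₂≢0)))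
               (trans (₃F₂-sum hA hB z) (cong (λ u → c * u * S A B z) (inv-* qK≢0 qK≢0))))
             (cong₂ (λ u v → G * u * v) twist
               (trans (inv-* (KF.*-≢0 (KF.*-≢0 qK≢0 qK≢0) a₂≢0) b₂≢0)
                 (cong (_* b′) (trans (inv-* (KF.*-≢0 qK≢0 qK≢0) a₂≢0) (cong (_* a′) (inv-* qK≢0 qK≢0))))))) ⟩
      (C₄ * G) / (qK * a₂ * b₂) * ₃F₂ (A · A) (B · B) (A · B) ((A · A) · (B · B)) (A · B · φ) z
        + (G * (conj A · conj B · φ) w) / (qK * qK * a₂ * b₂)  ∎
      where
      P₁ P₂ Λ : K
      P₁ = P A B z
      P₂ = P B A z
      Λ = (A · B) (i z) * φ z
      4≢0 : ¬ (4F ≡ 0F)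
      4≢0 e = FP.*-≢0 2≢0 2≢0 (trans (solveF 0 ((𝟙 ⊕ 𝟙) ⊗ (𝟙 ⊕ 𝟙) ⊜ 𝟙 ⊕ 𝟙 ⊕ (𝟙 ⊕ 𝟙)) refl) e)
      cc≡1 : c * c ≡ 1#
      cc≡1 = χ-neg² (·-isCharacter hC φ-isCharacter)
      extra : (A · B) (-F i z) * (qK * φ (-F ((1F +F -F z) *F i z))) ≡ c * Λ * qK
      extra = trans (cong₂ (λ s t → s * (qK * t))
          (trans (cong (A · B) (solveF 1 (λ u → ⊝ u ⊜ ⊝ 𝟙 ⊗ u) refl (i z))) (χ-mul hC _ _))
          (trans (cong φ (solveF 2 (λ y u → ⊝ (y ⊗ u) ⊜ ⊝ 𝟙 ⊗ (y ⊗ u)) refl (1F +F -F z) (i z)))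
            (trans (φ-mul _ _) (cong (φ (-F 1F) *_) (trans (φ-mul _ _) (cong₂ _*_ φ[1-z]≡1 (φ-i z)))))))
        (solve 5 (λ e u q s f → e :* u :* (q :* (s :* (:1 :* f))) := e :* s :* (u :* f) :* q) refl ((A · B) (-F 1F)) ((A · B) (i z)) qK (φ (-F 1F)) (φ z))
      twist : (conj A · conj B · φ) w ≡ C₄ * Λ
      twist = sym (begin
        C₄ * ((A · B) (i z) * φ z)
          ≡⟨ cong₂ (λ s t → C₄ * (s * t))
               (trans (cong (λ s → (A · B) (i s)) z≡4w) (trans (cong (A · B) (i-* 4F w)) (χ-mul hC _ _)))
               (trans (cong φ z≡4w) (trans (φ-mul 4F w) (trans (cong (_* φ w) φ4≡1) (*-identityˡ _)))) ⟩
        C₄ * ((A · B) (i 4F) * (A · B) (i w) * φ w)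
          ≡⟨ lin₁ ((A · B) (i w) * φ w) (χ-i hC 4≢0) (solve 4 (λ c u v f → c :* (u :* v :* f) :+ :- (v :* f) := v :* f :* (c :* u :+ :- :1)) refl C₄ ((A · B) (i 4F)) ((A · B) (i w)) (φ w)) ⟩
        (A · B) (i w) * φ w
          ≡⟨ cong (_* φ w) (sym (cong₂ _*_ (conj-i hA w) (conj-i hB w))) ⟩
        (conj A · conj B · φ) w  ∎)
        where
        φ4≡1 : φ 4F ≡ 1#
        φ4≡1 = trans (cong φ (solveF 0 (𝟙 ⊕ 𝟙 ⊕ (𝟙 ⊕ 𝟙) ⊜ (𝟙 ⊕ 𝟙) ⊗ (𝟙 ⊕ 𝟙)) refl)) (φ-sq 2≢0)

  ε-0 : ∀ {x} → x ≡ 0F → ε x ≡ 0#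
  ε-0 {x} e with x ≟ 0F
  ... | yes _ = refl
  ... | no ne = ⊥-elim (ne e)

  ε-≢0 : ∀ {x} → ¬ (x ≡ 0F) → ε x ≡ 1#
  ε-≢0 {x} ne with x ≟ 0F
  ... | yes e = ⊥-elim (ne e)
  ... | no _ = refl

  -- Together with `φ-twist-ε⇒square-ε` this derives the nontriviality of A and Aφ from A² ≠ ε
  -- alone, and likewise for B.
  ε⇒square-ε : ∀ {A} → A ≈χ ε → (A · A) ≈χ ε
  ε⇒square-ε e x = trans (cong₂ _*_ (e x) (e x)) (cases (x ≟ 0F))
    where
    cases : Dec (x ≡ 0F) → ε x * ε x ≡ ε x
    cases (yes e) = trans (cong (ε x *_) (ε-0 e)) (trans (zeroʳ _) (sym (ε-0 e)))
    cases (no ne) = trans (cong (ε x *_) (ε-≢0 ne)) (*-identityʳ _)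

  φ-twist-ε⇒square-ε : ∀ {A} → IsCharacter A → (A · φ) ≈χ ε → (A · A) ≈χ ε
  φ-twist-ε⇒square-ε {A} hA e x = cases (x ≟ 0F)
    where
    cases : Dec (x ≡ 0F) → (A · A) x ≡ ε x
    cases (yes x≡0) = trans (χ-at-0 (·-isCharacter hA hA) x≡0) (sym (ε-0 x≡0))
    cases (no ne) = trans (lin₁ (- (A x * A x)) (φ²≡1 ne) (solve 2 (λ a f → a :* a :+ :- (a :* f :* (a :* f)) := (:- (a :* a)) :* (f :* f :+ :- :1)) refl _ _))
      (ε⇒square-ε e x)

  module _ {A B : Char} (hA : IsCharacter A) (hB : IsCharacter B)
           (A²≉ε : ¬ ((A · A) ≈χ ε)) (B²≉ε : ¬ ((B · B) ≈χ ε))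
           (AB̄φ≉ε : ¬ ((A · conj B · φ) ≈χ ε)) (AB≉ε : ¬ ((A · B) ≈χ ε)) where

    private
      z : F → F
      z x = 4F *F (x *F (1F +F -F x))

      G : K
      G = g B * g B * g (A · φ) * g (A · φ)

    square-formula : ∀ x → ¬ (x ≡ 1F) → ¬ (x ≡ invF 2F) →
      ₂F₁ A B (A · B · φ) (z x) * ₂F₁ A B (A · B · φ) (z x)
      ≡ ((A · B) 4F * G) / (qK * g (A · A) * g (B · B))
          * ₃F₂ (A · A) (B · B) (A · B) ((A · A) · (B · B)) (A · B · φ) (z x)
        + (G * (conj A · conj B · φ) (x +F -F (x *F x))) / (qK * qK * g (A · A) * g (B · B))
    square-formula x x≢1 x≢½ = cases (x ≟ 0F)
      where
      cases : Dec (x ≡ 0F) → _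
      -- At x = 0 the argument z is 0, where `₂F₁-sum` does not apply. Every character vanishes at
      -- 0, so both sides are 0.
      cases (yes refl) = trans
        (trans (cong₂ _*_ (trans (cong (₂F₁ A B (A · B · φ)) z≡0) (₂F₁-at-0 A B (A · B · φ))) refl) (zeroˡ _))
        (sym (trans (cong₂ (λ s t → s₁ * s + (G * t) / s₂) (trans (cong F₃ z≡0) (₃F₂-at-0 (A · A) (B · B) (A · B) ((A · A) · (B · B)) (A · B · φ))) w-0)
          (solve 3 (λ a g b → a :* :0 :+ g :* :0 :* b := :0) refl _ _ _)))
        where
        F₃ : F → K
        F₃ = ₃F₂ (A · A) (B · B) (A · B) ((A · A) · (B · B)) (A · B · φ)
        s₁ s₂ : K
        s₁ = ((A · B) 4F * G) / (qK * g (A · A) * g (B · B))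
        s₂ = qK * qK * g (A · A) * g (B · B)
        z≡0 : z 0F ≡ 0F
        z≡0 = solveF 1 (λ f → f ⊗ (𝟘 ⊗ (𝟙 ⊕ ⊝ 𝟘)) ⊜ 𝟘) refl 4F
        w-0 : (conj A · conj B · φ) (0F +F -F (0F *F 0F)) ≡ 0#
        w-0 = χ-at-0 (·-isCharacter (·-isCharacter (conj-isCharacter hA) (conj-isCharacter hB)) φ-isCharacter)
          (solveF 0 (𝟘 ⊕ ⊝ (𝟘 ⊗ 𝟘) ⊜ 𝟘) refl)
      cases (no x≢0) = clausen hA hB
        (≉ε⇒nontrivial hA (λ e → A²≉ε (ε⇒square-ε e))) (≉ε⇒nontrivial hB (λ e → B²≉ε (ε⇒square-ε e)))
        (≉ε⇒nontrivial (·-isCharacter hA hA) A²≉ε) (≉ε⇒nontrivial (·-isCharacter hB hB) B²≉ε)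
        (≉ε⇒nontrivial (·-isCharacter hA φ-isCharacter) (λ e → A²≉ε (φ-twist-ε⇒square-ε hA e)))
        (≉ε⇒nontrivial (·-isCharacter hB φ-isCharacter) (λ e → B²≉ε (φ-twist-ε⇒square-ε hB e)))
        (≉ε⇒nontrivial (·-isCharacter hA hB) AB≉ε)
        (trans (Σ-cong (λ ρ → cong (λ s → A ρ * s * φ ρ) (sym (conj-i hB ρ))))
          (≉ε⇒nontrivial (·-isCharacter (·-isCharacter hA (conj-isCharacter hB)) φ-isCharacter) AB̄φ≉ε))
        (solveF 2 (λ f x → f ⊗ (x ⊗ (𝟙 ⊕ ⊝ x)) ⊜ f ⊗ (x ⊕ ⊝ (x ⊗ x))) refl 4F x)
        (FP.*-≢0 4≢0 (FP.*-≢0 x≢0 (FP.diff-≢0 (λ e → x≢1 (sym e)))))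
        (λ e → FP.*-≢0 s≢0 s≢0 (trans (sym 1-z≡s²) e))
        (trans (cong φ 1-z≡s²) (φ-sq s≢0))
        where
        4≢0 : ¬ (4F ≡ 0F)
        4≢0 e = FP.*-≢0 2≢0 2≢0 (trans (solveF 0 ((𝟙 ⊕ 𝟙) ⊗ (𝟙 ⊕ 𝟙) ⊜ 𝟙 ⊕ 𝟙 ⊕ (𝟙 ⊕ 𝟙)) refl) e)
        s : F
        s = 1F +F -F (2F *F x)
        s≢0 : ¬ (s ≡ 0F)
        s≢0 e = x≢½ (trans (sym (i-unique (linF₁ (-F 1F) e (solveF 1 (λ x → (𝟙 ⊕ 𝟙) ⊗ x ⊕ ⊝ 𝟙 ⊜ ⊝ 𝟙 ⊗ (𝟙 ⊕ ⊝ ((𝟙 ⊕ 𝟙) ⊗ x) ⊕ ⊝ 𝟘)) refl x)))) (i-inv 2≢0))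
        1-z≡s² : 1F +F -F z x ≡ s *F s
        1-z≡s² = solveF 1 (λ x → 𝟙 ⊕ ⊝ ((𝟙 ⊕ 𝟙 ⊕ (𝟙 ⊕ 𝟙)) ⊗ (x ⊗ (𝟙 ⊕ ⊝ x))) ⊜ (𝟙 ⊕ ⊝ ((𝟙 ⊕ 𝟙) ⊗ x)) ⊗ (𝟙 ⊕ ⊝ ((𝟙 ⊕ 𝟙) ⊗ x))) refl x

theorem1p3 : (𝔽 : FiniteField) (𝕂 : CharZeroField) (ζ ω : CharZeroField.K 𝕂) →
    Setup.Theorem1p3 𝔽 𝕂 ζ ω
theorem1p3 𝔽 𝕂 ζ ω ζ^p≡1 ζ≢1 ω^N≡1 ω-primitive A B hA hB A²≉ε B²≉ε AB̄φ≉ε AB≉ε _ x x≢1 x≢½ =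
  Clausen.square-formula 𝔽 𝕂 ζ ω ζ^p≡1 ζ≢1 ω^N≡1 ω-primitive hA hB A²≉ε B²≉ε AB̄φ≉ε AB≉ε x x≢1 x≢½
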